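{- Let $n$, $k$, $r$ be positive integers with $n \geq k \geq r\geq 3$ and $r > t$, where $t=\lfloor (n-1)/2\rfloor$. If $H$ is an $n$-vertex $r$-uniform hypergraph with $\delta(H) \geq \lfloor \frac{r(k-1)}{n} \rfloor+1$, then $H$ contains a Berge cycle of length $k$ or longer.
   Context: A hypergraph is a family of (distinct) subsets, called edges, of a vertex set; it is $r$-uniform if every edge has exactly $r$ vertices. $\delta(H)$ denotes the minimum number of edges containing a vertex. A Berge cycle of length $\ell$ is a list $v_1, e_1, v_2, \ldots, v_\ell, e_\ell, v_1$ of $\ell$ distinct vertices and $\ell$ distinct edges with $\{v_i, v_{i+1}\} \subseteq e_i$ for all $i$ (indices modulo $\ell$). -}

module Defs where

open import Data.Nat using (ℕ; zero; suc; _+_; _*_; _∸_; _≤_; _<_; _/_; NonZero)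
open import Data.Fin using (Fin; toℕ; fromℕ<)
open import Data.Fin.Subset using (Subset; _∈_; ∣_∣)
open import Data.Fin.Subset.Properties using (_∈?_)
open import Data.Vec using (tabulate)
open import Data.Bool using (Bool)
open import Relation.Nullary.Decidable using (does)
open import Data.Product using (Σ; _×_; _,_)
open import Function.Definitions using (Injective)
open import Relation.Binary.PropositionalEquality using (_≡_)
open import Data.Nat.DivMod using (_mod_)

record UniformHypergraph (n r : ℕ) : Set where
  field
    m        : ℕ
    edge     : Fin m → Subset n
    distinct : Injective _≡_ _≡_ edge
    uniform  : ∀ e → ∣ edge e ∣ ≡ r

open UniformHypergraph public

degree : ∀ {n r} (H : UniformHypergraph n r) → Fin n → ℕ
degree H v = ∣ tabulate (λ e → does (v ∈? edge H e)) ∣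

MinDegreeAtLeast : ∀ {n r} → UniformHypergraph n r → ℕ → Set
MinDegreeAtLeast H d = ∀ v → d ≤ degree H v

next : ∀ {ℓ} → Fin ℓ → Fin ℓ
next {suc ℓ} i = (suc (toℕ i)) mod (suc ℓ)

record BergeCycle {n r} (H : UniformHypergraph n r) (ℓ : ℕ) : Set where
  field
    vtx      : Fin ℓ → Fin n
    edg      : Fin ℓ → Fin (m H)
    vtx-inj  : Injective _≡_ _≡_ vtx
    edg-inj  : Injective _≡_ _≡_ edg
    here∈    : ∀ i → vtx i ∈ edge H (edg i)
    next∈    : ∀ i → vtx (next i) ∈ edge H (edg i)

HasLongBergeCycle : ∀ {n r} → UniformHypergraph n r → ℕ → Set
HasLongBergeCycle H k = Σ ℕ (λ ℓ → k ≤ ℓ × BergeCycle H ℓ)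

{-# OPTIONS --safe #-}
module Submission where

open import Defs
open import Data.Nat hiding (parity; equal)
open import Data.Nat.Properties
open import Data.Nat.DivMod using (_%_; m≡m%n+[m/n]*n; m%n<n; [m+kn]%n≡m%n; m<n⇒m%n≡m; n%n≡0)
open import Data.Nat.Tactic.RingSolver using (solve-∀)
open import Data.Fin using (Fin; toℕ; fromℕ<)
import Data.Fin as Fin
import Data.Fin.Properties as Fin
open import Data.Fin.Subset using (Subset; ∣_∣)
import Data.Fin.Subset.Properties as Subset
open import Data.Bool using (Bool; true; false; _∧_; _∨_; not; if_then_else_)
import Data.Bool.Properties as Bool
open import Data.Product using (_×_; _,_; proj₁; proj₂; ∃)
open import Data.Sum using (_⊎_; inj₁; inj₂)
import Data.Sum.Properties as Sum
open import Data.Empty using (⊥; ⊥-elim)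
import Data.Vec as Vec
open import Data.List using (List; []; _∷_; _++_; length; reverse; applyUpTo)
open import Data.List.Properties using (length-++; length-reverse; length-applyUpTo; unfold-reverse)
open import Data.List.Membership.Propositional using (_∈_)
open import Data.List.Membership.DecPropositional using (_∈?_)
open import Data.List.Membership.Propositional.Properties using (∈-applyUpTo⁺; ∈-applyUpTo⁻; ∈-++⁻; ∈-++⁺ˡ; ∈-++⁺ʳ)
open import Data.List.Relation.Unary.Any using (here; there; any?)
open import Data.List.Relation.Unary.All using (All; []; _∷_)
import Data.List.Relation.Unary.All as All
open import Data.List.Relation.Unary.AllPairs using ([]; _∷_)
open import Data.List.Relation.Unary.Unique.Propositional using (Unique)
import Data.List.Relation.Unary.Unique.Propositional.Properties as Unique
open import Data.List.Relation.Unary.Unique.DecPropositional using (unique?)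
open import Data.List.Relation.Binary.Disjoint.Propositional using (Disjoint)
open import Data.List.Relation.Binary.Permutation.Propositional using (↭-sym; ↭⇒↭ₛ)
open import Data.List.Relation.Binary.Permutation.Propositional.Properties using (↭-reverse; ∈-resp-↭)
import Data.List.Relation.Binary.Permutation.Setoid.Properties as Permₛ
open import Relation.Nullary using (¬_; Dec; yes; no; does; contradiction)
open import Relation.Nullary.Decidable using (map′; _×-dec_; _⊎-dec_)
open import Relation.Binary.Definitions using (tri<; tri≈; tri>; DecidableEquality)
open import Relation.Binary.PropositionalEquality
open import Function using (_∘_; id)

-- We work in the bipartite incidence graph between vertices and edges. Since n ≤ 2r, any two
-- disjoint edges are complementary, double counting gives at least k edges, and the degree bound d
-- satisfies k ≤ 2d. Let C be a longest Berge cycle and suppose that its length l is less than k, so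
-- that some edge and some vertex lie outside C. For an outer edge f let S f be the set of positions
-- i with v i ∈ f, and for an outer vertex x let T x be the set of positions i with x ∈ e i.
--
-- An outer path whose ends attach to C at distinct positions cannot shortcut C. Because edges are
-- large and distinct, this first forces every outer edge to meet C at least twice. Now take an outer
-- path P from an edge f to an edge g, as long as possible. If f has an outer neighbour z off P, then
-- T z avoids a neighbourhood of S g whose size grows with P, so r + d is at most l plus the number
-- of outer neighbours of g off P; applied at both ends, this either yields two common neighbours of
-- f and g, for which the same count gives 2d ≤ l, or leaves exactly one outer vertex. If neither end
-- has such a neighbour, then S f and S g are equal or far apart, and counting yields f = g. The
-- remaining case is n = 2r = 2d = l + 1; there an outer edge is exchanged with an edge of C.

-- Linear arithmetic

-- The counting leaves almost no slack. An edge has at least half of all vertices, and a vertex lies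
-- in more than `l / 2` edges; so, apart from what lies off C, the sets `S f` and `T x` each take up
-- about half of the `l` positions. Every rerouting forbids certain distances between two such sets.
-- An outer path with `h` vertices can absorb up to `h` vertices of an end edge and up to `h + 1`
-- edges through an outer vertex, but it also widens the forbidden distances, and in the main
-- estimates these effects cancel. The estimates need two attachments to C for each outer edge,
-- which is why edges that barely touch C are excluded separately by direct constructions. There the
-- obstacle is that two edges need not intersect. The substitute is that an edge has only one
-- possible complement: at most one edge avoids `f`, so of two distinct cycle edges at least one
-- meets `f`.

infixl 6 _⊕_
infixl 7 _⊛_

data Linear : Set where
  con : ℕ → Linear
  var : ℕ → Linear
  _⊕_ : Linear → Linear → Linear
  _⊛_ : ℕ → Linear → Linear

value : List ℕ → ℕ → ℕ
value []      i       = 0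
value (x ∷ ρ) zero    = x
value (x ∷ ρ) (suc i) = value ρ i

⟦_⟧ : Linear → List ℕ → ℕ
⟦ con k ⟧   ρ = k
⟦ var i ⟧   ρ = value ρ i
⟦ s ⊕ t ⟧   ρ = ⟦ s ⟧ ρ + ⟦ t ⟧ ρ
⟦ k ⊛ t ⟧   ρ = k * ⟦ t ⟧ ρ

dot : List ℕ → List ℕ → ℕ
dot []       ρ       = 0
dot (k ∷ ks) []      = 0
dot (k ∷ ks) (x ∷ ρ) = k * x + dot ks ρ

unit : ℕ → List ℕ
unit zero    = 1 ∷ []
unit (suc i) = 0 ∷ unit i

add : List ℕ → List ℕ → List ℕ
add []       js       = js
add (k ∷ ks) []       = k ∷ ks
add (k ∷ ks) (j ∷ js) = k + j ∷ add ks js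

scale : ℕ → List ℕ → List ℕ
scale k []       = []
scale k (j ∷ js) = k * j ∷ scale k js

normalise : Linear → ℕ × List ℕ
normalise (con k) = k , []
normalise (var i) = 0 , unit i
normalise (s ⊕ t) with normalise s | normalise t
... | k , ks | j , js = k + j , add ks js
normalise (k ⊛ t) with normalise t
... | j , js = k * j , scale k js

dot-unit : ∀ i ρ → dot (unit i) ρ ≡ value ρ i
dot-unit zero    []      = refl
dot-unit zero    (x ∷ ρ) = trans (+-identityʳ _) (*-identityˡ x)
dot-unit (suc i) []      = refl
dot-unit (suc i) (x ∷ ρ) = dot-unit i ρ

dot-add : ∀ ks js ρ → dot (add ks js) ρ ≡ dot ks ρ + dot js ρ
dot-add []       js       ρ       = refl
dot-add (k ∷ ks) []       ρ       = sym (+-identityʳ _)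
dot-add (k ∷ ks) (j ∷ js) []      = refl
dot-add (k ∷ ks) (j ∷ js) (x ∷ ρ) =
  trans (cong ((k + j) * x +_) (dot-add ks js ρ)) (rearrange k j x (dot ks ρ) (dot js ρ))
  where
  rearrange : ∀ k j x a b → (k + j) * x + (a + b) ≡ k * x + a + (j * x + b)
  rearrange = solve-∀

dot-scale : ∀ k js ρ → dot (scale k js) ρ ≡ k * dot js ρ
dot-scale k []       ρ       = sym (*-zeroʳ k)
dot-scale k (j ∷ js) []      = sym (*-zeroʳ k)
dot-scale k (j ∷ js) (x ∷ ρ) =
  trans (cong (k * j * x +_) (dot-scale k js ρ)) (rearrange k j x (dot js ρ))
  where
  rearrange : ∀ k j x a → k * j * x + k * a ≡ k * (j * x + a)
  rearrange = solve-∀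

affine : ℕ × List ℕ → List ℕ → ℕ
affine (k , ks) ρ = k + dot ks ρ

normalise-correct : ∀ t ρ → affine (normalise t) ρ ≡ ⟦ t ⟧ ρ
normalise-correct (con k) ρ = +-identityʳ k
normalise-correct (var i) ρ = dot-unit i ρ
normalise-correct (s ⊕ t) ρ with normalise s | normalise t | normalise-correct s ρ | normalise-correct t ρ
... | k , ks | j , js | hs | ht = begin
  k + j + dot (add ks js) ρ         ≡⟨ cong (k + j +_) (dot-add ks js ρ) ⟩
  k + j + (dot ks ρ + dot js ρ)     ≡⟨ rearrange k j (dot ks ρ) (dot js ρ) ⟩
  k + dot ks ρ + (j + dot js ρ)     ≡⟨ cong₂ _+_ hs ht ⟩
  ⟦ s ⟧ ρ + ⟦ t ⟧ ρ                 ∎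
  where
  open ≡-Reasoning
  rearrange : ∀ k j a b → k + j + (a + b) ≡ k + a + (j + b)
  rearrange = solve-∀
normalise-correct (k ⊛ t) ρ with normalise t | normalise-correct t ρ
... | j , js | ht = begin
  k * j + dot (scale k js) ρ        ≡⟨ cong (k * j +_) (dot-scale k js ρ) ⟩
  k * j + k * dot js ρ              ≡⟨ sym (*-distribˡ-+ k j (dot js ρ)) ⟩
  k * (j + dot js ρ)                ≡⟨ cong (k *_) ht ⟩
  k * ⟦ t ⟧ ρ                       ∎
  where open ≡-Reasoning

-- The side conditions named *-lin* are proved by Farkas certificates: a and b are the sums of the
-- left- and right-hand sides of the hypotheses, and a = 1 + b + c.
infeasible : ∀ ρ a b c → normalise a ≡ normalise (con 1 ⊕ (b ⊕ c)) → ⟦ a ⟧ ρ ≤ ⟦ b ⟧ ρ → ⊥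
infeasible ρ a b c eq a≤b = <⇒≱
  (subst (⟦ b ⟧ ρ <_)
    (trans (sym (normalise-correct (con 1 ⊕ (b ⊕ c)) ρ)) (trans (sym (cong (λ t → affine t ρ) eq)) (normalise-correct a ρ)))
    (s≤s (m≤m+n (⟦ b ⟧ ρ) (⟦ c ⟧ ρ))))
  a≤b

-- Counting

true≢false : ∀ {b} → b ≡ true → b ≡ false → ⊥
true≢false refl ()

dec-true : ∀ b → (b ≡ true) ⊎ (b ≡ false)
dec-true true  = inj₁ refl
dec-true false = inj₂ refl

∧-intro : ∀ {a b} → a ≡ true → b ≡ true → a ∧ b ≡ true
∧-intro refl refl = refl

∧-elim : ∀ {a b} → a ∧ b ≡ true → a ≡ true × b ≡ true
∧-elim {true} eq = refl , eq

∨-introˡ : ∀ {a b} → a ≡ true → a ∨ b ≡ true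
∨-introˡ refl = refl

∨-introʳ : ∀ {a b} → b ≡ true → a ∨ b ≡ true
∨-introʳ {true}  _  = refl
∨-introʳ {false} eq = eq

∨-elim : ∀ {a b} → a ∨ b ≡ true → a ≡ true ⊎ b ≡ true
∨-elim {true}  _  = inj₁ refl
∨-elim {false} eq = inj₂ eq

not-intro : ∀ {a} → ¬ a ≡ true → not a ≡ true
not-intro {true}  h = ⊥-elim (h refl)
not-intro {false} h = refl

not-elim : ∀ {a} → not a ≡ true → ¬ a ≡ true
not-elim {false} _ ()

¬true⇒false : ∀ {a} → ¬ a ≡ true → a ≡ false
¬true⇒false {true}  h = ⊥-elim (h refl)
¬true⇒false {false} h = refl

bit : Bool → ℕ
bit true  = 1
bit false = 0

count : ∀ {k} → (Fin k → Bool) → ℕ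
count {zero}  f = 0
count {suc k} f = bit (f Fin.zero) + count (f ∘ Fin.suc)

_⊑_ : ∀ {A : Set} → (A → Bool) → (A → Bool) → Set
f ⊑ g = ∀ x → f x ≡ true → g x ≡ true

bit-mono : ∀ {a b} → (a ≡ true → b ≡ true) → bit a ≤ bit b
bit-mono {false}        h = z≤n
bit-mono {true} {true}  h = ≤-refl
bit-mono {true} {false} h with h refl
... | ()

bit≤1 : ∀ a → bit a ≤ 1
bit≤1 true  = ≤-refl
bit≤1 false = z≤n

count-mono : ∀ {k} {f g : Fin k → Bool} → f ⊑ g → count f ≤ count g
count-mono {zero}  h = z≤n
count-mono {suc k} h = +-mono-≤ (bit-mono (h Fin.zero)) (count-mono (h ∘ Fin.suc))

count≤ : ∀ {k} (f : Fin k → Bool) → count f ≤ k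
count≤ {zero}  f = z≤n
count≤ {suc k} f = +-mono-≤ (bit≤1 (f Fin.zero)) (count≤ (f ∘ Fin.suc))

count-full : ∀ {k} {f : Fin k → Bool} → (∀ x → f x ≡ true) → count f ≡ k
count-full {zero}  h = refl
count-full {suc k} h = cong₂ _+_ (cong bit (h Fin.zero)) (count-full (h ∘ Fin.suc))

interchange : ∀ a b c d → a + b + (c + d) ≡ a + c + (b + d)
interchange = solve-∀

bit-∨∧ : ∀ a b → bit a + bit b ≡ bit (a ∨ b) + bit (a ∧ b)
bit-∨∧ true  true  = refl
bit-∨∧ true  false = refl
bit-∨∧ false true  = refl
bit-∨∧ false false = refl

count-∨∧ : ∀ {k} (f g : Fin k → Bool) →
  count f + count g ≡ count (λ x → f x ∨ g x) + count (λ x → f x ∧ g x)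
count-∨∧ {zero}  f g = refl
count-∨∧ {suc k} f g = begin
  bit (f Fin.zero) + count (f ∘ Fin.suc) + (bit (g Fin.zero) + count (g ∘ Fin.suc))
    ≡⟨ interchange (bit (f Fin.zero)) _ _ _ ⟩
  bit (f Fin.zero) + bit (g Fin.zero) + (count (f ∘ Fin.suc) + count (g ∘ Fin.suc))
    ≡⟨ cong₂ _+_ (bit-∨∧ (f Fin.zero) (g Fin.zero)) (count-∨∧ (f ∘ Fin.suc) (g ∘ Fin.suc)) ⟩
  bit (f Fin.zero ∨ g Fin.zero) + bit (f Fin.zero ∧ g Fin.zero) + _
    ≡⟨ interchange (bit (f Fin.zero ∨ g Fin.zero)) _ _ _ ⟩
  _ ∎
  where open ≡-Reasoning

count-empty : ∀ {k} {f : Fin k → Bool} → (∀ x → ¬ f x ≡ true) → count f ≡ 0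
count-empty {zero}  h = refl
count-empty {suc k} {f} h = cong₂ _+_ (cong bit (¬true⇒false (h Fin.zero))) (count-empty (h ∘ Fin.suc))

remove : ∀ {k} → Fin k → (Fin k → Bool) → Fin k → Bool
remove a f x = if does (x Fin.≟ a) then false else f x

remove-elim : ∀ {k} (a : Fin k) f x → remove a f x ≡ true → x ≢ a × f x ≡ true
remove-elim a f x eq with x Fin.≟ a
... | no x≢a = x≢a , eq

remove-intro : ∀ {k} (a : Fin k) f x → x ≢ a → f x ≡ true → remove a f x ≡ true
remove-intro a f x x≢a eq with x Fin.≟ a
... | yes x≡a = contradiction x≡a x≢a
... | no _    = eq

count-remove : ∀ {k} (a : Fin k) f → count f ≡ bit (f a) + count (remove a f)
count-remove Fin.zero    f = refl
count-remove (Fin.suc a) f = begin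
  bit (f Fin.zero) + count (f ∘ Fin.suc)
    ≡⟨ cong (bit (f Fin.zero) +_) (count-remove a (f ∘ Fin.suc)) ⟩
  bit (f Fin.zero) + (bit (f (Fin.suc a)) + count (remove a (f ∘ Fin.suc)))
    ≡⟨ swap (bit (f Fin.zero)) (bit (f (Fin.suc a))) _ ⟩
  bit (f (Fin.suc a)) + (bit (f Fin.zero) + count (remove a (f ∘ Fin.suc))) ∎
  where
  open ≡-Reasoning
  swap : ∀ x y z → x + (y + z) ≡ y + (x + z)
  swap = solve-∀

-- The entries of `L` are deleted from `f` one at a time. A repetition in `L` only weakens the
-- bound, whereas `count-pack` has to ask for distinct entries.
count-cover : ∀ {k} (f g : Fin k → Bool) L →
  (∀ x → f x ≡ true → g x ≡ true ⊎ x ∈ L) → count f ≤ count g + length L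
count-cover f g [] h = ≤-trans (count-mono λ x fx → lemma (h x fx)) (m≤m+n _ 0)
  where
  lemma : ∀ {x} → g x ≡ true ⊎ x ∈ [] → g x ≡ true
  lemma (inj₁ gx) = gx
count-cover f g (a ∷ L) h = begin
  count f                          ≡⟨ count-remove a f ⟩
  bit (f a) + count (remove a f)   ≤⟨ +-mono-≤ (bit≤1 (f a)) (count-cover (remove a f) g L lemma) ⟩
  suc (count g + length L)         ≡⟨ sym (+-suc (count g) (length L)) ⟩
  count g + suc (length L)         ∎
  where
  open ≤-Reasoning
  lemma : ∀ x → remove a f x ≡ true → g x ≡ true ⊎ x ∈ L
  lemma x eq with remove-elim a f x eq
  ... | x≢a , fx with h x fx
  ...   | inj₁ gx          = inj₁ gx
  ...   | inj₂ (here x≡a)  = contradiction x≡a x≢a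
  ...   | inj₂ (there x∈L) = inj₂ x∈L

count-pack : ∀ {k} (f g : Fin k → Bool) {L} → Unique L → g ⊑ f →
  (∀ {x} → x ∈ L → f x ≡ true) → (∀ {x} → x ∈ L → ¬ g x ≡ true) →
  count g + length L ≤ count f
count-pack f g {[]} [] g⊑f L⊑f L#g = ≤-trans (≤-reflexive (+-identityʳ _)) (count-mono g⊑f)
count-pack f g {a ∷ L} (a∉L ∷ uL) g⊑f L⊑f L#g = begin
  count g + suc (length L)        ≡⟨ +-suc (count g) (length L) ⟩
  suc (count g + length L)        ≤⟨ s≤s (count-pack (remove a f) g uL
                                       (λ x gx → remove-intro a f x (λ { refl → L#g (here refl) gx }) (g⊑f x gx))
                                       (λ {x} x∈L → remove-intro a f x (λ { refl → All.lookup a∉L x∈L refl }) (L⊑f (there x∈L)))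
                                       (L#g ∘ there)) ⟩
  1 + count (remove a f)          ≡⟨ cong (λ b → bit b + count (remove a f)) (sym (L⊑f (here refl))) ⟩
  bit (f a) + count (remove a f)  ≡⟨ sym (count-remove a f) ⟩
  count f                         ∎
  where open ≤-Reasoning

count-strict : ∀ {k} {f g : Fin k → Bool} → f ⊑ g → ∀ x → g x ≡ true → ¬ f x ≡ true →
  count f < count g
count-strict {f = f} {g} f⊑g x gx ¬fx = subst (_≤ count g) (+-comm (count f) 1)
  (count-pack g f {x ∷ []} ([] ∷ []) f⊑g (λ { (here refl) → gx }) (λ { (here refl) → ¬fx }))

count-⊑⁻ : ∀ {k} {f g : Fin k → Bool} → f ⊑ g → count g ≤ count f → g ⊑ f
count-⊑⁻ {f = f} f⊑g g≤f x gx with dec-true (f x)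
... | inj₁ fx  = fx
... | inj₂ ¬fx = contradiction (count-strict f⊑g x gx (λ fx → true≢false fx ¬fx)) (≤⇒≯ g≤f)

count-witness : ∀ {k} (f : Fin k → Bool) → 0 < count f → ∃ λ x → f x ≡ true
count-witness {suc k} f 0< with dec-true (f Fin.zero)
... | inj₁ f0 = Fin.zero , f0
... | inj₂ ¬f0 with count-witness (f ∘ Fin.suc) (subst (λ b → 0 < bit b + count (f ∘ Fin.suc)) ¬f0 0<)
...   | x , fx = Fin.suc x , fx

count-witness₂ : ∀ {k} (f : Fin k → Bool) → 2 ≤ count f →
  ∃ λ x → ∃ λ y → x ≢ y × f x ≡ true × f y ≡ true
count-witness₂ f 2≤ with count-witness f (≤-trans (s≤s z≤n) 2≤)
... | x , fx with count-witness (remove x f)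
                    (s≤s⁻¹ (subst (2 ≤_) (trans (count-remove x f) (cong (λ b → bit b + count (remove x f)) fx)) 2≤))
...   | y , ry with remove-elim x f y ry
...     | y≢x , fy = x , y , y≢x ∘ sym , fx , fy

count-disjoint : ∀ {k} (f g h : Fin k → Bool) → f ⊑ h → g ⊑ h →
  (∀ x → f x ≡ true → g x ≡ true → ⊥) → count f + count g ≤ count h
count-disjoint f g h f⊑h g⊑h f#g = begin
  count f + count g                                   ≡⟨ count-∨∧ f g ⟩
  count (λ x → f x ∨ g x) + count (λ x → f x ∧ g x)   ≡⟨ cong (count (λ x → f x ∨ g x) +_)
                                                         (count-empty λ x e → f#g x (proj₁ (∧-elim e)) (proj₂ (∧-elim e))) ⟩
  count (λ x → f x ∨ g x) + 0                         ≡⟨ +-identityʳ _ ⟩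
  count (λ x → f x ∨ g x)                             ≤⟨ count-mono (λ x e → lemma x (∨-elim e)) ⟩
  count h                                             ∎
  where
  open ≤-Reasoning
  lemma : ∀ x → f x ≡ true ⊎ g x ≡ true → h x ≡ true
  lemma x (inj₁ fx) = f⊑h x fx
  lemma x (inj₂ gx) = g⊑h x gx

-- Periodic sets

countUpTo : ℕ → (ℕ → Bool) → ℕ
countUpTo zero    A = 0
countUpTo (suc k) A = bit (A 0) + countUpTo k (A ∘ suc)

countUpTo≡count : ∀ k A → countUpTo k A ≡ count {k} (A ∘ toℕ)
countUpTo≡count zero    A = refl
countUpTo≡count (suc k) A = cong (bit (A 0) +_) (countUpTo≡count k (A ∘ suc))

module Periodic (l : ℕ) (0<l : 0 < l) where

  cnt : (ℕ → Bool) → ℕ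
  cnt A = countUpTo l A

  cnt≡ : ∀ A → cnt A ≡ count {l} (A ∘ toℕ)
  cnt≡ = countUpTo≡count l

  Periodic : (ℕ → Bool) → Set
  Periodic A = ∀ i → A (l + i) ≡ A i

  periodic-* : ∀ {A} → Periodic A → ∀ k i → A (k * l + i) ≡ A i
  periodic-* {A} per zero    i = refl
  periodic-* {A} per (suc k) i =
    trans (cong A (+-assoc l (k * l) i)) (trans (per (k * l + i)) (periodic-* per k i))

  periodic-shift : ∀ {A} t → Periodic A → Periodic (λ i → A (t + i))
  periodic-shift {A} t per i = trans (cong A (swap t l i)) (per (t + i))
    where
    swap : ∀ t l i → t + (l + i) ≡ l + (t + i)
    swap = solve-∀

  periodic-∨ : ∀ {A B} → Periodic A → Periodic B → Periodic (λ i → A i ∨ B i)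
  periodic-∨ pA pB i = cong₂ _∨_ (pA i) (pB i)

  periodic-∧ : ∀ {A B} → Periodic A → Periodic B → Periodic (λ i → A i ∧ B i)
  periodic-∧ pA pB i = cong₂ _∧_ (pA i) (pB i)

  periodic-not : ∀ {A} → Periodic A → Periodic (λ i → not (A i))
  periodic-not pA i = cong not (pA i)

  -- Both sides count `A` on `0, …, k`, split off at opposite ends. For a full period the two end
  -- terms agree, so counts are invariant under translation.
  countUpTo-snoc : ∀ k A → bit (A 0) + countUpTo k (A ∘ suc) ≡ bit (A k) + countUpTo k A
  countUpTo-snoc zero    A = refl
  countUpTo-snoc (suc k) A = begin
    bit (A 0) + (bit (A 1) + countUpTo k (A ∘ suc ∘ suc))
      ≡⟨ cong (bit (A 0) +_) (countUpTo-snoc k (A ∘ suc)) ⟩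
    bit (A 0) + (bit (A (suc k)) + countUpTo k (A ∘ suc))
      ≡⟨ swap (bit (A 0)) (bit (A (suc k))) _ ⟩
    bit (A (suc k)) + (bit (A 0) + countUpTo k (A ∘ suc)) ∎
    where
    open ≡-Reasoning
    swap : ∀ x y z → x + (y + z) ≡ y + (x + z)
    swap = solve-∀

  cnt-suc : ∀ {A} → Periodic A → cnt (A ∘ suc) ≡ cnt A
  cnt-suc {A} per = +-cancelˡ-≡ (bit (A 0)) _ _
    (trans (countUpTo-snoc l A)
           (cong (λ b → bit b + cnt A) (trans (cong A (sym (+-identityʳ l))) (per 0))))

  cnt-shift : ∀ {A} t → Periodic A → cnt (λ i → A (t + i)) ≡ cnt A
  cnt-shift     zero    per = refl
  cnt-shift {A} (suc t) per =
    trans (cnt-shift t (periodic-shift 1 per)) (cnt-suc per)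

  cnt-mono : ∀ {A B} → A ⊑ B → cnt A ≤ cnt B
  cnt-mono {A} {B} A⊑B = subst₂ _≤_ (sym (cnt≡ A)) (sym (cnt≡ B)) (count-mono {l} (A⊑B ∘ toℕ))

  cnt-∨∧ : ∀ A B → cnt A + cnt B ≡ cnt (λ i → A i ∨ B i) + cnt (λ i → A i ∧ B i)
  cnt-∨∧ A B = begin
    cnt A + cnt B ≡⟨ cong₂ _+_ (cnt≡ A) (cnt≡ B) ⟩
    _             ≡⟨ count-∨∧ {l} (A ∘ toℕ) (B ∘ toℕ) ⟩
    _             ≡⟨ cong₂ _+_ (sym (cnt≡ (λ i → A i ∨ B i))) (sym (cnt≡ (λ i → A i ∧ B i))) ⟩
    _             ∎
    where open ≡-Reasoning

  cnt≤ : ∀ A → cnt A ≤ l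
  cnt≤ A = subst (_≤ l) (sym (cnt≡ A)) (count≤ {l} (A ∘ toℕ))

  cnt-disjoint : ∀ A B → (∀ i → A i ≡ true → B i ≡ true → ⊥) → cnt A + cnt B ≤ cnt (λ i → A i ∨ B i)
  cnt-disjoint A B A#B = subst₂ _≤_ (sym (cong₂ _+_ (cnt≡ A) (cnt≡ B))) (sym (cnt≡ (λ i → A i ∨ B i)))
    (count-disjoint {l} (A ∘ toℕ) (B ∘ toℕ) (λ x → A (toℕ x) ∨ B (toℕ x))
      (λ _ → ∨-introˡ) (λ x → ∨-introʳ {A (toℕ x)}) (A#B ∘ toℕ))

  cnt-disjoint-l : ∀ A B → (∀ i → A i ≡ true → B i ≡ true → ⊥) → cnt A + cnt B ≤ l
  cnt-disjoint-l A B A#B = ≤-trans (cnt-disjoint A B A#B) (cnt≤ _)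

  cnt-strict : ∀ {A B} → Periodic A → Periodic B → A ⊑ B → ∀ i → B i ≡ true → ¬ A i ≡ true →
    cnt A < cnt B
  cnt-strict {A} {B} pA pB A⊑B i Bi ¬Ai = subst₂ _<_
    (trans (sym (cnt≡ (λ t → A (i + t)))) (cnt-shift i pA)) (trans (sym (cnt≡ (λ t → B (i + t)))) (cnt-shift i pB))
    (count-strict {l} (λ x → A⊑B (i + toℕ x)) (fromℕ< 0<l)
      (subst (λ t → B t ≡ true) (sym i≡) Bi) (λ h → ¬Ai (subst (λ t → A t ≡ true) i≡ h)))
    where
    i≡ : i + toℕ (fromℕ< 0<l) ≡ i
    i≡ = trans (cong (i +_) (Fin.toℕ-fromℕ< 0<l)) (+-identityʳ i)

  cnt-full⁻ : ∀ {A} → Periodic A → l ≤ cnt A → ∀ i → A i ≡ true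
  cnt-full⁻ {A} pA l≤ i with dec-true (A i)
  ... | inj₁ Ai  = Ai
  ... | inj₂ ¬Ai = contradiction
    (≤-trans (cnt-strict {B = λ _ → true} pA (λ _ → refl) (λ _ _ → refl) i refl (λ e → true≢false e ¬Ai)) (cnt≤ _))
    (≤⇒≯ l≤)

  cnt-⊑⁻ : ∀ {A B} → Periodic A → Periodic B → A ⊑ B → cnt B ≤ cnt A → B ⊑ A
  cnt-⊑⁻ {A} pA pB A⊑B B≤A i Bi with dec-true (A i)
  ... | inj₁ Ai  = Ai
  ... | inj₂ ¬Ai = contradiction (cnt-strict pA pB A⊑B i Bi (λ e → true≢false e ¬Ai)) (≤⇒≯ B≤A)

  cnt-witness : ∀ A → 0 < cnt A → ∃ λ i → A i ≡ true
  cnt-witness A 0< with count-witness {l} (A ∘ toℕ) (subst (0 <_) (cnt≡ A) 0<)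
  ... | x , Ax = toℕ x , Ax

  cnt-witness₂ : ∀ A → 2 ≤ cnt A →
    ∃ λ i → ∃ λ k → 0 < k × k < l × A i ≡ true × A (k + i) ≡ true
  cnt-witness₂ A 2≤ with count-witness₂ {l} (A ∘ toℕ) (subst (2 ≤_) (cnt≡ A) 2≤)
  ... | x , y , x≢y , Ax , Ay with <-cmp (toℕ x) (toℕ y)
  ...   | tri≈ _ e _ = contradiction (Fin.toℕ-injective e) x≢y
  ...   | tri< x<y _ _ = toℕ x , toℕ y ∸ toℕ x , m<n⇒0<n∸m x<y , ≤-<-trans (m∸n≤m (toℕ y) (toℕ x)) (Fin.toℕ<n y) ,
                         Ax , subst (λ t → A t ≡ true) (sym (m∸n+n≡m (<⇒≤ x<y))) Ay
  ...   | tri> _ _ y<x = toℕ y , toℕ x ∸ toℕ y , m<n⇒0<n∸m y<x , ≤-<-trans (m∸n≤m (toℕ x) (toℕ y)) (Fin.toℕ<n x) ,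
                         Ay , subst (λ t → A t ≡ true) (sym (m∸n+n≡m (<⇒≤ y<x))) Ax

  cnt≤1 : ∀ A → (∀ i k → 0 < k → k < l → A i ≡ true → A (k + i) ≡ true → ⊥) → cnt A ≤ 1
  cnt≤1 A h with 2 ≤? cnt A
  ... | no 2≰  = s≤s⁻¹ (≰⇒> 2≰)
  ... | yes 2≤ with cnt-witness₂ A 2≤
  ...   | i , k , 0<k , k<l , Ai , Aki = ⊥-elim (h i k 0<k k<l Ai Aki)

  cnt-pos : ∀ {A} → Periodic A → ∀ i → A i ≡ true → 0 < cnt A
  cnt-pos {A} pA i Ai = ≤-<-trans z≤n
    (cnt-strict {A = λ _ → false} (λ _ → refl) pA (λ _ ()) i Ai (λ ()))

  2≤cnt : ∀ {A} → Periodic A → ∀ i k → 0 < k → k < l → A i ≡ true → A (k + i) ≡ true → 2 ≤ cnt A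
  2≤cnt {A} pA i k 0<k k<l Ai Aki = subst (2 ≤_) (trans (sym (cnt≡ (λ t → A (i + t)))) (cnt-shift i pA))
    (≤-trans (m≤n+m 2 _) (count-pack {l} (λ x → A (i + toℕ x)) (λ _ → false) {zeroF ∷ kF ∷ []} ((z≢k ∷ []) ∷ [] ∷ []) (λ _ ())
      (λ { (here refl) → subst (λ t → A t ≡ true) (sym i0) Ai
         ; (there (here refl)) → subst (λ t → A t ≡ true) (sym ik) Aki }) (λ _ ())))
    where
    zeroF kF : Fin l
    zeroF = fromℕ< 0<l
    kF = fromℕ< k<l
    i0 : i + toℕ zeroF ≡ i
    i0 = trans (cong (i +_) (Fin.toℕ-fromℕ< 0<l)) (+-identityʳ i)
    ik : i + toℕ kF ≡ k + i
    ik = trans (cong (i +_) (Fin.toℕ-fromℕ< k<l)) (+-comm i k)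
    z≢k : zeroF ≢ kF
    z≢k e = <⇒≢ 0<k (trans (sym (Fin.toℕ-fromℕ< 0<l)) (trans (cong toℕ e) (Fin.toℕ-fromℕ< k<l)))

  fall-from : ∀ (A : ℕ → Bool) k a → A a ≡ true → A (k + a) ≡ false → ∃ λ i → A i ≡ true × A (suc i) ≡ false
  fall-from A zero    a Aa ¬A = ⊥-elim (true≢false Aa ¬A)
  fall-from A (suc k) a Aa ¬A with dec-true (A (suc a))
  ... | inj₂ ¬As = a , Aa , ¬As
  ... | inj₁ As  = fall-from A k (suc a) As (subst (λ t → A t ≡ false) (sym (+-suc k a)) ¬A)

  fall : ∀ {A} → Periodic A → ∀ a b → A a ≡ true → A b ≡ false → ∃ λ i → A i ≡ true × A (suc i) ≡ false
  -- Since `l ≥ 1`, the copy `a * l + b` of `b` lies at or after `a`, so a walk upwards from `a`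
  -- reaches it.
  fall {A} pA a b Aa ¬Ab = fall-from A (a * l + b ∸ a) a Aa
    (trans (cong A (m∸n+n≡m a≤)) (trans (periodic-* pA a b) ¬Ab))
    where
    a≤ : a ≤ a * l + b
    a≤ = ≤-trans (subst (_≤ a * l) (*-identityʳ a) (*-monoʳ-≤ a 0<l)) (m≤m+n _ b)

  rise : ∀ {A} → Periodic A → ∀ a b → A a ≡ true → A b ≡ false → ∃ λ i → A i ≡ false × A (suc i) ≡ true
  rise {A} pA a b Aa ¬Ab with fall {not ∘ A} (periodic-not pA) b a (cong not ¬Ab) (cong not Aa)
  ... | i , h , h' = i , not-true h , not-false h'
    where
    not-true : ∀ {b} → not b ≡ true → b ≡ false
    not-true {false} _ = refl
    not-false : ∀ {b} → not b ≡ false → b ≡ true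
    not-false {true} _ = refl

  -- dil j A is the set A - {0,…,j}.
  dil : ℕ → (ℕ → Bool) → ℕ → Bool
  dil zero    A i = A i
  dil (suc j) A i = dil j A i ∨ dil j A (suc i)

  periodic-dil : ∀ {A} j → Periodic A → Periodic (dil j A)
  periodic-dil zero    pA = pA
  periodic-dil {A} (suc j) pA = periodic-∨ (periodic-dil j pA) (periodic-shift 1 (periodic-dil j pA))

  dil-elim : ∀ {A} j i → dil j A i ≡ true → ∃ λ t → t ≤ j × A (t + i) ≡ true
  dil-elim zero    i h = 0 , z≤n , h
  dil-elim {A} (suc j) i h with ∨-elim {dil j A i} h
  ... | inj₁ h₁ with dil-elim j i h₁
  ...   | t , t≤j , At = t , m≤n⇒m≤1+n t≤j , At
  dil-elim {A} (suc j) i h | inj₂ h₂ with dil-elim j (suc i) h₂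
  ...   | t , t≤j , At = suc t , s≤s t≤j , subst (λ s → A s ≡ true) (+-suc t i) At

  dil-incl : ∀ {A} j → A ⊑ dil j A
  dil-incl zero    i Ai = Ai
  dil-incl (suc j) i Ai = ∨-introˡ (dil-incl j i Ai)

  -- A nonempty proper subset of a cycle has a boundary, so it gains a position from its translate.
  cnt-grow : ∀ {A} → Periodic A → ∀ a b → A a ≡ true → A b ≡ false →
    cnt A < cnt (λ i → A i ∨ A (suc i))
  cnt-grow {A} pA a b Aa ¬Ab with rise pA a b Aa ¬Ab
  ... | i , ¬Ai , Asi = cnt-strict pA (periodic-∨ pA (periodic-shift 1 pA)) (λ _ → ∨-introˡ) i
                          (∨-introʳ {A i} Asi) (λ e → true≢false e ¬Ai)

  ∨-false : ∀ {a b} → a ∨ b ≡ false → a ≡ false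
  ∨-false {false} _ = refl

  -- Each unit step of the dilation gains a position as long as the set is not everything; `b`,
  -- never reached, certifies this for all `j` steps.
  cnt-dil : ∀ {A} → Periodic A → ∀ j a b → A a ≡ true → dil j A b ≡ false →
    cnt A + j ≤ cnt (dil j A)
  cnt-dil {A} pA zero    a b Aa ¬b = ≤-reflexive (+-identityʳ _)
  cnt-dil {A} pA (suc j) a b Aa ¬b = begin
    cnt A + suc j           ≡⟨ +-suc (cnt A) j ⟩
    suc (cnt A + j)         ≤⟨ s≤s (cnt-dil pA j a b Aa (∨-false ¬b)) ⟩
    suc (cnt (dil j A))     ≤⟨ cnt-grow (periodic-dil j pA) a b (dil-incl j a Aa) (∨-false ¬b) ⟩
    cnt (dil (suc j) A)     ∎
    where open ≤-Reasoning

module _ {X : Set} where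

  select : ℕ → (ℕ → X) → (ℕ → Bool) → List X
  select zero    g A = []
  select (suc k) g A = if A 0 then g 0 ∷ select k (g ∘ suc) (A ∘ suc) else select k (g ∘ suc) (A ∘ suc)

  length-select : ∀ k g A → length (select k g A) ≡ countUpTo k A
  length-select zero    g A = refl
  length-select (suc k) g A with A 0
  ... | true  = cong suc (length-select k (g ∘ suc) (A ∘ suc))
  ... | false = length-select k (g ∘ suc) (A ∘ suc)

  ∈-select : ∀ k (g : ℕ → X) A i → i < k → A i ≡ true → g i ∈ select k g A
  ∈-select (suc k) g A zero i<k Ai with A 0
  ... | true = here refl
  ∈-select (suc k) g A (suc i) i<k Ai with A 0
  ... | true  = there (∈-select k (g ∘ suc) (A ∘ suc) i (s≤s⁻¹ i<k) Ai)
  ... | false = ∈-select k (g ∘ suc) (A ∘ suc) i (s≤s⁻¹ i<k) Ai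

-- The incidence graph

module _ {A : Set} where

  Unique-reverse : {L : List A} → Unique L → Unique (reverse L)
  Unique-reverse {L} = Permₛ.Unique-resp-↭ (setoid A) (↭⇒↭ₛ (↭-sym (↭-reverse L)))

  ∈-reverse⁻ : ∀ {x} (L : List A) → x ∈ reverse L → x ∈ L
  ∈-reverse⁻ L = ∈-resp-↭ (↭-reverse L)

  Disjoint-++ʳ : {L M K : List A} → Disjoint L M → Disjoint L K → Disjoint L (M ++ K)
  Disjoint-++ʳ {L} {M} L#M L#K (u∈L , u∈MK) with ∈-++⁻ M u∈MK
  ... | inj₁ u∈M = L#M (u∈L , u∈M)
  ... | inj₂ u∈K = L#K (u∈L , u∈K)

  Disjoint-reverseˡ : {L M : List A} → Disjoint L M → Disjoint (reverse L) M
  Disjoint-reverseˡ {L} L#M (u∈L , u∈M) = L#M (∈-reverse⁻ L u∈L , u∈M)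

  Disjoint-reverseʳ : {L M : List A} → Disjoint L M → Disjoint L (reverse M)
  Disjoint-reverseʳ {M = M} L#M (u∈L , u∈M) = L#M (u∈L , ∈-reverse⁻ M u∈M)

  Disjoint-sym : {L M : List A} → Disjoint L M → Disjoint M L
  Disjoint-sym L#M (u∈M , u∈L) = L#M (u∈L , u∈M)

-- Defined by recursion and not as `i + i`, so that it unfolds in step with the two-step recursion
-- of `weave`.
double : ℕ → ℕ
double zero    = zero
double (suc i) = suc (suc (double i))

double-+ : ∀ i j → double (i + j) ≡ double i + double j
double-+ zero    j = refl
double-+ (suc i) j = cong (suc ∘ suc) (double-+ i j)

double≡ : ∀ i → double i ≡ i + i
double≡ zero    = refl
double≡ (suc i) = cong suc (trans (cong suc (double≡ i)) (sym (+-suc i i)))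

double-cancel-< : ∀ {i j} → double i < double j → i < j
double-cancel-< {zero}  {suc j} _ = s≤s z≤n
double-cancel-< {suc i} {suc j} h = s≤s (double-cancel-< (s≤s⁻¹ (s≤s⁻¹ h)))

data Parity : ℕ → Set where
  even : ∀ i → Parity (double i)
  odd  : ∀ i → Parity (suc (double i))

parity : ∀ s → Parity s
parity zero = even 0
parity (suc zero) = odd 0
parity (suc (suc s)) with parity s
... | even i = even (suc i)
... | odd i  = odd (suc i)

module Incidence {n m : ℕ} (inc : Fin n → Fin m → Bool) where

  Node : Set
  Node = Fin n ⊎ Fin m

  _≟ᴺ_ : DecidableEquality Node
  _≟ᴺ_ = Sum.≡-dec Fin._≟_ Fin._≟_

  infix 4 _~_
  _~_ : Node → Node → Set
  inj₁ x ~ inj₂ y = inc x y ≡ true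
  inj₂ y ~ inj₁ x = inc x y ≡ true
  inj₁ _ ~ inj₁ _ = ⊥
  inj₂ _ ~ inj₂ _ = ⊥

  ~-sym : ∀ u w → u ~ w → w ~ u
  ~-sym (inj₁ _) (inj₂ _) h = h
  ~-sym (inj₂ _) (inj₁ _) h = h

  infixr 5 _∷_
  data Walk : Node → List Node → Node → Set where
    single : ∀ u → Walk u (u ∷ []) u
    _∷_ : ∀ {u w L z} → u ~ w → Walk w L z → Walk u (u ∷ L) z

  walk-++ : ∀ {a L b c M d} → Walk a L b → b ~ c → Walk c M d → Walk a (L ++ M) d
  walk-++ (single u)   h M = h ∷ M
  walk-++ (g ∷ L) h M = g ∷ walk-++ L h M

  walk-reverse : ∀ {a L b} → Walk a L b → Walk b (reverse L) a
  walk-reverse (single u) = (single u)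
  walk-reverse {a} (_∷_ {w = w} {L} g W) =
    subst (λ K → Walk _ K a) (sym (unfold-reverse a L)) (walk-++ (walk-reverse W) (~-sym a w g) (single a))

  last∈ : ∀ {a L b} → Walk a L b → b ∈ L
  last∈ (single u)   = here refl
  last∈ (_ ∷ W) = there (last∈ W)

  head∈ : ∀ {a L b} → Walk a L b → a ∈ L
  head∈ (single u)   = here refl
  head∈ (_ ∷ W) = here refl

  walk-applyUpTo : ∀ (f : ℕ → Node) → (∀ t → f t ~ f (suc t)) → ∀ k →
    Walk (f 0) (applyUpTo f (suc k)) (f k)
  walk-applyUpTo f h zero    = single (f 0)
  walk-applyUpTo f h (suc k) = h 0 ∷ walk-applyUpTo (f ∘ suc) (h ∘ suc) k

  weave : (ℕ → Fin n) → (ℕ → Fin m) → ℕ → Node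
  weave v e zero          = inj₁ (v 0)
  weave v e (suc zero)    = inj₂ (e 0)
  weave v e (suc (suc s)) = weave (v ∘ suc) (e ∘ suc) s

  weave-even : ∀ v e i → weave v e (double i) ≡ inj₁ (v i)
  weave-even v e zero    = refl
  weave-even v e (suc i) = weave-even (v ∘ suc) (e ∘ suc) i

  weave-odd : ∀ v e i → weave v e (suc (double i)) ≡ inj₂ (e i)
  weave-odd v e zero    = refl
  weave-odd v e (suc i) = weave-odd (v ∘ suc) (e ∘ suc) i

  -- Positions are all natural numbers read with period `l`. Arcs and translates then need no
  -- wrap-around, and distinctness is asked only of positions less than one period apart.
  record Cycle (l : ℕ) : Set where
    field
      v     : ℕ → Fin n
      e     : ℕ → Fin m
      per-v : ∀ i → v (l + i) ≡ v i
      per-e : ∀ i → e (l + i) ≡ e i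
      inj-v : ∀ i k → 0 < k → k < l → v i ≢ v (k + i)
      inj-e : ∀ i k → 0 < k → k < l → e i ≢ e (k + i)
      here∈ : ∀ i → inc (v i) (e i) ≡ true
      next∈ : ∀ i → inc (v (suc i)) (e i) ≡ true

  shift : ∀ {l} → ℕ → Cycle l → Cycle l
  shift {l} a C = record
    { v = λ i → v (i + a) ; e = λ i → e (i + a)
    ; per-v = λ i → trans (cong v (+-assoc l i a)) (per-v (i + a))
    ; per-e = λ i → trans (cong e (+-assoc l i a)) (per-e (i + a))
    ; inj-v = λ i k 0<k k<l eq → inj-v (i + a) k 0<k k<l (trans eq (cong v (+-assoc k i a)))
    ; inj-e = λ i k 0<k k<l eq → inj-e (i + a) k 0<k k<l (trans eq (cong e (+-assoc k i a)))
    ; here∈ = λ i → here∈ (i + a) ; next∈ = λ i → next∈ (i + a) }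
    where open Cycle C

  module OnCycle {l : ℕ} (C : Cycle l) where
    open Cycle C public

    N : ℕ
    N = double l

    c : ℕ → Node
    c = weave v e

    c-even : ∀ i → c (double i) ≡ inj₁ (v i)
    c-even = weave-even v e

    c-odd : ∀ i → c (suc (double i)) ≡ inj₂ (e i)
    c-odd = weave-odd v e

    c-adj : ∀ s → c s ~ c (suc s)
    c-adj s with parity s
    ... | even i = subst₂ _~_ (sym (c-even i)) (sym (c-odd i)) (here∈ i)
    ... | odd i  = subst₂ _~_ (sym (c-odd i)) (sym (c-even (suc i))) (next∈ i)

    c-adj′ : ∀ s → c (suc s) ~ c s
    c-adj′ s = ~-sym (c s) (c (suc s)) (c-adj s)

    c-per : ∀ s → c (N + s) ≡ c s
    c-per s with parity s
    ... | even i = begin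
      c (double l + double i) ≡⟨ cong c (sym (double-+ l i)) ⟩
      c (double (l + i))      ≡⟨ c-even (l + i) ⟩
      inj₁ (v (l + i))        ≡⟨ cong inj₁ (per-v i) ⟩
      inj₁ (v i)              ≡⟨ sym (c-even i) ⟩
      c (double i)            ∎
      where open ≡-Reasoning
    ... | odd i = begin
      c (double l + suc (double i)) ≡⟨ cong c (trans (+-suc (double l) (double i)) (cong suc (sym (double-+ l i)))) ⟩
      c (suc (double (l + i)))      ≡⟨ c-odd (l + i) ⟩
      inj₂ (e (l + i))              ≡⟨ cong inj₂ (per-e i) ⟩
      inj₂ (e i)                    ≡⟨ sym (c-odd i) ⟩
      c (suc (double i))            ∎
      where open ≡-Reasoning

    c-inj′ : ∀ s k → 0 < k → k < N → c s ≢ c (k + s)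
    c-inj′ s k 0<k k<N eq with parity s | parity k
    ... | even i | even zero    = <-irrefl refl 0<k
    ... | even i | even (suc j) = inj-v i (suc j) (s≤s z≤n) (double-cancel-< {suc j} k<N)
      (Sum.inj₁-injective (trans (sym (c-even i)) (trans eq
        (trans (cong c (sym (double-+ (suc j) i))) (c-even (suc j + i))))))
    ... | even i | odd j
      with () ← trans (sym (c-even i)) (trans eq (trans (cong (c ∘ suc) (sym (double-+ j i))) (c-odd (j + i))))
    ... | odd i  | even zero    = <-irrefl refl 0<k
    ... | odd i  | even (suc j) = inj-e i (suc j) (s≤s z≤n) (double-cancel-< {suc j} k<N)
      (Sum.inj₂-injective (trans (sym (c-odd i)) (trans eq
        (trans (cong c (trans (+-suc (double (suc j)) (double i)) (cong suc (sym (double-+ (suc j) i))))) (c-odd (suc j + i))))))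
    ... | odd i  | odd j
      with () ← trans (sym (c-odd i)) (trans eq
        (trans (cong c (cong suc (trans (+-suc (double j) (double i)) (cong suc (sym (double-+ j i)))))) (c-even (suc (j + i)))))

    c-inj : ∀ {a b} → a < b → b < N + a → c a ≢ c b
    c-inj {a} {b} a<b b< eq = c-inj′ a (b ∸ a) (m<n⇒0<n∸m a<b)
      (+-cancelʳ-< a (b ∸ a) N (subst (_< N + a) (sym (m∸n+n≡m (<⇒≤ a<b))) b<))
      (trans eq (cong c (sym (m∸n+n≡m (<⇒≤ a<b)))))

    arc : ℕ → ℕ → List Node
    arc s k = applyUpTo (λ t → c (t + s)) k

    walk-arc : ∀ s k → Walk (c s) (arc s (suc k)) (c (k + s))
    walk-arc s k = walk-applyUpTo (λ t → c (t + s)) (λ t → c-adj (t + s)) k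

    length-arc : ∀ s k → length (arc s k) ≡ k
    length-arc s k = length-applyUpTo _ k

    ∈-arc⁻ : ∀ {u} s k → u ∈ arc s k → ∃ λ t → t < k × u ≡ c (t + s)
    ∈-arc⁻ s k = ∈-applyUpTo⁻ (λ t → c (t + s))

    arc-unique : ∀ s k → k ≤ N → Unique (arc s k)
    arc-unique s k k≤N = Unique.applyUpTo⁺₁ _ k λ {i} {j} i<j j<k →
      c-inj (+-monoˡ-< s i<j)
            (<-≤-trans (+-monoˡ-< s (<-≤-trans j<k k≤N)) (+-monoʳ-≤ N (m≤n+m s i)))

    arc-disjoint : ∀ s k s' k' → k + s ≤ s' → k' + s' ≤ N + s → Disjoint (arc s k) (arc s' k')
    arc-disjoint s k s' k' h h' (u∈ , u∈') with ∈-arc⁻ s k u∈ | ∈-arc⁻ s' k' u∈'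
    ... | t , t<k , refl | t' , t'<k' , eq =
      c-inj (<-≤-trans (+-monoˡ-< s t<k) (≤-trans h (m≤n+m s' t')))
            (<-≤-trans (+-monoˡ-< s' t'<k') (≤-trans h' (+-monoʳ-≤ N (m≤n+m s t)))) eq

    Outside : Node → Set
    Outside u = ∀ s → u ≢ c s

    outside-arc : ∀ {L} s k → (∀ {u} → u ∈ L → Outside u) → Disjoint L (arc s k)
    outside-arc s k out (u∈L , u∈arc) with ∈-arc⁻ s k u∈arc
    ... | t , _ , eq = out u∈L (t + s) eq

  -- Vertices and edges both count in `length D`, hence `double l`. The closed walk may start at
  -- either kind of node, so each rerouting can start wherever is convenient.
  Maximal : ℕ → Set
  Maximal l = ∀ {a D b} → Walk a D b → b ~ a → Unique D → length D ≤ double l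

-- Rerouting a cycle through an outer path

abstract
  arc-lin₁ : ∀ (p j q N : ℕ) → p + (1 + j) ≤ N → j + q ≡ N → p < q
  arc-lin₁ p j q N h₁ h₂ = ≮⇒≥ λ neg → infeasible (p ∷ j ∷ q ∷ N ∷ [])
    ((var 0 ⊕ (con 1 ⊕ var 1)) ⊕ (var 3 ⊕ (con 1 ⊕ var 2)))
    (var 3 ⊕ ((var 1 ⊕ var 2) ⊕ (con 1 ⊕ var 0)))
    (con 0) refl (+-mono-≤ h₁ (+-mono-≤ (≤-reflexive (sym h₂)) neg))

  arc-lin₂ : ∀ (q j N : ℕ) → 0 < q → j + q ≡ N → 1 + j ≤ N
  arc-lin₂ q j N h₁ h₂ = ≮⇒≥ λ neg → infeasible (q ∷ j ∷ N ∷ [])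
    ((con 1 ⊕ con 0) ⊕ ((var 1 ⊕ var 0) ⊕ (con 1 ⊕ var 2)))
    (var 0 ⊕ (var 2 ⊕ (con 1 ⊕ var 1)))
    (con 0) refl (+-mono-≤ h₁ (+-mono-≤ (≤-reflexive h₂) neg))

  arc-lin₃ : ∀ (p q j r N : ℕ) → p + (q + (1 + j)) ≤ N → j + r ≡ N → p + q < r
  arc-lin₃ p q j r N h₁ h₂ = ≮⇒≥ λ neg → infeasible (p ∷ q ∷ j ∷ r ∷ N ∷ [])
    ((var 0 ⊕ (var 1 ⊕ (con 1 ⊕ var 2))) ⊕ (var 4 ⊕ (con 1 ⊕ var 3)))
    (var 4 ⊕ ((var 2 ⊕ var 3) ⊕ (con 1 ⊕ (var 0 ⊕ var 1))))
    (con 0) refl (+-mono-≤ h₁ (+-mono-≤ (≤-reflexive (sym h₂)) neg))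

  arc-lin₄ : ∀ (q r s : ℕ) → q < r → q + (1 + s) ≤ r + s
  arc-lin₄ q r s h₁ = ≮⇒≥ λ neg → infeasible (q ∷ r ∷ s ∷ [])
    ((con 1 ⊕ var 0) ⊕ (con 1 ⊕ (var 1 ⊕ var 2)))
    (var 1 ⊕ (var 0 ⊕ (con 1 ⊕ var 2)))
    (con 0) refl (+-mono-≤ h₁ neg)

  arc-lin₅ : ∀ (j r N s : ℕ) → j + r ≡ N → (1 + j) + (r + s) ≤ N + (1 + s)
  arc-lin₅ j r N s h₁ = ≮⇒≥ λ neg → infeasible (j ∷ r ∷ N ∷ s ∷ [])
    ((var 0 ⊕ var 1) ⊕ (con 1 ⊕ (var 2 ⊕ (con 1 ⊕ var 3))))
    (var 2 ⊕ ((con 1 ⊕ var 0) ⊕ (var 1 ⊕ var 3)))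
    (con 0) refl (+-mono-≤ (≤-reflexive h₁) neg)

  arc-lin₆ : ∀ (q j r N : ℕ) → q < r → j + r ≡ N → q ≤ N
  arc-lin₆ q j r N h₁ h₂ = ≮⇒≥ λ neg → infeasible (q ∷ j ∷ r ∷ N ∷ [])
    ((con 1 ⊕ var 0) ⊕ ((var 1 ⊕ var 2) ⊕ (con 1 ⊕ var 3)))
    (var 2 ⊕ (var 3 ⊕ var 0))
    (con 1 ⊕ var 1) refl (+-mono-≤ h₁ (+-mono-≤ (≤-reflexive h₂) neg))

  arc-lin₇ : ∀ (p q j r N : ℕ) → p + (q + (1 + (1 + j))) ≤ N → j + r ≡ N → p + (q + 1) < r
  arc-lin₇ p q j r N h₁ h₂ = ≮⇒≥ λ neg → infeasible (p ∷ q ∷ j ∷ r ∷ N ∷ [])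
    ((var 0 ⊕ (var 1 ⊕ (con 1 ⊕ (con 1 ⊕ var 2)))) ⊕ (var 4 ⊕ (con 1 ⊕ var 3)))
    (var 4 ⊕ ((var 2 ⊕ var 3) ⊕ (con 1 ⊕ (var 0 ⊕ (var 1 ⊕ con 1)))))
    (con 0) refl (+-mono-≤ h₁ (+-mono-≤ (≤-reflexive (sym h₂)) neg))

  arc-lin₈ : ∀ (p q j r N : ℕ) → 1 + (1 + ((1 + j) + (q + p))) ≤ N → (2 + j) + r ≡ N → p + q < r
  arc-lin₈ p q j r N h₁ h₂ = ≮⇒≥ λ neg → infeasible (p ∷ q ∷ j ∷ r ∷ N ∷ [])
    ((con 1 ⊕ (con 1 ⊕ ((con 1 ⊕ var 2) ⊕ (var 1 ⊕ var 0)))) ⊕ (var 4 ⊕ (con 1 ⊕ var 3)))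
    (var 4 ⊕ (((con 2 ⊕ var 2) ⊕ var 3) ⊕ (con 1 ⊕ (var 0 ⊕ var 1))))
    (con 0) refl (+-mono-≤ h₁ (+-mono-≤ (≤-reflexive (sym h₂)) neg))

  arc-lin₉ : ∀ (p q j r N : ℕ) → (1 + q) + ((1 + j) + p) ≤ N → (1 + j) + r ≡ N → p + q < r
  arc-lin₉ p q j r N h₁ h₂ = ≮⇒≥ λ neg → infeasible (p ∷ q ∷ j ∷ r ∷ N ∷ [])
    (((con 1 ⊕ var 1) ⊕ ((con 1 ⊕ var 2) ⊕ var 0)) ⊕ (var 4 ⊕ (con 1 ⊕ var 3)))
    (var 4 ⊕ (((con 1 ⊕ var 2) ⊕ var 3) ⊕ (con 1 ⊕ (var 0 ⊕ var 1))))
    (con 0) refl (+-mono-≤ h₁ (+-mono-≤ (≤-reflexive (sym h₂)) neg))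

  arc-lin₁₀ : ∀ (p k q j N : ℕ) → 1 + (1 + ((1 + k) + ((1 + j) + p))) ≤ N → (1 + j) + q ≡ N → p + (2 + k) < q
  arc-lin₁₀ p k q j N h₁ h₂ = ≮⇒≥ λ neg → infeasible (p ∷ k ∷ q ∷ j ∷ N ∷ [])
    ((con 1 ⊕ (con 1 ⊕ ((con 1 ⊕ var 1) ⊕ ((con 1 ⊕ var 3) ⊕ var 0)))) ⊕ (var 4 ⊕ (con 1 ⊕ var 2)))
    (var 4 ⊕ (((con 1 ⊕ var 3) ⊕ var 2) ⊕ (con 1 ⊕ (var 0 ⊕ (con 2 ⊕ var 1)))))
    (con 0) refl (+-mono-≤ h₁ (+-mono-≤ (≤-reflexive (sym h₂)) neg))

  arc-lin₁₁ : ∀ (j r N s : ℕ) → (2 + j) + r ≡ N → (1 + j) + (r + s) ≤ N + s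
  arc-lin₁₁ j r N s h₁ = ≮⇒≥ λ neg → infeasible (j ∷ r ∷ N ∷ s ∷ [])
    (((con 2 ⊕ var 0) ⊕ var 1) ⊕ (con 1 ⊕ (var 2 ⊕ var 3)))
    (var 2 ⊕ ((con 1 ⊕ var 0) ⊕ (var 1 ⊕ var 3)))
    (con 1) refl (+-mono-≤ (≤-reflexive h₁) neg)

  arc-lin₁₂ : ∀ (j r N s : ℕ) → (2 + j) + r ≡ N → 1 + (1 + (j + (r + s))) ≤ N + s
  arc-lin₁₂ j r N s h₁ = ≮⇒≥ λ neg → infeasible (j ∷ r ∷ N ∷ s ∷ [])
    (((con 2 ⊕ var 0) ⊕ var 1) ⊕ (con 1 ⊕ (var 2 ⊕ var 3)))
    (var 2 ⊕ (con 1 ⊕ (con 1 ⊕ (var 0 ⊕ (var 1 ⊕ var 3)))))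
    (con 0) refl (+-mono-≤ (≤-reflexive h₁) neg)

  arc-lin₁₃ : ∀ (q j r N s : ℕ) → q < r → (2 + j) + r ≡ N → q + (1 + s) ≤ N + s
  arc-lin₁₃ q j r N s h₁ h₂ = ≮⇒≥ λ neg → infeasible (q ∷ j ∷ r ∷ N ∷ s ∷ [])
    ((con 1 ⊕ var 0) ⊕ (((con 2 ⊕ var 1) ⊕ var 2) ⊕ (con 1 ⊕ (var 3 ⊕ var 4))))
    (var 2 ⊕ (var 3 ⊕ (var 0 ⊕ (con 1 ⊕ var 4))))
    (con 2 ⊕ var 1) refl (+-mono-≤ h₁ (+-mono-≤ (≤-reflexive h₂) neg))

  arc-lin₁₄ : ∀ (j r N : ℕ) → (1 + j) + r ≡ N → 1 + j ≤ N
  arc-lin₁₄ j r N h₁ = ≮⇒≥ λ neg → infeasible (j ∷ r ∷ N ∷ [])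
    (((con 1 ⊕ var 0) ⊕ var 1) ⊕ (con 1 ⊕ var 2))
    (var 2 ⊕ (con 1 ⊕ var 0))
    (var 1) refl (+-mono-≤ (≤-reflexive h₁) neg)

  arc-lin₁₅ : ∀ (q j r N : ℕ) → q < r → (1 + j) + r ≡ N → 1 + q ≤ N
  arc-lin₁₅ q j r N h₁ h₂ = ≮⇒≥ λ neg → infeasible (q ∷ j ∷ r ∷ N ∷ [])
    ((con 1 ⊕ var 0) ⊕ (((con 1 ⊕ var 1) ⊕ var 2) ⊕ (con 1 ⊕ var 3)))
    (var 2 ⊕ (var 3 ⊕ (con 1 ⊕ var 0)))
    (con 1 ⊕ var 1) refl (+-mono-≤ h₁ (+-mono-≤ (≤-reflexive h₂) neg))

  arc-lin₁₆ : ∀ (q r s : ℕ) → q < r → (1 + q) + s ≤ r + s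
  arc-lin₁₆ q r s h₁ = ≮⇒≥ λ neg → infeasible (q ∷ r ∷ s ∷ [])
    ((con 1 ⊕ var 0) ⊕ (con 1 ⊕ (var 1 ⊕ var 2)))
    (var 1 ⊕ ((con 1 ⊕ var 0) ⊕ var 2))
    (con 0) refl (+-mono-≤ h₁ neg)

  arc-lin₁₇ : ∀ (j r N s : ℕ) → (1 + j) + r ≡ N → (1 + j) + (r + s) ≤ N + s
  arc-lin₁₇ j r N s h₁ = ≮⇒≥ λ neg → infeasible (j ∷ r ∷ N ∷ s ∷ [])
    (((con 1 ⊕ var 0) ⊕ var 1) ⊕ (con 1 ⊕ (var 2 ⊕ var 3)))
    (var 2 ⊕ ((con 1 ⊕ var 0) ⊕ (var 1 ⊕ var 3)))
    (con 0) refl (+-mono-≤ (≤-reflexive h₁) neg)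

  arc-lin₁₈ : ∀ (k q s : ℕ) → 2 + k < q → (1 + k) + (2 + s) ≤ q + s
  arc-lin₁₈ k q s h₁ = ≮⇒≥ λ neg → infeasible (k ∷ q ∷ s ∷ [])
    ((con 1 ⊕ (con 2 ⊕ var 0)) ⊕ (con 1 ⊕ (var 1 ⊕ var 2)))
    (var 1 ⊕ ((con 1 ⊕ var 0) ⊕ (con 2 ⊕ var 2)))
    (con 0) refl (+-mono-≤ h₁ neg)

  arc-lin₁₉ : ∀ (k j q N s : ℕ) → 2 + k < q → (1 + j) + q ≡ N → (1 + k) + (2 + s) ≤ N + s
  arc-lin₁₉ k j q N s h₁ h₂ = ≮⇒≥ λ neg → infeasible (k ∷ j ∷ q ∷ N ∷ s ∷ [])
    ((con 1 ⊕ (con 2 ⊕ var 0)) ⊕ (((con 1 ⊕ var 1) ⊕ var 2) ⊕ (con 1 ⊕ (var 3 ⊕ var 4))))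
    (var 2 ⊕ (var 3 ⊕ ((con 1 ⊕ var 0) ⊕ (con 2 ⊕ var 4))))
    (con 1 ⊕ var 1) refl (+-mono-≤ h₁ (+-mono-≤ (≤-reflexive h₂) neg))

  arc-lin₂₀ : ∀ (k j q N s : ℕ) → 2 + k < q → (1 + j) + q ≡ N → 1 + (1 + s) ≤ N + s
  arc-lin₂₀ k j q N s h₁ h₂ = ≮⇒≥ λ neg → infeasible (k ∷ j ∷ q ∷ N ∷ s ∷ [])
    ((con 1 ⊕ (con 2 ⊕ var 0)) ⊕ (((con 1 ⊕ var 1) ⊕ var 2) ⊕ (con 1 ⊕ (var 3 ⊕ var 4))))
    (var 2 ⊕ (var 3 ⊕ (con 1 ⊕ (con 1 ⊕ var 4))))
    (con 2 ⊕ var 0 ⊕ var 1) refl (+-mono-≤ h₁ (+-mono-≤ (≤-reflexive h₂) neg))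

  arc-lin₂₁ : ∀ (k q s : ℕ) → 2 + k < q → 1 + s ≤ q + s
  arc-lin₂₁ k q s h₁ = ≮⇒≥ λ neg → infeasible (k ∷ q ∷ s ∷ [])
    ((con 1 ⊕ (con 2 ⊕ var 0)) ⊕ (con 1 ⊕ (var 1 ⊕ var 2)))
    (var 1 ⊕ (con 1 ⊕ var 2))
    (con 2 ⊕ var 0) refl (+-mono-≤ h₁ neg)

  arc-lin₂₂ : ∀ (k q s : ℕ) → 2 + k < q → 1 + (1 + s) ≤ q + s
  arc-lin₂₂ k q s h₁ = ≮⇒≥ λ neg → infeasible (k ∷ q ∷ s ∷ [])
    ((con 1 ⊕ (con 2 ⊕ var 0)) ⊕ (con 1 ⊕ (var 1 ⊕ var 2)))
    (var 1 ⊕ (con 1 ⊕ (con 1 ⊕ var 2)))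
    (con 1 ⊕ var 0) refl (+-mono-≤ h₁ neg)

  arc-lin₂₃ : ∀ (k j q N : ℕ) → 2 + k < q → (1 + j) + q ≡ N → 1 + k ≤ N
  arc-lin₂₃ k j q N h₁ h₂ = ≮⇒≥ λ neg → infeasible (k ∷ j ∷ q ∷ N ∷ [])
    ((con 1 ⊕ (con 2 ⊕ var 0)) ⊕ (((con 1 ⊕ var 1) ⊕ var 2) ⊕ (con 1 ⊕ var 3)))
    (var 2 ⊕ (var 3 ⊕ (con 1 ⊕ var 0)))
    (con 3 ⊕ var 1) refl (+-mono-≤ h₁ (+-mono-≤ (≤-reflexive h₂) neg))

  arc-lin₂₄ : ∀ (j r N : ℕ) → (2 + j) + r ≡ N → 1 ≤ N
  arc-lin₂₄ j r N h₁ = ≮⇒≥ λ neg → infeasible (j ∷ r ∷ N ∷ [])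
    (((con 2 ⊕ var 0) ⊕ var 1) ⊕ (con 1 ⊕ var 2))
    (var 2 ⊕ con 1)
    (con 1 ⊕ var 0 ⊕ var 1) refl (+-mono-≤ (≤-reflexive h₁) neg)

  arc-lin₂₅ : ∀ (q r N j : ℕ) → q < r → (2 + j) + r ≡ N → q ≤ N
  arc-lin₂₅ q r N j h₁ h₂ = ≮⇒≥ λ neg → infeasible (q ∷ r ∷ N ∷ j ∷ [])
    ((con 1 ⊕ var 0) ⊕ (((con 2 ⊕ var 3) ⊕ var 1) ⊕ (con 1 ⊕ var 2)))
    (var 1 ⊕ (var 2 ⊕ var 0))
    (con 3 ⊕ var 3) refl (+-mono-≤ h₁ (+-mono-≤ (≤-reflexive h₂) neg))

  arc-lin₂₆ : ∀ (r s : ℕ) → 0 < r → 1 + s ≤ r + s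
  arc-lin₂₆ r s h₁ = ≮⇒≥ λ neg → infeasible (r ∷ s ∷ [])
    ((con 1 ⊕ con 0) ⊕ (con 1 ⊕ (var 0 ⊕ var 1)))
    (var 0 ⊕ (con 1 ⊕ var 1))
    (con 0) refl (+-mono-≤ h₁ neg)

  arc-lin₂₇ : ∀ (j r N : ℕ) → (2 + j) + r ≡ N → 1 + j ≤ N
  arc-lin₂₇ j r N h₁ = ≮⇒≥ λ neg → infeasible (j ∷ r ∷ N ∷ [])
    (((con 2 ⊕ var 0) ⊕ var 1) ⊕ (con 1 ⊕ var 2))
    (var 2 ⊕ (con 1 ⊕ var 0))
    (con 1 ⊕ var 1) refl (+-mono-≤ (≤-reflexive h₁) neg)

  arc-lin₂₈ : ∀ (q j N s : ℕ) → (1 + j) + q ≡ N → (1 + j) + (q + s) ≤ N + (1 + s)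
  arc-lin₂₈ q j N s h₁ = ≮⇒≥ λ neg → infeasible (q ∷ j ∷ N ∷ s ∷ [])
    (((con 1 ⊕ var 1) ⊕ var 0) ⊕ (con 1 ⊕ (var 2 ⊕ (con 1 ⊕ var 3))))
    (var 2 ⊕ ((con 1 ⊕ var 1) ⊕ (var 0 ⊕ var 3)))
    (con 1) refl (+-mono-≤ (≤-reflexive h₁) neg)

  arc-lin₂₉ : ∀ (q j N s : ℕ) → (1 + j) + q ≡ N → (1 + j) + (q + s) ≤ N + (2 + s)
  arc-lin₂₉ q j N s h₁ = ≮⇒≥ λ neg → infeasible (q ∷ j ∷ N ∷ s ∷ [])
    (((con 1 ⊕ var 1) ⊕ var 0) ⊕ (con 1 ⊕ (var 2 ⊕ (con 2 ⊕ var 3))))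
    (var 2 ⊕ ((con 1 ⊕ var 1) ⊕ (var 0 ⊕ var 3)))
    (con 2) refl (+-mono-≤ (≤-reflexive h₁) neg)

  arc-lin₃₀ : ∀ (j q N s : ℕ) → (2 + j) + q ≡ N → 1 + (1 + (j + (q + s))) ≤ N + (1 + s)
  arc-lin₃₀ j q N s h₁ = ≮⇒≥ λ neg → infeasible (j ∷ q ∷ N ∷ s ∷ [])
    (((con 2 ⊕ var 0) ⊕ var 1) ⊕ (con 1 ⊕ (var 2 ⊕ (con 1 ⊕ var 3))))
    (var 2 ⊕ (con 1 ⊕ (con 1 ⊕ (var 0 ⊕ (var 1 ⊕ var 3)))))
    (con 1) refl (+-mono-≤ (≤-reflexive h₁) neg)

  arc-lin₃₁ : ∀ (j q N s : ℕ) → (2 + j) + q ≡ N → 1 + (1 + (j + (q + s))) ≤ N + (q + s)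
  arc-lin₃₁ j q N s h₁ = ≮⇒≥ λ neg → infeasible (j ∷ q ∷ N ∷ s ∷ [])
    (((con 2 ⊕ var 0) ⊕ var 1) ⊕ (con 1 ⊕ (var 2 ⊕ (var 1 ⊕ var 3))))
    (var 2 ⊕ (con 1 ⊕ (con 1 ⊕ (var 0 ⊕ (var 1 ⊕ var 3)))))
    (var 1) refl (+-mono-≤ (≤-reflexive h₁) neg)

  arc-lin₃₂ : ∀ (j q N s : ℕ) → (2 + j) + q ≡ N → (1 + j) + (q + s) ≤ N + (1 + s)
  arc-lin₃₂ j q N s h₁ = ≮⇒≥ λ neg → infeasible (j ∷ q ∷ N ∷ s ∷ [])
    (((con 2 ⊕ var 0) ⊕ var 1) ⊕ (con 1 ⊕ (var 2 ⊕ (con 1 ⊕ var 3))))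
    (var 2 ⊕ ((con 1 ⊕ var 0) ⊕ (var 1 ⊕ var 3)))
    (con 2) refl (+-mono-≤ (≤-reflexive h₁) neg)

  arc-lin₃₃ : ∀ (k j q N s : ℕ) → 2 + k < q → (1 + j) + q ≡ N → (1 + k) + (2 + s) ≤ N + (1 + s)
  arc-lin₃₃ k j q N s h₁ h₂ = ≮⇒≥ λ neg → infeasible (k ∷ j ∷ q ∷ N ∷ s ∷ [])
    ((con 1 ⊕ (con 2 ⊕ var 0)) ⊕ (((con 1 ⊕ var 1) ⊕ var 2) ⊕ (con 1 ⊕ (var 3 ⊕ (con 1 ⊕ var 4)))))
    (var 2 ⊕ (var 3 ⊕ ((con 1 ⊕ var 0) ⊕ (con 2 ⊕ var 4))))
    (con 2 ⊕ var 1) refl (+-mono-≤ h₁ (+-mono-≤ (≤-reflexive h₂) neg))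

module _ {n m : ℕ} (inc : Fin n → Fin m → Bool) where
  open Incidence inc

  module Reroute {l : ℕ} (C : Cycle l) (0<N : 0 < double l) (max : Maximal l) where
    open OnCycle C

    record OuterPath (a : Node) (P : List Node) (b : Node) : Set where
      constructor outer
      field
        walk : Walk a P b
        uniq : Unique P
        out  : ∀ {u} → u ∈ P → Outside u

    open OuterPath

    reversePath : ∀ {a P b} → OuterPath a P b → OuterPath b (reverse P) a
    reversePath {P = P} p = outer (walk-reverse (walk p)) (Unique-reverse (uniq p)) (out p ∘ ∈-reverse⁻ P)

    path#arc : ∀ {a P b} → OuterPath a P b → ∀ s k → Disjoint P (arc s k)
    path#arc p s k = outside-arc s k (out p)

    -- `P` takes the place of the `q - 1` nodes strictly between `c s` and `c (q + s)`; the `j + 1`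
    -- nodes from `c (q + s)` round to `c s` are kept.
    arc-bound₀ : ∀ {a P b} → OuterPath a P b → ∀ s q j → a ~ c s → b ~ c (q + s) → 0 < q → j + q ≡ N →
      length P < q
    arc-bound₀ {a} {P} {b} p s q j a~ b~ 0<q j+q = arc-lin₁ (length P) j q N (subst (_≤ N) len (max
        (walk-++ (walk p) b~ (walk-arc (q + s) j))
        (subst (_~ a) (sym closing) (~-sym a (c s) a~))
        (Unique.++⁺ (uniq p) (arc-unique (q + s) (suc j) (arc-lin₂ q j N 0<q j+q)) (path#arc p (q + s) (suc j)))))
        j+q
      where
      closing : c (j + (q + s)) ≡ c s
      closing = trans (cong c (trans (sym (+-assoc j q s)) (cong (_+ s) j+q))) (c-per s)
      len : length (P ++ arc (q + s) (suc j)) ≡ length P + suc j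
      len = trans (length-++ P) (cong (length P +_) (length-arc (q + s) (suc j)))

    -- An attachment more than one turn ahead is moved back by `N`, which only makes `q` smaller.
    arc-bound-fuel : ∀ k {a P b} → OuterPath a P b → ∀ s q → q ≤ k → a ~ c s → b ~ c (q + s) → 0 < q →
      length P < q
    arc-bound-fuel zero p s zero z≤n a~ b~ ()
    arc-bound-fuel (suc k) {b = b} p s q q≤ a~ b~ 0<q with q ≤? N
    ... | yes q≤N = arc-bound₀ p s q (N ∸ q) a~ b~ 0<q (m∸n+n≡m q≤N)
    ... | no q≰N = <-≤-trans
      (arc-bound-fuel k p s (q ∸ N) (s≤s⁻¹ (≤-trans (∸-monoʳ-< 0<N (<⇒≤ (≰⇒> q≰N))) q≤)) a~
        (subst (b ~_) (trans (cong c pos) (c-per _)) b~) (m<n⇒0<n∸m (≰⇒> q≰N)))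
      (m∸n≤m q N)
      where
      pos : q + s ≡ N + (q ∸ N + s)
      pos = trans (cong (_+ s) (sym (m+[n∸m]≡n (<⇒≤ (≰⇒> q≰N))))) (+-assoc N (q ∸ N) s)

    arc-bound : ∀ {a P b} → OuterPath a P b → ∀ s q → a ~ c s → b ~ c (q + s) → 0 < q → length P < q
    arc-bound p s q = arc-bound-fuel q p s q ≤-refl

    -- The new cycle runs along `P`, backwards from `c (suc q₀ + s)` to `c (1 + s)`, over the chord
    -- to `c (q + s)` and on to `c s`. Only the nodes strictly between positions `suc q₀ + s` and
    -- `q + s` are lost.
    crossing : ∀ {a P b} → OuterPath a P b → ∀ s q₀ q j →
      a ~ c s → b ~ c (suc q₀ + s) → c (1 + s) ~ c (q + s) → suc q₀ < q → j + q ≡ N →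
      length P + suc q₀ < q
    crossing {a} {P} {b} p s q₀ q j a~ b~ chord q₀<q j+q = arc-lin₃ (length P) (suc q₀) j q N (subst (_≤ N) len (max
        (walk-++ (walk p) (subst (λ t → b ~ c t) (sym (+-suc q₀ s)) b~)
          (walk-++ (walk-reverse (walk-arc (1 + s) q₀)) chord (walk-arc (q + s) j)))
        (subst (_~ a) (sym closing) (~-sym a (c s) a~))
        (Unique.++⁺ (uniq p)
          (Unique.++⁺ (Unique-reverse (arc-unique (1 + s) (suc q₀) (arc-lin₆ (suc q₀) j q N q₀<q j+q)))
                      (arc-unique (q + s) (suc j) (arc-lin₂ q j N (≤-<-trans z≤n q₀<q) j+q))
                      (Disjoint-reverseˡ (arc-disjoint (1 + s) (suc q₀) (q + s) (suc j) (arc-lin₄ (suc q₀) q s q₀<q) (arc-lin₅ j q N s j+q))))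
          (Disjoint-++ʳ (Disjoint-reverseʳ (path#arc p (1 + s) (suc q₀))) (path#arc p (q + s) (suc j))))))
        j+q
      where
      closing : c (j + (q + s)) ≡ c s
      closing = trans (cong c (trans (sym (+-assoc j q s)) (cong (_+ s) j+q))) (c-per s)
      len : length (P ++ reverse (arc (1 + s) (suc q₀)) ++ arc (q + s) (suc j)) ≡ length P + (suc q₀ + suc j)
      len = trans (length-++ P) (cong (length P +_) (trans (length-++ (reverse (arc (1 + s) (suc q₀))))
        (cong₂ _+_ (trans (length-reverse (arc (1 + s) (suc q₀))) (length-arc (1 + s) (suc q₀))) (length-arc (q + s) (suc j)))))

    -- The chord of `crossing` becomes a detour through the outer node `w`, which accounts for the
    -- extra `1`.
    crossing-via : ∀ {a P b} → OuterPath a P b → ∀ {w} → Outside w → ¬ w ∈ P → ∀ s q₀ q j →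
      a ~ c s → b ~ c (suc q₀ + s) → w ~ c (1 + s) → w ~ c (q + s) → suc q₀ < q → j + q ≡ N →
      length P + (suc q₀ + 1) < q
    crossing-via {a} {P} {b} p {w} out-w w∉P s q₀ q j a~ b~ w~ w~' q₀<q j+q =
      arc-lin₇ (length P) (suc q₀) j q N (subst (_≤ N) len (max
        (walk-++ (walk p) (subst (λ t → b ~ c t) (sym (+-suc q₀ s)) b~)
          (walk-++ (walk-reverse (walk-arc (1 + s) q₀)) (~-sym w (c (1 + s)) w~)
            (walk-++ (single w) w~' (walk-arc (q + s) j))))
        (subst (_~ a) (sym closing) (~-sym a (c s) a~))
        (Unique.++⁺ (uniq p)
          (Unique.++⁺ (Unique-reverse (arc-unique (1 + s) (suc q₀) (arc-lin₆ (suc q₀) j q N q₀<q j+q)))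
            (Unique.++⁺ ([] ∷ []) (arc-unique (q + s) (suc j) (arc-lin₂ q j N (≤-<-trans z≤n q₀<q) j+q)) (w# (q + s) (suc j)))
            (Disjoint-++ʳ {M = w ∷ []} (Disjoint-sym (Disjoint-reverseʳ {M = arc (1 + s) (suc q₀)} (w# (1 + s) (suc q₀))))
              (Disjoint-reverseˡ (arc-disjoint (1 + s) (suc q₀) (q + s) (suc j)
                (arc-lin₄ (suc q₀) q s q₀<q) (arc-lin₅ j q N s j+q)))))
          (Disjoint-++ʳ {M = reverse (arc (1 + s) (suc q₀))} (Disjoint-reverseʳ {M = arc (1 + s) (suc q₀)} (path#arc p (1 + s) (suc q₀)))
            (Disjoint-++ʳ {M = w ∷ []} (λ { (u∈P , here refl) → w∉P u∈P }) (path#arc p (q + s) (suc j)))))))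
        j+q
      where
      w# : ∀ s k → Disjoint (w ∷ []) (arc s k)
      w# s k = outside-arc s k λ { (here refl) → out-w }
      closing : c (j + (q + s)) ≡ c s
      closing = trans (cong c (trans (sym (+-assoc j q s)) (cong (_+ s) j+q))) (c-per s)
      len : length (P ++ reverse (arc (1 + s) (suc q₀)) ++ w ∷ arc (q + s) (suc j)) ≡ length P + (suc q₀ + (1 + suc j))
      len = trans (length-++ P) (cong (length P +_) (trans (length-++ (reverse (arc (1 + s) (suc q₀))))
        (cong₂ _+_ (trans (length-reverse (arc (1 + s) (suc q₀))) (length-arc (1 + s) (suc q₀)))
                   (cong suc (length-arc (q + s) (suc j))))))

    length-path-end : ∀ {A : Set} (L P : List A) → length (L ++ reverse P) ≡ length L + length P
    length-path-end L P = trans (length-++ L) (cong (length L +_) (length-reverse P))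

    length-reverse-arc : ∀ s k → length (reverse (arc s k)) ≡ k
    length-reverse-arc s k = trans (length-reverse (arc s k)) (length-arc s k)

    -- The cycle c s, c (N-1), c q … c (N-2), c 1 … c (suc q₀), P⁻¹ (positions relative to s).
    exchange : ∀ {a P b} → OuterPath a P b → ∀ s q₀ q j →
      a ~ c s → b ~ c (suc q₀ + s) → c (1 + (j + (q + s))) ~ c (q + s) → c (j + (q + s)) ~ c (1 + s) →
      suc q₀ < q → (2 + j) + q ≡ N → length P + suc q₀ < q
    exchange {a} {P} {b} p s q₀ q j a~ b~ chord chord' q₀<q j+q = arc-lin₈ (length P) (suc q₀) j q N (subst (_≤ N) len (max
        (walk-++ (single (c s)) first
          (walk-++ (single (c (1 + (j + (q + s))))) chord
            (walk-++ (walk-arc (q + s) j) chord'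
              (walk-++ (walk-arc (1 + s) q₀)
                 (~-sym b _ (subst (λ t → b ~ c t) (sym (+-suc q₀ s)) b~))
                 (walk-reverse (walk p))))))
        a~
        (Unique.++⁺ (arc-unique s 1 (arc-lin₂₄ j q N j+q))
          (Unique.++⁺ (arc-unique (1 + (j + (q + s))) 1 (arc-lin₂₄ j q N j+q))
            (Unique.++⁺ (arc-unique (q + s) (suc j) (arc-lin₂₇ j q N j+q))
              (Unique.++⁺ (arc-unique (1 + s) (suc q₀) (arc-lin₂₅ (suc q₀) q N j q₀<q j+q)) (Unique-reverse (uniq p))
                (#P (1 + s) (suc q₀)))
              (Disjoint-++ʳ (Disjoint-sym (arc-disjoint (1 + s) (suc q₀) (q + s) (suc j) (arc-lin₄ (suc q₀) q s q₀<q) (arc-lin₃₂ j q N s j+q)))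
                (#P (q + s) (suc j))))
            (Disjoint-++ʳ (Disjoint-sym (arc-disjoint (q + s) (suc j) (1 + (j + (q + s))) 1 ≤-refl (arc-lin₃₁ j q N s j+q)))
              (Disjoint-++ʳ (Disjoint-sym (arc-disjoint (1 + s) (suc q₀) (1 + (j + (q + s))) 1
                  (≤-trans (arc-lin₄ (suc q₀) q s q₀<q) (m≤n+m (q + s) (1 + j))) (arc-lin₃₀ j q N s j+q)))
                (#P (1 + (j + (q + s))) 1))))
          (Disjoint-++ʳ (arc-disjoint s 1 (1 + (j + (q + s))) 1
              (s≤s (≤-trans (m≤n+m s q) (m≤n+m (q + s) j))) (arc-lin₁₂ j q N s j+q))
            (Disjoint-++ʳ (arc-disjoint s 1 (q + s) (suc j) (arc-lin₂₆ q s 0<q) (arc-lin₁₁ j q N s j+q))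
              (Disjoint-++ʳ (arc-disjoint s 1 (1 + s) (suc q₀) ≤-refl (arc-lin₁₃ (suc q₀) j q N s q₀<q j+q)) (#P s 1)))))))
        j+q
      where
      0<q : 0 < q
      0<q = ≤-<-trans z≤n q₀<q
      #P : ∀ s k → Disjoint (arc s k) (reverse P)
      #P s k = Disjoint-reverseʳ (Disjoint-sym (path#arc p s k))
      wrap : c (2 + (j + (q + s))) ≡ c s
      wrap = trans (cong c (trans (cong (2 +_) (sym (+-assoc j q s))) (cong (_+ s) j+q))) (c-per s)
      first : c s ~ c (1 + (j + (q + s)))
      first = subst (_~ c (1 + (j + (q + s)))) wrap (c-adj′ (1 + (j + (q + s))))
      len : length (c s ∷ c (1 + (j + (q + s))) ∷ arc (q + s) (suc j) ++ arc (1 + s) (suc q₀) ++ reverse P)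
            ≡ 1 + (1 + ((1 + j) + (suc q₀ + length P)))
      len = cong (suc ∘ suc) (trans (length-++ (arc (q + s) (suc j))) (cong₂ _+_ (length-arc (q + s) (suc j))
        (trans (length-path-end (arc (1 + s) (suc q₀)) P) (cong (_+ length P) (length-arc (1 + s) (suc q₀))))))

    -- The mirror image of `crossing`: the chord now ends at `c (j + (q + s))`, the predecessor of
    -- `c s`, and the arc from there to `c (q + s)` is traversed backwards.
    crossing′ : ∀ {a P b} → OuterPath a P b → ∀ s q₀ q j →
      a ~ c s → b ~ c (q + s) → c (q₀ + s) ~ c (j + (q + s)) → q₀ < q → (1 + j) + q ≡ N →
      length P + q₀ < q
    crossing′ {a} {P} {b} p s q₀ q j a~ b~ chord q₀<q j+q = arc-lin₉ (length P) q₀ j q N (subst (_≤ N) len (max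
        (walk-++ (walk-arc s q₀) chord
          (walk-++ (walk-reverse (walk-arc (q + s) j)) (~-sym b _ b~) (walk-reverse (walk p))))
        a~
        (Unique.++⁺ (arc-unique s (suc q₀) (arc-lin₁₅ q₀ j q N q₀<q j+q))
          (Unique.++⁺ (Unique-reverse (arc-unique (q + s) (suc j) (arc-lin₁₄ j q N j+q))) (Unique-reverse (uniq p))
            (Disjoint-reverseˡ (#P (q + s) (suc j))))
          (Disjoint-++ʳ (Disjoint-reverseʳ (arc-disjoint s (suc q₀) (q + s) (suc j) (arc-lin₁₆ q₀ q s q₀<q) (arc-lin₁₇ j q N s j+q)))
            (#P s (suc q₀))))))
        j+q
      where
      #P : ∀ s k → Disjoint (arc s k) (reverse P)
      #P s k = Disjoint-reverseʳ (Disjoint-sym (path#arc p s k))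
      len : length (arc s (suc q₀) ++ reverse (arc (q + s) (suc j)) ++ reverse P) ≡ (1 + q₀) + ((1 + j) + length P)
      len = trans (length-++ (arc s (suc q₀))) (cong₂ _+_ (length-arc s (suc q₀))
        (trans (length-path-end (reverse (arc (q + s) (suc j))) P) (cong (_+ length P) (length-reverse-arc (q + s) (suc j)))))

    -- The cycle c s, c 1, c (k+2) ... c 2, c (N-1) ... c q, P⁻¹ (positions relative to s), which is
    -- `exchange` in the opposite direction round C.
    exchange′ : ∀ {a P b} → OuterPath a P b → ∀ s k q j →
      a ~ c s → b ~ c (q + s) → c (1 + s) ~ c (k + (2 + s)) → c (2 + s) ~ c (j + (q + s)) →
      2 + k < q → (1 + j) + q ≡ N → length P + (2 + k) < q
    exchange′ {a} {P} {b} p s k q j a~ b~ chord chord' k<q j+q = arc-lin₁₀ (length P) k q j N (subst (_≤ N) len (max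
        (walk-++ (single (c s)) (c-adj s)
          (walk-++ (single (c (1 + s))) chord
            (walk-++ (walk-reverse (walk-arc (2 + s) k)) chord'
              (walk-++ (walk-reverse (walk-arc (q + s) j)) (~-sym b _ b~) (walk-reverse (walk p))))))
        a~
        (Unique.++⁺ (arc-unique s 1 1≤N)
          (Unique.++⁺ (arc-unique (1 + s) 1 1≤N)
            (Unique.++⁺ (Unique-reverse (arc-unique (2 + s) (suc k) (arc-lin₂₃ k j q N k<q j+q)))
              (Unique.++⁺ (Unique-reverse (arc-unique (q + s) (suc j) (arc-lin₁₄ j q N j+q))) (Unique-reverse (uniq p))
                (Disjoint-reverseˡ (#P (q + s) (suc j))))
              (Disjoint-++ʳ (Disjoint-reverseˡ (Disjoint-reverseʳ
                  (arc-disjoint (2 + s) (suc k) (q + s) (suc j) (arc-lin₁₈ k q s k<q) (arc-lin₂₉ q j N s j+q))))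
                (Disjoint-reverseˡ (#P (2 + s) (suc k)))))
            (Disjoint-++ʳ (Disjoint-reverseʳ (arc-disjoint (1 + s) 1 (2 + s) (suc k) ≤-refl (arc-lin₃₃ k j q N s k<q j+q)))
              (Disjoint-++ʳ (Disjoint-reverseʳ (arc-disjoint (1 + s) 1 (q + s) (suc j) (arc-lin₂₂ k q s k<q) (arc-lin₂₈ q j N s j+q)))
                (#P (1 + s) 1))))
          (Disjoint-++ʳ (arc-disjoint s 1 (1 + s) 1 ≤-refl (arc-lin₂₀ k j q N s k<q j+q))
            (Disjoint-++ʳ (Disjoint-reverseʳ (arc-disjoint s 1 (2 + s) (suc k) (n≤1+n _) (arc-lin₁₉ k j q N s k<q j+q)))
              (Disjoint-++ʳ (Disjoint-reverseʳ (arc-disjoint s 1 (q + s) (suc j) (arc-lin₂₁ k q s k<q) (arc-lin₁₇ j q N s j+q)))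
                (#P s 1)))))))
        j+q
      where
      1≤N : 1 ≤ N
      1≤N = subst (1 ≤_) j+q (s≤s z≤n)
      #P : ∀ s k → Disjoint (arc s k) (reverse P)
      #P s k = Disjoint-reverseʳ (Disjoint-sym (path#arc p s k))
      len : length (c s ∷ c (1 + s) ∷ reverse (arc (2 + s) (suc k)) ++ reverse (arc (q + s) (suc j)) ++ reverse P)
            ≡ 1 + (1 + ((1 + k) + ((1 + j) + length P)))
      len = cong (suc ∘ suc) (trans (length-++ (reverse (arc (2 + s) (suc k)))) (cong₂ _+_ (length-reverse-arc (2 + s) (suc k))
        (trans (length-path-end (reverse (arc (q + s) (suc j))) P) (cong (_+ length P) (length-reverse-arc (q + s) (suc j))))))

-- Longest cycles

find : ∀ {k} (f : Fin k → Bool) → (∃ λ x → f x ≡ true) ⊎ (∀ x → ¬ f x ≡ true)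
find f with Fin.any? (λ x → f x Bool.≟ true)
... | yes p = inj₁ p
... | no ¬p = inj₂ λ x fx → ¬p (x , fx)

abstract
  edge-lin₁ : ∀ (r n : ℕ) → r + r + 1 ≤ n → n ≤ r + r → ⊥
  edge-lin₁ r n h₁ h₂ = infeasible (r ∷ n ∷ [])
    ((var 0 ⊕ var 0 ⊕ con 1) ⊕ var 1)
    (var 1 ⊕ (var 0 ⊕ var 0))
    (con 0) refl (+-mono-≤ h₁ h₂)

record Design (n m r d : ℕ) : Set where
  field
    inc   : Fin n → Fin m → Bool
    size  : ∀ y → count (λ x → inc x y) ≡ r
    deg   : ∀ x → d ≤ count (inc x)
    ext   : ∀ y y' → (∀ x → inc x y ≡ inc x y') → y ≡ y'
    n≤2r  : n ≤ r + r
    3≤r   : 3 ≤ r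

module Edges {n m r d : ℕ} (D : Design n m r d) where
  open Design D public
  open Incidence inc public

  infix 4 _∈ᴱ_ _∉ᴱ_
  _∈ᴱ_ _∉ᴱ_ : Fin n → Fin m → Set
  x ∈ᴱ y = inc x y ≡ true
  x ∉ᴱ y = ¬ x ∈ᴱ y

  _∈ᴱ?_ : ∀ x y → Dec (x ∈ᴱ y)
  x ∈ᴱ? y = inc x y Bool.≟ true

  ⊆⇒≡ : ∀ {y y'} → (∀ x → x ∈ᴱ y → x ∈ᴱ y') → y ≡ y'
  ⊆⇒≡ {y} {y'} h = ext y y' λ x → equal x (h x)
      (count-⊑⁻ {f = λ x → inc x y} {g = λ x → inc x y'} h (≤-reflexive (trans (size y') (sym (size y)))) x)
    where
    equal : ∀ x → (x ∈ᴱ y → x ∈ᴱ y') → (x ∈ᴱ y' → x ∈ᴱ y) → inc x y ≡ inc x y'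
    equal x f g with inc x y | inc x y'
    ... | true  | true  = refl
    ... | true  | false = sym (f refl)
    ... | false | true  = g refl
    ... | false | false = refl

  difference : ∀ {y y'} → y ≢ y' → ∃ λ x → x ∈ᴱ y × x ∉ᴱ y'
  difference {y} {y'} y≢y' with find (λ x → inc x y ∧ not (inc x y'))
  ... | inj₁ (x , h) = x , proj₁ (∧-elim h) , not-elim (proj₂ (∧-elim h))
  ... | inj₂ none = contradiction
    (⊆⇒≡ λ x x∈y → Dec-stable x (λ x∉y' → none x (∧-intro x∈y (not-intro x∉y')))) y≢y'
    where
    Dec-stable : ∀ x → ¬ x ∉ᴱ y' → x ∈ᴱ y'
    Dec-stable x h with x ∈ᴱ? y'
    ... | yes p = p
    ... | no ¬p = ⊥-elim (h ¬p)

  count-others : ∀ x f → d ≤ 1 + count (remove f (inc x))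
  count-others x f = ≤-trans (deg x) (subst (_≤ 1 + count (remove f (inc x))) (sym (count-remove f (inc x)))
    (+-monoˡ-≤ _ (bit≤1 (inc x f))))

  another : 2 ≤ d → ∀ x f → ∃ λ g → g ≢ f × x ∈ᴱ g
  another 2≤d x f with count-witness (remove f (inc x)) (s≤s⁻¹ (≤-trans 2≤d (count-others x f)))
  ... | g , h = g , remove-elim f (inc x) g h

  another₂ : 3 ≤ d → ∀ x f → ∃ λ g → ∃ λ h → g ≢ h × (g ≢ f × x ∈ᴱ g) × (h ≢ f × x ∈ᴱ h)
  another₂ 3≤d x f with count-witness₂ (remove f (inc x)) (s≤s⁻¹ (≤-trans 3≤d (count-others x f)))
  ... | g , h , g≢h , rg , rh = g , h , g≢h , remove-elim f (inc x) g rg , remove-elim f (inc x) h rh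

  disjoint-bound : ∀ y (g : Fin n → Bool) {L} → Unique L →
    (∀ x → x ∈ᴱ y → g x ≡ true → ⊥) → (∀ {x} → x ∈ L → x ∉ᴱ y) → (∀ {x} → x ∈ L → ¬ g x ≡ true) →
    r + count g + length L ≤ n
  disjoint-bound y g {L} uL y#g L#y L#g = begin
    r + count g + length L                           ≡⟨ cong (λ t → t + count g + length L) (sym (size y)) ⟩
    count (λ x → inc x y) + count g + length L       ≤⟨ +-monoˡ-≤ (length L)
       (count-disjoint (λ x → inc x y) g (λ x → inc x y ∨ g x) (λ _ → ∨-introˡ) (λ x → ∨-introʳ {inc x y}) y#g) ⟩
    count (λ x → inc x y ∨ g x) + length L           ≤⟨ count-pack (λ _ → true) _ uL (λ _ _ → refl) (λ _ → refl)
                                                          (λ {x} x∈L h → either x∈L (∨-elim {inc x y} h)) ⟩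
    count {n} (λ _ → true)                           ≤⟨ count≤ _ ⟩
    n                                                ∎
    where
    open ≤-Reasoning
    either : ∀ {x} → x ∈ L → x ∈ᴱ y ⊎ g x ≡ true → ⊥
    either x∈L (inj₁ h) = L#y x∈L h
    either x∈L (inj₂ h) = L#g x∈L h

  covered : ∀ {f y} → (∀ x → x ∈ᴱ f → x ∈ᴱ y → ⊥) → ∀ x → x ∉ᴱ f → x ∉ᴱ y → ⊥
  covered {f} {y} f#y x x∉f x∉y = edge-lin₁ r n
    (subst (λ t → r + t + 1 ≤ n) (size y)
      (disjoint-bound f (λ x → inc x y) {x ∷ []} ([] ∷ []) f#y (λ { (here refl) → x∉f }) (λ { (here refl) → x∉y }))) n≤2r

  disjoint-unique : ∀ {f y y'} → (∀ x → x ∈ᴱ f → x ∈ᴱ y → ⊥) → (∀ x → x ∈ᴱ f → x ∈ᴱ y' → ⊥) → y ≡ y'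
  disjoint-unique {f} {y} {y'} f#y f#y' with y Fin.≟ y'
  ... | yes eq = eq
  ... | no y≢y' with difference y≢y'
  ...   | x , x∈y , x∉y' = ⊥-elim (covered f#y' x (λ x∈f → f#y x x∈f x∈y) x∉y')

  record LongestCycle (l : ℕ) : Set where
    field
      C    : Cycle l
      2≤l  : 2 ≤ l
      max  : Maximal l
      l<n  : l < n
      l<m  : l < m
      l<2d : l < d + d

  abstract
    d-lin : ∀ (l d : ℕ) → 2 ≤ l → l < d + d → 2 ≤ d
    d-lin l d h₁ h₂ = ≮⇒≥ λ neg → infeasible (l ∷ d ∷ [])
      (con 2 ⊕ ((con 1 ⊕ var 0) ⊕ ((con 1 ⊕ var 1) ⊕ (con 1 ⊕ var 1))))
      (var 0 ⊕ ((var 1 ⊕ var 1) ⊕ (con 2 ⊕ con 2)))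
      (con 0) refl (+-mono-≤ h₁ (+-mono-≤ h₂ (+-mono-≤ neg neg)))

  module Longest {l : ℕ} (K : LongestCycle l) where
    open LongestCycle K public
    open OnCycle C public

    0<l : 0 < l
    0<l = ≤-trans (s≤s z≤n) 2≤l

    0<N : 0 < double l
    0<N = subst (0 <_) (sym (double≡ l)) (≤-trans 0<l (m≤m+n l l))

    open Reroute inc C 0<N max public
    open Periodic l 0<l public

    2≤d : 2 ≤ d
    2≤d = d-lin l d 2≤l l<2d

    S : Fin m → ℕ → Bool
    S f i = inc (v i) f

    T : Fin n → ℕ → Bool
    T x i = inc x (e i)

    per-S : ∀ f → Periodic (S f)
    per-S f i = cong (λ x → inc x f) (per-v i)

    per-T : ∀ x → Periodic (T x)
    per-T x i = cong (inc x) (per-e i)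

    private instance
      l-nonZero : NonZero l
      l-nonZero = >-nonZero 0<l

    per-* : ∀ {A : Set} (g : ℕ → A) → (∀ i → g (l + i) ≡ g i) → ∀ k t → g (k * l + t) ≡ g t
    per-* g per zero    t = refl
    per-* g per (suc k) t = trans (cong g (+-assoc l (k * l) t)) (trans (per (k * l + t)) (per-* g per k t))

    reduce : ∀ {A : Set} (g : ℕ → A) → (∀ i → g (l + i) ≡ g i) → ∀ i → ∃ λ j → j < l × g i ≡ g j
    reduce g per i = i % l , m%n<n i l ,
      trans (cong g (trans (m≡m%n+[m/n]*n i l) (+-comm (i % l) _))) (per-* g per (i / l) (i % l))

    -- Every position is congruent to some `k + a` with `k < l`. Multiples of `l` on both sides
    -- express the congruence without subtraction, in the form that `transfer` consumes.
    offset : ∀ a i → ∃ λ k → k < l × ∃ λ q → ∃ λ q' → q * l + i ≡ q' * l + (k + a)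
    offset a i = t % l , m%n<n t l , a , t / l , (begin
      a * l + i                       ≡⟨ sym (m∸n+n≡m a≤) ⟩
      t + a                           ≡⟨ cong (_+ a) (m≡m%n+[m/n]*n t l) ⟩
      t % l + t / l * l + a           ≡⟨ swap (t % l) (t / l * l) a ⟩
      t / l * l + (t % l + a)         ∎)
      where
      open ≡-Reasoning
      t : ℕ
      t = a * l + i ∸ a
      a≤ : a ≤ a * l + i
      a≤ = ≤-trans (subst (_≤ a * l) (*-identityʳ a) (*-monoʳ-≤ a 0<l)) (m≤m+n _ i)
      swap : ∀ x y z → x + y + z ≡ y + (x + z)
      swap = solve-∀

    transfer : ∀ {A : Set} (g : ℕ → A) → (∀ i → g (l + i) ≡ g i) → ∀ {i j} q q' → q * l + i ≡ q' * l + j → g i ≡ g j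
    transfer g per q q' eq = trans (sym (per-* g per q _)) (trans (cong g eq) (per-* g per q' _))

    e-suc-inj : ∀ a i → e (suc a) ≡ e (suc i) → e a ≡ e i
    e-suc-inj a i eq with offset a i
    ... | zero  , _   , q , q' , h = sym (transfer e per-e q q' h)
    ... | suc k , k<l , q , q' , h = contradiction
      (trans eq (trans (transfer (e ∘ suc) (λ i → trans (cong e (sym (+-suc l i))) (per-e (suc i))) q q' h)
                       (cong e (sym (+-suc (suc k) a)))))
      (inj-e (suc a) (suc k) (s≤s z≤n) k<l)

    some? : ∀ {A} → Periodic A → (∃ λ i → A i ≡ true) ⊎ (∀ i → ¬ A i ≡ true)
    some? {A} pA with 0 <? cnt A
    ... | yes 0< = inj₁ (cnt-witness A 0<)
    ... | no ¬0< = inj₂ λ i Ai → ¬0< (cnt-pos pA i Ai)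

    OutX : Fin n → Set
    OutX x = ∀ i → x ≢ v i

    OutY : Fin m → Set
    OutY y = ∀ i → y ≢ e i

    onX? : ∀ x → (∃ λ i → i < l × x ≡ v i) ⊎ OutX x
    onX? x with _∈?_ Fin._≟_ x (applyUpTo v l)
    ... | yes x∈ = inj₁ (∈-applyUpTo⁻ v x∈)
    ... | no x∉ = inj₂ λ i eq → let j , j<l , vi≡vj = reduce v per-v i in
      x∉ (subst (_∈ applyUpTo v l) (sym (trans eq vi≡vj)) (∈-applyUpTo⁺ v j<l))

    onY? : ∀ y → (∃ λ i → i < l × y ≡ e i) ⊎ OutY y
    onY? y with _∈?_ Fin._≟_ y (applyUpTo e l)
    ... | yes y∈ = inj₁ (∈-applyUpTo⁻ e y∈)
    ... | no y∉ = inj₂ λ i eq → let j , j<l , ei≡ej = reduce e per-e i in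
      y∉ (subst (_∈ applyUpTo e l) (sym (trans eq ei≡ej)) (∈-applyUpTo⁺ e j<l))

    outsideX : ∀ {x} → OutX x → Outside (inj₁ x)
    outsideX out s eq with parity s
    ... | even i = out i (Sum.inj₁-injective (trans eq (c-even i)))
    ... | odd i  with () ← trans eq (c-odd i)

    outsideY : ∀ {y} → OutY y → Outside (inj₂ y)
    outsideY out s eq with parity s
    ... | even i with () ← trans eq (c-even i)
    ... | odd i  = out i (Sum.inj₂-injective (trans eq (c-odd i)))

    outX⁻ : ∀ {x} → Outside (inj₁ x) → OutX x
    outX⁻ out i eq = out (double i) (trans (cong inj₁ eq) (sym (c-even i)))

    outY⁻ : ∀ {y} → Outside (inj₂ y) → OutY y
    outY⁻ out i eq = out (suc (double i)) (trans (cong inj₂ eq) (sym (c-odd i)))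

    Y~v : ∀ {f} i → S f i ≡ true → inj₂ f ~ c (double i)
    Y~v {f} i h = subst (inj₂ f ~_) (sym (c-even i)) h

    X~e : ∀ {x} i → T x i ≡ true → inj₁ x ~ c (suc (double i))
    X~e {x} i h = subst (inj₁ x ~_) (sym (c-odd i)) h

    onePath : ∀ {u} → Outside u → OuterPath u (u ∷ []) u
    onePath {u} out = outer (single u) ([] ∷ []) λ { (here refl) → out }

    consPath : ∀ {u a P b} → Outside u → u ~ a → ¬ u ∈ P → OuterPath a P b → OuterPath u (u ∷ P) b
    consPath {P = P} out u~a u∉P (outer W U O) = outer (u~a ∷ W) (All.tabulate (λ { p refl → u∉P p }) ∷ U)
      λ { (here refl) → out ; (there p) → O p }

    YX-path : ∀ {f x} → OutY f → OutX x → x ∈ᴱ f → OuterPath (inj₂ f) (inj₂ f ∷ inj₁ x ∷ []) (inj₁ x)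
    YX-path out-f out-x x∈f =
      consPath (outsideY out-f) x∈f (λ { (here ()) ; (there ()) }) (onePath (outsideX out-x))

    XYX-path : ∀ {x f z} → OutX x → OutY f → OutX z → x ∈ᴱ f → z ∈ᴱ f → x ≢ z →
      OuterPath (inj₁ x) (inj₁ x ∷ inj₂ f ∷ inj₁ z ∷ []) (inj₁ z)
    XYX-path out-x out-f out-z x∈f z∈f x≢z =
      consPath (outsideX out-x) x∈f (λ { (here ()) ; (there (here refl)) → x≢z refl ; (there (there ())) })
        (YX-path out-f out-z z∈f)

    YXY-path : ∀ {f x g} → OutY f → OutX x → OutY g → x ∈ᴱ f → x ∈ᴱ g → f ≢ g →
      OuterPath (inj₂ f) (inj₂ f ∷ inj₁ x ∷ inj₂ g ∷ []) (inj₂ g)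
    YXY-path out-f out-x out-g x∈f x∈g f≢g =
      consPath (outsideY out-f) x∈f (λ { (here ()) ; (there (here refl)) → f≢g refl ; (there (there ())) })
        (consPath (outsideX out-x) x∈g (λ { (here ()) ; (there ()) }) (onePath (outsideY out-g)))

    YXYX-path : ∀ {g x f z} → OutY g → OutX x → OutY f → OutX z → x ∈ᴱ g → x ∈ᴱ f → z ∈ᴱ f → g ≢ f → x ≢ z →
      OuterPath (inj₂ g) (inj₂ g ∷ inj₁ x ∷ inj₂ f ∷ inj₁ z ∷ []) (inj₁ z)
    YXYX-path out-g out-x out-f out-z x∈g x∈f z∈f g≢f x≢z =
      consPath (outsideY out-g) x∈g
        (λ { (here ()) ; (there (here refl)) → g≢f refl ; (there (there (here ()))) ; (there (there (there ()))) })
        (XYX-path out-x out-f out-z x∈f z∈f x≢z)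

    e-distinct : ∀ i → e i ≢ e (suc i)
    e-distinct i = inj-e i 1 (s≤s z≤n) 2≤l

    pred-index : ∀ i → ∃ λ j → e (suc j) ≡ e i × v (suc j) ≡ v i × v (suc (suc j)) ≡ v (suc i)
    pred-index i = l ∸ 1 + i , trans (cong e lem) (per-e i) , trans (cong v lem) (per-v i) ,
                   trans (cong v (trans (cong suc lem) (sym (+-suc l i)))) (per-v (suc i))
      where
      lem : suc (l ∸ 1 + i) ≡ l + i
      lem = cong (_+ i) (m+[n∸m]≡n 0<l)

    YXYXY-path : ∀ {f y g x h} → OutY f → OutX y → OutY g → OutX x → OutY h →
      y ∈ᴱ f → y ∈ᴱ g → x ∈ᴱ g → x ∈ᴱ h → f ≢ g → f ≢ h → g ≢ h → y ≢ x →
      OuterPath (inj₂ f) (inj₂ f ∷ inj₁ y ∷ inj₂ g ∷ inj₁ x ∷ inj₂ h ∷ []) (inj₂ h)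
    YXYXY-path out-f out-y out-g out-x out-h y∈f y∈g x∈g x∈h f≢g f≢h g≢h y≢x =
      consPath (outsideY out-f) y∈f
        (λ { (here ()) ; (there (here refl)) → f≢g refl ; (there (there (here ())))
           ; (there (there (there (here refl)))) → f≢h refl ; (there (there (there (there ())))) })
        (consPath (outsideX out-y) y∈g
          (λ { (here ()) ; (there (here refl)) → y≢x refl ; (there (there (here ()))) ; (there (there (there ()))) })
          (YXY-path out-g out-x out-h x∈g x∈h g≢h))

    size-cover : ∀ f (g : Fin n → Bool) L → (∀ x → OutX x → x ∈ᴱ f → g x ≡ true ⊎ x ∈ L) →
      r ≤ cnt (S f) + (count g + length L)
    size-cover f g L h = begin
      r                                              ≡⟨ sym (size f) ⟩
      count (λ x → inc x f)                          ≤⟨ count-cover _ g (select l v (S f) ++ L) cov ⟩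
      count g + length (select l v (S f) ++ L)       ≡⟨ cong (count g +_) (length-++ (select l v (S f))) ⟩
      count g + (length (select l v (S f)) + length L) ≡⟨ cong (λ t → count g + (t + length L)) (length-select l v (S f)) ⟩
      count g + (cnt (S f) + length L)               ≡⟨ swap (count g) (cnt (S f)) (length L) ⟩
      cnt (S f) + (count g + length L)               ∎
      where
      open ≤-Reasoning
      swap : ∀ x y z → x + (y + z) ≡ y + (x + z)
      swap = solve-∀
      cov : ∀ x → x ∈ᴱ f → g x ≡ true ⊎ x ∈ select l v (S f) ++ L
      cov x x∈f with onX? x
      ... | inj₁ (i , i<l , refl) = inj₂ (∈-++⁺ˡ (∈-select l v (S f) i i<l x∈f))
      ... | inj₂ out with h x out x∈f
      ...   | inj₁ gx  = inj₁ gx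
      ...   | inj₂ x∈L = inj₂ (∈-++⁺ʳ (select l v (S f)) x∈L)

    deg-cover : ∀ x L → (∀ y → OutY y → x ∈ᴱ y → y ∈ L) → d ≤ cnt (T x) + length L
    deg-cover x L h = begin
      d                                              ≤⟨ deg x ⟩
      count (inc x)                                  ≤⟨ count-cover _ (λ _ → false) (select l e (T x) ++ L) cov ⟩
      count {m} (λ _ → false) + length (select l e (T x) ++ L) ≡⟨ cong₂ _+_ (count-empty {m} λ _ ()) (length-++ (select l e (T x))) ⟩
      length (select l e (T x)) + length L           ≡⟨ cong (_+ length L) (length-select l e (T x)) ⟩
      cnt (T x) + length L                           ∎
      where
      open ≤-Reasoning
      cov : ∀ y → x ∈ᴱ y → false ≡ true ⊎ y ∈ select l e (T x) ++ L
      cov y x∈y with onY? y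
      ... | inj₁ (i , i<l , refl) = inj₂ (∈-++⁺ˡ (∈-select l e (T x) i i<l x∈y))
      ... | inj₂ out = inj₂ (∈-++⁺ʳ (select l e (T x)) (h y out x∈y))

-- Every outer edge meets the cycle at least twice

abstract
  star-lin₁ : ∀ (l : ℕ) → 8 ≤ l + l → l ≤ 2 → ⊥
  star-lin₁ l h₁ h₂ = infeasible (l ∷ [])
    (con 8 ⊕ (var 0 ⊕ var 0))
    ((var 0 ⊕ var 0) ⊕ (con 2 ⊕ con 2))
    (con 3) refl (+-mono-≤ h₁ (+-mono-≤ h₂ h₂))

  star-lin₂ : ∀ (r c n : ℕ) → r + c + 2 ≤ n → r ≡ 1 + c → n ≤ r + r → ⊥
  star-lin₂ r c n h₁ h₂ h₃ = infeasible (r ∷ c ∷ n ∷ [])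
    ((var 0 ⊕ var 1 ⊕ con 2) ⊕ (var 0 ⊕ var 2))
    (var 2 ⊕ ((con 1 ⊕ var 1) ⊕ (var 0 ⊕ var 0)))
    (con 0) refl (+-mono-≤ h₁ (+-mono-≤ (≤-reflexive h₂) h₃))

module Reinsertion {n m r d l : ℕ} (D : Design n m r d) (K : Edges.LongestCycle D l) where
  open Edges D
  open Longest K

  -- Otherwise the three nodes `z`, `f`, `z'` could replace the single node `v (suc i)` between
  -- `e i` and `e (suc i)`.
  same-vertex : ∀ {f} → OutY f → ∀ i {z z'} → OutX z → OutX z' → z ∈ᴱ f → z' ∈ᴱ f →
    T z i ≡ true → T z' (suc i) ≡ true → z ≡ z'
  same-vertex out-f i {z} {z'} out-z out-z' z∈f z'∈f Tz Tz' with z Fin.≟ z'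
  ... | yes eq = eq
  ... | no z≢z' with arc-bound (XYX-path out-z out-f out-z' z∈f z'∈f z≢z') (suc (double i)) 2
                       (X~e i Tz) (X~e (suc i) Tz') (s≤s z≤n)
  ...   | s≤s (s≤s ())

  -- The pair `f`, `z` would fit between the adjacent nodes `v i` and `e i` without losing any node.
  no-insert : ∀ {f z} → OutY f → OutX z → z ∈ᴱ f → ∀ i → S f i ≡ true → T z i ≡ true → ⊥
  no-insert out-f out-z z∈f i Sf Tz
    with arc-bound (YX-path out-f out-z z∈f) (double i) 1 (Y~v i Sf) (X~e i Tz) (s≤s z≤n)
  ... | s≤s ()

  no-insert′ : ∀ {f z} → OutY f → OutX z → z ∈ᴱ f → ∀ i → S f (suc i) ≡ true → T z i ≡ true → ⊥
  no-insert′ out-f out-z z∈f i Sf Tz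
    with arc-bound (reversePath (YX-path out-f out-z z∈f)) (suc (double i)) 1 (X~e i Tz) (Y~v (suc i) Sf) (s≤s z≤n)
  ... | s≤s ()

  -- When `l ≤ 2` the edges `e i` and `e (suc (suc i))` may coincide, and an explicit longer cycle
  -- is needed in place of a rerouting.
  four-cycle : ∀ {y₁ y₂ y₃ y₄ x₁ x₂ x₃ x₄} →
    x₁ ∈ᴱ y₁ → x₁ ∈ᴱ y₂ → x₂ ∈ᴱ y₂ → x₂ ∈ᴱ y₃ → x₃ ∈ᴱ y₃ → x₃ ∈ᴱ y₄ → x₄ ∈ᴱ y₄ → x₄ ∈ᴱ y₁ →
    Unique (y₁ ∷ y₂ ∷ y₃ ∷ y₄ ∷ []) → Unique (x₁ ∷ x₂ ∷ x₃ ∷ x₄ ∷ []) → 8 ≤ double l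
  four-cycle {y₁} {y₂} {y₃} {y₄} {x₁} {x₂} {x₃} {x₄} h₁ h₂ h₃ h₄ h₅ h₆ h₇ h₈
      ((y₁₂ ∷ y₁₃ ∷ y₁₄ ∷ []) ∷ (y₂₃ ∷ y₂₄ ∷ []) ∷ (y₃₄ ∷ []) ∷ [] ∷ [])
      ((x₁₂ ∷ x₁₃ ∷ x₁₄ ∷ []) ∷ (x₂₃ ∷ x₂₄ ∷ []) ∷ (x₃₄ ∷ []) ∷ [] ∷ []) =
    max {D = inj₂ y₁ ∷ inj₁ x₁ ∷ inj₂ y₂ ∷ inj₁ x₂ ∷ inj₂ y₃ ∷ inj₁ x₃ ∷ inj₂ y₄ ∷ inj₁ x₄ ∷ []}
      (h₁ ∷ h₂ ∷ h₃ ∷ h₄ ∷ h₅ ∷ h₆ ∷ h₇ ∷ single (inj₁ x₄)) h₈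
      (((λ ()) ∷ Y y₁₂ ∷ (λ ()) ∷ Y y₁₃ ∷ (λ ()) ∷ Y y₁₄ ∷ (λ ()) ∷ []) ∷
       ((λ ()) ∷ X x₁₂ ∷ (λ ()) ∷ X x₁₃ ∷ (λ ()) ∷ X x₁₄ ∷ []) ∷
       ((λ ()) ∷ Y y₂₃ ∷ (λ ()) ∷ Y y₂₄ ∷ (λ ()) ∷ []) ∷
       ((λ ()) ∷ X x₂₃ ∷ (λ ()) ∷ X x₂₄ ∷ []) ∷
       ((λ ()) ∷ Y y₃₄ ∷ (λ ()) ∷ []) ∷
       ((λ ()) ∷ X x₃₄ ∷ []) ∷ ((λ ()) ∷ []) ∷ [] ∷ [])
    where
    X : ∀ {x x' : Fin n} → x ≢ x' → inj₁ {B = Fin m} x ≢ inj₁ x'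
    X x≢x' refl = x≢x' refl
    Y : ∀ {y y' : Fin m} → y ≢ y' → inj₂ {A = Fin n} y ≢ inj₂ y'
    Y y≢y' refl = y≢y' refl

-- Outer edges that miss the cycle

module Detached {n m r d l : ℕ} (D : Design n m r d) (K : Edges.LongestCycle D l) where
  open Edges D
  open Longest K
  open Reinsertion D K

  module _ {f : Fin m} (out-f : OutY f) (noS : ∀ i → ¬ S f i ≡ true) where

    outX : ∀ {x} → x ∈ᴱ f → OutX x
    outX x∈f i refl = noS i x∈f

    hit? : ∀ i → (∃ λ w → w ∈ᴱ f × T w i ≡ true) ⊎ (∀ w → w ∈ᴱ f → T w i ≡ true → ⊥)
    hit? i with find (λ w → inc w f ∧ T w i)
    ... | inj₁ (w , h) = inj₁ (w , ∧-elim h)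
    ... | inj₂ none = inj₂ λ w w∈f Tw → none w (∧-intro w∈f Tw)

    -- By `same-vertex`, two vertices of `f` in `e (suc i)` make `f` miss both neighbouring edges.
    -- These equal the complement of `f`, so `l ≤ 2`, and a Berge cycle of length four is found.
    hit-twice′ : ∀ i {y y'} → y ∈ᴱ f → y' ∈ᴱ f → y ≢ y' → T y (suc i) ≡ true → T y' (suc i) ≡ true → ⊥
    hit-twice′ i {y} {y'} y∈f y'∈f y≢y' Ty Ty' with difference (out-f (suc i))
    ... | u , u∈f , u∉eⱼ with another 2≤d u f
    ...   | g , g≢f , u∈g with find (λ b → inc b g ∧ inc b (e (suc (suc i))))
    ...     | inj₁ (b , h) = finish (v (suc (suc i)) Fin.≟ b)
      where
      eⱼ R : Fin m
      eⱼ = e (suc i)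
      R = e (suc (suc i))
      f#R : ∀ w → w ∈ᴱ f → w ∈ᴱ R → ⊥
      f#R w w∈f w∈R = y≢y' (trans (same-vertex out-f (suc i) (outX y∈f) (outX w∈f) y∈f w∈f Ty w∈R)
                             (sym (same-vertex out-f (suc i) (outX y'∈f) (outX w∈f) y'∈f w∈f Ty' w∈R)))
      f#eᵢ : ∀ w → w ∈ᴱ f → w ∈ᴱ e i → ⊥
      f#eᵢ w w∈f w∈e = y≢y' (trans (sym (same-vertex out-f i (outX w∈f) (outX y∈f) w∈f y∈f w∈e Ty))
                              (same-vertex out-f i (outX w∈f) (outX y'∈f) w∈f y'∈f w∈e Ty'))
      eᵢ≡R : e i ≡ R
      eᵢ≡R = disjoint-unique f#eᵢ f#R
      l≤2 : l ≤ 2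
      l≤2 = ≮⇒≥ λ 2<l → inj-e i 2 (s≤s z≤n) 2<l eᵢ≡R
      g≢R : g ≢ R
      g≢R refl = f#R u u∈f u∈g
      g≢eⱼ : g ≢ eⱼ
      g≢eⱼ refl = u∉eⱼ u∈g
      b∈R : b ∈ᴱ R
      b∈R = proj₂ (∧-elim h)
      close : ∀ {a} → a ≢ b → a ∈ᴱ eⱼ → a ∈ᴱ R → ⊥
      close a≢b a∈eⱼ a∈R = star-lin₁ l (subst (8 ≤_) (double≡ l)
        (four-cycle a∈eⱼ a∈R b∈R (proj₁ (∧-elim h)) u∈g u∈f y∈f Ty
          ((e-distinct (suc i) ∷ (g≢eⱼ ∘ sym) ∷ (out-f (suc i) ∘ sym) ∷ []) ∷
           ((g≢R ∘ sym) ∷ (out-f (suc (suc i)) ∘ sym) ∷ []) ∷ (g≢f ∷ []) ∷ [] ∷ [])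
          ((a≢b ∷ (λ { refl → f#R _ u∈f a∈R }) ∷ (λ { refl → f#R _ y∈f a∈R }) ∷ []) ∷
           ((λ { refl → f#R _ u∈f b∈R }) ∷ (λ { refl → f#R _ y∈f b∈R }) ∷ []) ∷
           ((λ { refl → u∉eⱼ Ty }) ∷ []) ∷ [] ∷ []))) l≤2
      finish : Dec (v (suc (suc i)) ≡ b) → ⊥
      -- The first two edges of the four-cycle must share a vertex other than `b`. Since `e i`
      -- equals `R`, they share both `v (suc (suc i))` and `v (suc i)`.
      finish (no ≢b)    = close ≢b (next∈ (suc i)) (here∈ (suc (suc i)))
      finish (yes refl) = close (inj-v (suc i) 1 (s≤s z≤n) 2≤l) (here∈ (suc i)) (subst (v (suc i) ∈ᴱ_) eᵢ≡R (next∈ i))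
    -- Here `f` and `g` would both be the complement of the edge after `e (suc i)`.
    ...     | inj₂ none = contradiction
      (disjoint-unique {e (suc (suc i))} (λ w w∈R w∈g → none w (∧-intro w∈g w∈R)) f#R) g≢f
      where
      f#R : ∀ w → w ∈ᴱ e (suc (suc i)) → w ∈ᴱ f → ⊥
      f#R w w∈R w∈f = y≢y' (trans (same-vertex out-f (suc i) (outX y∈f) (outX w∈f) y∈f w∈f Ty w∈R)
                             (sym (same-vertex out-f (suc i) (outX y'∈f) (outX w∈f) y'∈f w∈f Ty' w∈R)))

    hit-once : ∀ i {y y'} → y ∈ᴱ f → y' ∈ᴱ f → T y i ≡ true → T y' i ≡ true → y ≡ y'
    hit-once i {y} {y'} y∈f y'∈f Ty Ty' with y Fin.≟ y'
    ... | yes eq = eq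
    ... | no y≢y' with pred-index i
    ...   | j , eq , _ = ⊥-elim (hit-twice′ j y∈f y'∈f y≢y'
                            (subst (y ∈ᴱ_) (sym eq) Ty) (subst (y' ∈ᴱ_) (sym eq) Ty'))

    -- `T x` is not everywhere true, because `e b` already contains `x'`. Where `T x` ends,
    -- `same-vertex` allows only `x` in the next edge, and `x` is not there.
    miss-after : ∀ {x x'} → x ∈ᴱ f → x' ∈ᴱ f → x ≢ x' → ∀ a b → T x a ≡ true → T x' b ≡ true →
      ∃ λ i → T x i ≡ true × (∀ w → w ∈ᴱ f → T w (suc i) ≡ true → ⊥)
    miss-after {x} {x'} x∈f x'∈f x≢x' a b Tx Tx'
      with fall (per-T x) a b Tx (¬true⇒false λ h → x≢x' (hit-once b x∈f x'∈f h Tx'))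
    ... | i , Txi , ¬Txsi = i , Txi , λ w w∈f Tw →
      true≢false (subst (λ z → T z (suc i) ≡ true) (sym (same-vertex out-f i (outX x∈f) (outX w∈f) x∈f w∈f Txi Tw)) Tw) ¬Txsi

    -- By `miss-after`, `x` and `x'` each lie in an edge whose successor misses `f`. Both successors
    -- are the complement of `f`, so the two edges coincide and meet `f` twice.
    single-hit : ∀ {x x'} → x ∈ᴱ f → x' ∈ᴱ f → x ≢ x' → ∀ a b → T x a ≡ true → T x' b ≡ true → ⊥
    single-hit {x} {x'} x∈f x'∈f x≢x' a b Tx Tx'
      with miss-after x∈f x'∈f x≢x' a b Tx Tx' | miss-after x'∈f x∈f (x≢x' ∘ sym) b a Tx' Tx
    ... | i , Ti , miss | i' , Ti' , miss' = x≢x' (hit-once i x∈f x'∈f Ti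
      (subst (x' ∈ᴱ_) (sym (e-suc-inj i i' (disjoint-unique miss miss'))) Ti'))

    unused : ∃ λ x → x ∈ᴱ f × (∀ i → ¬ T x i ≡ true)
    unused with count-witness₂ (λ x → inc x f) (subst (2 ≤_) (sym (size f)) (≤-trans (s≤s (s≤s z≤n)) 3≤r))
    ... | x , x' , x≢x' , x∈f , x'∈f with some? (per-T x) | some? (per-T x')
    ...   | inj₂ none    | _               = x , x∈f , none
    ...   | inj₁ _       | inj₂ none       = x' , x'∈f , none
    ...   | inj₁ (a , h) | inj₁ (b , h')   = ⊥-elim (single-hit x∈f x'∈f x≢x' a b h h')

    -- A second edge `g` through a vertex `x` of `f` in no cycle edge is itself outer. Hence a
    -- vertex `u` of `g` outside `f` is joined, through `g`, `x` and `f`, to every vertex of `f`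
    -- that lies in a cycle edge, and this decides how `f` can meet two consecutive cycle edges.
    impossible : ⊥
    impossible with unused
    ... | x , x∈f , noT with another 2≤d x f
    ...   | g , g≢f , x∈g with difference g≢f
    ...     | u , u∈g , u∉f with onX? u
    ...       | inj₁ (b , _ , refl) with pred-index b
    ...         | j , _ , vj , _ = either (hit? j) (hit? (suc j))
      where
      out-g : OutY g
      out-g i refl = noT i x∈g
      Sg : S g (suc j) ≡ true
      Sg = subst (_∈ᴱ g) (sym vj) u∈g
      path : ∀ {y} i → y ∈ᴱ f → T y i ≡ true → OuterPath (inj₂ g) (inj₂ g ∷ inj₁ x ∷ inj₂ f ∷ inj₁ y ∷ []) (inj₁ y)
      path i y∈f Ty = YXYX-path out-g (outX x∈f) out-f (outX y∈f) x∈g x∈f y∈f g≢f (λ { refl → noT i Ty })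
      either : (∃ λ w → w ∈ᴱ f × T w j ≡ true) ⊎ (∀ w → w ∈ᴱ f → T w j ≡ true → ⊥) →
               (∃ λ w → w ∈ᴱ f × T w (suc j) ≡ true) ⊎ (∀ w → w ∈ᴱ f → T w (suc j) ≡ true → ⊥) → ⊥
      either (inj₁ (y , y∈f , Ty)) _
        with arc-bound (reversePath (path j y∈f Ty)) (suc (double j)) 1 (X~e j Ty) (Y~v (suc j) Sg) (s≤s z≤n)
      ... | s≤s ()
      either (inj₂ _) (inj₁ (y , y∈f , Ty))
        with arc-bound (path (suc j) y∈f Ty) (double (suc j)) 1 (Y~v (suc j) Sg) (X~e (suc j) Ty) (s≤s z≤n)
      ... | s≤s ()
      -- With `u` on C, `f` can meet neither of the two edges next to `u`; both would be the
      -- complement of `f`.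
      either (inj₂ none) (inj₂ none') = e-distinct j (disjoint-unique none none')
    impossible | x , x∈f , noT | g , g≢f , x∈g | u , u∈g , u∉f | inj₂ out-u = either (hit? 0) (hit? 1) (u ∈ᴱ? e 0) (u ∈ᴱ? e 1)
      where
      out-g : OutY g
      out-g i refl = noT i x∈g
      path : ∀ {y} i → y ∈ᴱ f → T y i ≡ true →
        OuterPath (inj₁ u) (inj₁ u ∷ inj₂ g ∷ inj₁ x ∷ inj₂ f ∷ inj₁ y ∷ []) (inj₁ y)
      path i y∈f Ty = consPath (outsideX out-u) u∈g
        (λ { (here ()) ; (there (here refl)) → u∉f x∈f ; (there (there (here ())))
           ; (there (there (there (here refl)))) → u∉f y∈f ; (there (there (there (there ())))) })
        (YXYX-path out-g (outX x∈f) out-f (outX y∈f) x∈g x∈f y∈f g≢f (λ { refl → noT i Ty }))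
      forward : ∀ {y} → u ∈ᴱ e 0 → y ∈ᴱ f → T y 1 ≡ true → ⊥
      forward u∈e y∈f Ty with arc-bound (path 1 y∈f Ty) 1 2 u∈e Ty (s≤s z≤n)
      ... | s≤s (s≤s ())
      backward : ∀ {y} → u ∈ᴱ e 1 → y ∈ᴱ f → T y 0 ≡ true → ⊥
      backward u∈e y∈f Ty with arc-bound (reversePath (path 0 y∈f Ty)) 1 2 Ty u∈e (s≤s z≤n)
      ... | s≤s (s≤s ())
      either : (∃ λ w → w ∈ᴱ f × T w 0 ≡ true) ⊎ (∀ w → w ∈ᴱ f → T w 0 ≡ true → ⊥) →
               (∃ λ w → w ∈ᴱ f × T w 1 ≡ true) ⊎ (∀ w → w ∈ᴱ f → T w 1 ≡ true → ⊥) →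
               Dec (u ∈ᴱ e 0) → Dec (u ∈ᴱ e 1) → ⊥
      either (inj₂ none) (inj₂ none') _ _ = e-distinct 0 (disjoint-unique none none')
      either _ (inj₁ (y , y∈f , Ty)) (yes u∈) _ = forward u∈ y∈f Ty
      either (inj₁ (y , y∈f , Ty)) _ _ (yes u∈) = backward u∈ y∈f Ty
      either (inj₂ none) _ (no u∉) _ = covered none u u∉f u∉
      either _ (inj₂ none) _ (no u∉) = covered none u u∉f u∉
      -- Now `f` meets `e 0` and `e 1` in the same single vertex, and `u` lies in neither edge. A
      -- vertex `w` of `e 0` outside `e 1` would make `e 1`, the rest of `f`, and `u`, `w` disjoint,
      -- which takes `2 r + 1` vertices.
      either (inj₁ (y₀ , y₀∈f , Ty₀)) (inj₁ (y₁ , y₁∈f , Ty₁)) (no u∉e₀) (no u∉e₁) =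
        e-distinct 0 (⊆⇒≡ λ w w∈e₀ → sub w w∈e₀ (w ∈ᴱ? e 1))
        where
        y₀≡y₁ : y₀ ≡ y₁
        y₀≡y₁ = same-vertex out-f 0 (outX y₀∈f) (outX y₁∈f) y₀∈f y₁∈f Ty₀ Ty₁
        sub : ∀ w → w ∈ᴱ e 0 → Dec (w ∈ᴱ e 1) → w ∈ᴱ e 1
        sub w w∈e₀ (yes p) = p
        sub w w∈e₀ (no w∉e₁) = ⊥-elim (star-lin₂ r (count (remove y₁ (λ x → inc x f))) n
          (disjoint-bound (e 1) (remove y₁ (λ x → inc x f)) {w ∷ u ∷ []}
            (((λ { refl → u∉e₀ w∈e₀ }) ∷ []) ∷ [] ∷ [])
            (λ z z∈e₁ h → let z≢ , z∈f = remove-elim y₁ (λ x → inc x f) z h in z≢ (hit-once 1 z∈f y₁∈f z∈e₁ Ty₁))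
            (λ { (here refl) → w∉e₁ ; (there (here refl)) → u∉e₁ })
            (λ { (here refl) h → w∉f (proj₂ (remove-elim y₁ (λ x → inc x f) w h)) ; (there (here refl)) h → u∉f (proj₂ (remove-elim y₁ (λ x → inc x f) u h)) }))
          (trans (sym (size f)) (trans (count-remove y₁ _) (cong (λ b → bit b + count (remove y₁ (λ x → inc x f))) y₁∈f))) n≤2r)
          where
          w∉f : w ∉ᴱ f
          w∉f w∈f = w∉e₁ (subst (_∈ᴱ e 1) (sym (trans (hit-once 0 w∈f y₀∈f w∈e₀ Ty₀) y₀≡y₁)) Ty₁)

-- Outer edges with a single vertex on the cycle

abstract
  tan-lin₁ : ∀ (l p : ℕ) → 1 + p ≡ l → 2 ≤ l → 0 < p
  tan-lin₁ l p h₁ h₂ = ≮⇒≥ λ neg → infeasible (l ∷ p ∷ [])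
    (var 0 ⊕ (con 2 ⊕ (con 1 ⊕ var 1)))
    ((con 1 ⊕ var 1) ⊕ (var 0 ⊕ (con 1 ⊕ con 0)))
    (con 0) refl (+-mono-≤ (≤-reflexive (sym h₁)) (+-mono-≤ h₂ neg))

  tan-lin₂ : ∀ (r c n : ℕ) → r + c + 1 ≤ n → n ≤ c + 3 → 3 ≤ r → ⊥
  tan-lin₂ r c n h₁ h₂ h₃ = infeasible (r ∷ c ∷ n ∷ [])
    ((var 0 ⊕ var 1 ⊕ con 1) ⊕ (var 2 ⊕ con 3))
    (var 2 ⊕ ((var 1 ⊕ con 3) ⊕ var 0))
    (con 0) refl (+-mono-≤ h₁ (+-mono-≤ h₂ h₃))

  tan-lin₃ : ∀ (l d : ℕ) → 4 ≤ l → l < d + d → 3 ≤ d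
  tan-lin₃ l d h₁ h₂ = ≮⇒≥ λ neg → infeasible (l ∷ d ∷ [])
    (con 4 ⊕ ((con 1 ⊕ var 0) ⊕ ((con 1 ⊕ var 1) ⊕ (con 1 ⊕ var 1))))
    (var 0 ⊕ ((var 1 ⊕ var 1) ⊕ (con 3 ⊕ con 3)))
    (con 0) refl (+-mono-≤ h₁ (+-mono-≤ h₂ (+-mono-≤ neg neg)))

double-mono : ∀ {i j} → i ≤ j → double i ≤ double j
double-mono z≤n     = z≤n
double-mono (s≤s h) = s≤s (s≤s (double-mono h))

module Tangent {n m r d l : ℕ} (D : Design n m r d) (K : Edges.LongestCycle D l) where
  open Edges D
  open Longest K
  open Reinsertion D K

  module _ {f : Fin m} (out-f : OutY f) (S0 : S f 0 ≡ true) (uniqS : ∀ i → S f i ≡ true → v i ≡ v 0) where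

    p : ℕ
    p = l ∸ 1

    suc-p : suc p ≡ l
    suc-p = m+[n∸m]≡n 0<l

    0<p : 0 < p
    0<p = tan-lin₁ l p suc-p 2≤l

    p<l : p < l
    p<l = ≤-reflexive suc-p

    N≡ : N ≡ 2 + double p
    N≡ = cong double (sym suc-p)

    Sp : S f (suc p) ≡ true
    Sp = subst (_∈ᴱ f) (sym (trans (cong v (trans suc-p (sym (+-identityʳ l)))) (per-v 0))) S0

    Z : Fin n → Bool
    Z = remove (v 0) (λ x → inc x f)

    Z⇒∈ : ∀ {x} → Z x ≡ true → x ∈ᴱ f
    Z⇒∈ {x} h = proj₂ (remove-elim (v 0) (λ x → inc x f) x h)

    Z⇒≢ : ∀ {x} → Z x ≡ true → x ≢ v 0
    Z⇒≢ {x} h = proj₁ (remove-elim (v 0) (λ x → inc x f) x h)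

    Z⇒out : ∀ {x} → Z x ≡ true → OutX x
    Z⇒out h i refl = Z⇒≢ h (uniqS i (Z⇒∈ h))

    v∉Z : ∀ i → ¬ Z (v i) ≡ true
    v∉Z i h = Z⇒≢ h (uniqS i (Z⇒∈ h))

    count-Z : r ≡ 1 + count Z
    count-Z = trans (sym (size f)) (trans (count-remove (v 0) (λ x → inc x f)) (cong (λ b → bit b + count Z) S0))

    miss₀ : ∀ x → Z x ≡ true → T x 0 ≡ true → ⊥
    miss₀ x h = no-insert out-f (Z⇒out h) (Z⇒∈ h) 0 S0

    missₚ : ∀ x → Z x ≡ true → T x p ≡ true → ⊥
    missₚ x h = no-insert′ out-f (Z⇒out h) (Z⇒∈ h) p Sp

    -- `e j` and `Z` are disjoint and together have `2 r - 1` elements, so at most one vertex is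
    -- left over.
    miss-one : ∀ j → (∀ x → Z x ≡ true → T x j ≡ true → ⊥) → ∀ {α β} → ¬ Z α ≡ true → ¬ Z β ≡ true →
      α ∉ᴱ e j → β ∉ᴱ e j → α ≡ β
    miss-one j miss {α} {β} ¬Zα ¬Zβ α∉ β∉ with α Fin.≟ β
    ... | yes eq = eq
    ... | no α≢β = ⊥-elim (star-lin₂ r (count Z) n
      (disjoint-bound (e j) Z {α ∷ β ∷ []} ((α≢β ∷ []) ∷ [] ∷ []) (λ x x∈ Zx → miss x Zx x∈)
        (λ { (here refl) → α∉ ; (there (here refl)) → β∉ })
        (λ { (here refl) → ¬Zα ; (there (here refl)) → ¬Zβ })) count-Z n≤2r)

    e₀≢eₚ : e 0 ≢ e p
    e₀≢eₚ eq = inj-e 0 p 0<p p<l (trans eq (cong e (sym (+-identityʳ p))))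

    -- The vertex left over by `e p` can only be a vertex of `e 0`, since some vertex of `e 0` is
    -- missing from `e p`.
    miss-both : ∀ {α} → ¬ Z α ≡ true → α ∉ᴱ e 0 → α ∉ᴱ e p → ⊥
    miss-both {α} ¬Zα α∉₀ α∉ₚ with difference e₀≢eₚ
    ... | w , w∈₀ , w∉ₚ with miss-one p missₚ ¬Zα (λ Zw → miss₀ w Zw w∈₀) α∉ₚ w∉ₚ
    ...   | refl = α∉₀ w∈₀

    v∈eₚ : ∀ t → v t ∉ᴱ e 0 → v t ∈ᴱ e p
    v∈eₚ t h with v t ∈ᴱ? e p
    ... | yes h' = h'
    ... | no h' = ⊥-elim (miss-both (v∉Z t) h h')

    v∈e₀ : ∀ t → v t ∉ᴱ e p → v t ∈ᴱ e 0
    v∈e₀ t h with v t ∈ᴱ? e 0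
    ... | yes h' = h'
    ... | no h' = ⊥-elim (miss-both (v∉Z t) h' h)

    v-≢ : ∀ {i j} → i < j → j < l → v i ≢ v j
    v-≢ {i} {j} i<j j<l eq = inj-v i (j ∸ i) (m<n⇒0<n∸m i<j) (≤-<-trans (m∸n≤m j i) j<l)
      (trans eq (cong v (sym (m∸n+n≡m (<⇒≤ i<j)))))

    pos-even : ∀ t → c (double t + 0) ≡ inj₁ (v t)
    pos-even t = trans (cong c (+-identityʳ (double t))) (c-even t)

    -- The four reroutings through a path leaving C at v 0; each fails only because of the unique
    -- vertex missed by e 0, respectively e p, and together they pin down where the path returns.
    ear : ∀ {P b} → OuterPath (inj₂ f) P b → ∀ q₀ t t′ → b ~ c (suc q₀) →
      suc q₀ < double t → t ≤ p → double t ≤ length P + suc q₀ →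
      0 < t′ → double t′ < suc q₀ → suc q₀ ≤ length P + double t′ →
      t ≡ p × t′ ≡ 1 × v p ∉ᴱ e 0 × v 1 ∉ᴱ e p
    ear {P} {b} path q₀ t t′ b~′ q<t t≤p t-long 0<t′ t′<q t′-long =
      t≡p , t′≡1 , subst (λ i → v i ∉ᴱ e 0) t≡p vₜ∉e₀ , subst (λ i → v i ∉ᴱ e p) t′≡1 vₜ′∉eₚ
      where
      b~ : b ~ c (suc q₀ + 0)
      b~ = subst (λ s → b ~ c s) (sym (+-identityʳ (suc q₀))) b~′
      t≤N : double t ≤ N
      t≤N = double-mono (≤-trans t≤p (<⇒≤ p<l))
      vₜ∉e₀ : v t ∉ᴱ e 0
      vₜ∉e₀ h = <⇒≱ (crossing path 0 q₀ (double t) (N ∸ double t) S0 b~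
        (subst (inj₂ (e 0) ~_) (sym (pos-even t)) h) q<t (m∸n+n≡m t≤N)) t-long
      exchange-at : t < p → v t ∈ᴱ e p → v p ∈ᴱ e 0 → ⊥
      exchange-at t<p h h′ = <⇒≱ (exchange path 0 q₀ (double t) (double (p ∸ t)) S0 b~
        (subst₂ _~_ (sym (trans (cong (c ∘ suc) last) (c-odd p))) (sym (pos-even t)) h)
        (subst (_~ inj₂ (e 0)) (sym (trans (cong c last) (c-even p))) h′) q<t
        (trans (cong (2 +_) last′) (sym N≡))) t-long
        where
        last′ : double (p ∸ t) + double t ≡ double p
        last′ = trans (sym (double-+ (p ∸ t) t)) (cong double (m∸n+n≡m t≤p))
        last : double (p ∸ t) + (double t + 0) ≡ double p
        last = trans (cong (double (p ∸ t) +_) (+-identityʳ (double t))) last′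
      -- If `t < p`, then `v t` is the one exception of `e 0` and lies in `e p`. So `v p` lies in
      -- `e 0`, and both chords of `exchange` are present.
      t≡p : t ≡ p
      t≡p with m≤n⇒m<n∨m≡n t≤p
      ... | inj₂ eq = eq
      ... | inj₁ t<p with v p ∈ᴱ? e 0
      ...   | yes h = ⊥-elim (exchange-at t<p (v∈eₚ t vₜ∉e₀) h)
      ...   | no h = ⊥-elim (v-≢ t<p p<l (miss-one 0 miss₀ (v∉Z t) (v∉Z p) vₜ∉e₀ h))
      j : ℕ
      j = N ∸ (2 + q₀)
      j+q : (1 + j) + suc q₀ ≡ N
      j+q = trans (sym (+-suc j (suc q₀))) (m∸n+n≡m (≤-trans q<t t≤N))
      last : c (j + (suc q₀ + 0)) ≡ inj₂ (e p)
      last = trans (cong c (trans (cong (j +_) (+-identityʳ (suc q₀))) (suc-injective (trans j+q N≡)))) (c-odd p)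
      vₜ′∉eₚ : v t′ ∉ᴱ e p
      vₜ′∉eₚ h = <⇒≱ (crossing′ path 0 (double t′) (suc q₀) j S0 b~
        (subst₂ _~_ (sym (pos-even t′)) (sym last) h) t′<q j+q) t′-long
      exchange′-at : ∀ k → t′ ≡ 2 + k → v t′ ∈ᴱ e 0 → v 1 ∈ᴱ e p → ⊥
      exchange′-at k refl h h′ = <⇒≱ (exchange′ path 0 (double (suc k)) (suc q₀) j S0 b~
        (subst (inj₂ (e 0) ~_) (sym (trans (cong c (+-comm (double (suc k)) 2)) (c-even (2 + k)))) h)
        (subst (inj₁ (v 1) ~_) (sym last) h′) t′<q j+q) t′-long
      is-one : ∀ s → s ≡ t′ → s ≡ 1
      is-one zero eq = contradiction (subst (0 <_) (sym eq) 0<t′) (<-irrefl refl)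
      is-one (suc zero) eq = refl
      is-one (suc (suc k)) eq with v 1 ∈ᴱ? e p
      ... | yes h = ⊥-elim (exchange′-at k (sym eq) (v∈e₀ t′ vₜ′∉eₚ) h)
      ... | no h = ⊥-elim (v-≢ {1} {t′} (subst (1 <_) eq (s≤s (s≤s z≤n)))
        (≤-trans (double-cancel-< (<-trans t′<q q<t)) (≤-trans t≤p (<⇒≤ p<l)))
        (miss-one p missₚ (v∉Z 1) (v∉Z t′) h vₜ′∉eₚ))
      t′≡1 : t′ ≡ 1
      t′≡1 = is-one t′ refl

    -- Here `l = 3`, and the exceptions of `e 0` and `e 2` are `v 2` and `v 1`. An outer vertex off
    -- `f` would lie in both edges and serve as the detour of `crossing-via`. Thus `n` is at most
    -- `count Z + 3`, while `e p`, `Z` and a vertex of `e 0` outside `e p` are disjoint, which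
    -- leaves `r ≤ 2`.
    three-impossible : ∀ {x} → Z x ≡ true → T x 1 ≡ true → p ≡ 2 → v p ∉ᴱ e 0 → v 1 ∉ᴱ e p → ⊥
    three-impossible {x} Zx Tx p≡2 vₚ∉e₀ v₁∉eₚ with difference e₀≢eₚ
    ... | w , w∈₀ , w∉ₚ = tan-lin₂ r (count Z) n
      (disjoint-bound (e p) Z {w ∷ []} ([] ∷ []) (λ x x∈ Zx → missₚ x Zx x∈)
        (λ { (here refl) → w∉ₚ }) (λ { (here refl) Zw → miss₀ w Zw w∈₀ }))
      (≤-trans (≤-reflexive (sym (count-full {n} {λ _ → true} λ _ → refl)))
        (subst (λ t → count {n} (λ _ → true) ≤ count Z + t) (trans (length-applyUpTo v l) l≡3)
          (count-cover (λ _ → true) Z (applyUpTo v l) (λ u _ → cover u))))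
      3≤r
      where
      l≡3 : l ≡ 3
      l≡3 = trans (sym suc-p) (cong suc p≡2)
      free : ∀ u → ¬ Z u ≡ true → OutX u → ⊥
      free u ¬Zu out-u with u ∈ᴱ? e 0 | u ∈ᴱ? e p
      ... | no h | _ = out-u p (miss-one 0 miss₀ ¬Zu (v∉Z p) h vₚ∉e₀)
      ... | _ | no h = out-u 1 (miss-one p missₚ ¬Zu (v∉Z 1) h v₁∉eₚ)
      ... | yes h | yes h′ = absurd (crossing-via (YX-path out-f (Z⇒out Zx) (Z⇒∈ Zx)) (outsideX out-u)
              (λ { (here ()) ; (there (here refl)) → ¬Zu Zx ; (there (there ())) })
              0 2 5 1 S0 Tx h (subst (λ i → u ∈ᴱ e i) p≡2 h′) (s≤s (s≤s (s≤s (s≤s z≤n)))) (cong double (sym l≡3)))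
        where
        absurd : ¬ 6 < 5
        absurd (s≤s (s≤s (s≤s (s≤s (s≤s ())))))
      cover : ∀ u → Z u ≡ true ⊎ u ∈ applyUpTo v l
      cover u with dec-true (Z u) | onX? u
      ... | inj₁ Zu | _ = inj₁ Zu
      ... | inj₂ _ | inj₁ (i , i<l , refl) = inj₂ (∈-applyUpTo⁺ v i<l)
      ... | inj₂ ¬Zu | inj₂ out = ⊥-elim (free u (λ Zu → true≢false Zu ¬Zu) out)

    -- The edges next to `v 0` are excluded by insertion. For any other edge, `ear` with the path
    -- `f`, `x` and the two cycle vertices of that edge as `t′` and `t` leaves only `l = 3`.
    off-cycle : ∀ {x} → Z x ≡ true → ∀ i → ¬ T x i ≡ true
    off-cycle {x} Zx i Tx with reduce e per-e i
    ... | zero , _ , eq = miss₀ x Zx (subst (x ∈ᴱ_) eq Tx)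
    ... | suc i′ , i<l , eq with suc i′ ≟ p
    ...   | yes i≡p = missₚ x Zx (subst (λ k → x ∈ᴱ e k) i≡p (subst (x ∈ᴱ_) eq Tx))
    ...   | no i≢p = conclude (suc i′) (subst (x ∈ᴱ_) eq Tx)
                  (ear (YX-path out-f (Z⇒out Zx) (Z⇒∈ Zx)) (double (suc i′)) (suc (suc i′)) (suc i′)
                  (X~e (suc i′) (subst (x ∈ᴱ_) eq Tx)) ≤-refl (≤∧≢⇒< (s≤s⁻¹ (subst (suc i′ <_) (sym suc-p) i<l)) i≢p)
                  (n≤1+n _) (s≤s z≤n) ≤-refl (n≤1+n _))
      where
      conclude : ∀ i → T x i ≡ true → suc i ≡ p × i ≡ 1 × v p ∉ᴱ e 0 × v 1 ∉ᴱ e p → ⊥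
      conclude i Tx (2≡p , refl , vₚ∉ , v₁∉) = three-impossible Zx Tx (sym 2≡p) vₚ∉ v₁∉

    module _ {x : Fin n} (Zx : Z x ≡ true) where

      out-edge : ∀ {g} → x ∈ᴱ g → OutY g
      out-edge x∈g i refl = off-cycle Zx i x∈g

      -- An outer `u` lies in `e 0` or `e p`, so the path `f`, `x`, `g`, `u` could be inserted next
      -- to `v 0`. If `u` is `v b`, not adjacent to `v 0`, the path `f`, `x`, `g` returns at `v b`
      -- itself; `ear` with `b + 1` and `b - 1` leaves only `b = 2` and `l = 4`.
      classify : ∀ {g} → g ≢ f → x ∈ᴱ g → ∀ u → u ∈ᴱ g → ¬ Z u ≡ true → u ≢ v 0 → u ≡ v 2 × p ≡ 3
      classify {g} g≢f x∈g u u∈g ¬Zu u≢v₀ with onX? u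
      ... | inj₂ out-u = ⊥-elim (meets (u ∈ᴱ? e 0) (u ∈ᴱ? e p))
        where
        path : OuterPath (inj₂ f) (inj₂ f ∷ inj₁ x ∷ inj₂ g ∷ inj₁ u ∷ []) (inj₁ u)
        path = YXYX-path out-f (Z⇒out Zx) (out-edge x∈g) out-u (Z⇒∈ Zx) x∈g u∈g (g≢f ∘ sym) (λ { refl → ¬Zu Zx })
        meets : Dec (u ∈ᴱ e 0) → Dec (u ∈ᴱ e p) → ⊥
        meets (no h) (no h′) = miss-both ¬Zu h h′
        meets (yes h) _ with arc-bound path 0 1 S0 h (s≤s z≤n)
        ... | s≤s ()
        meets (no _) (yes h) with arc-bound (reversePath path) (suc (double p)) 1 (X~e p h) (Y~v (suc p) Sp) (s≤s z≤n)
        ... | s≤s ()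
      ... | inj₁ (zero , _ , refl) = contradiction refl u≢v₀
      ... | inj₁ (suc b , b<l , refl) = return b b<l u∈g
        where
        path : OuterPath (inj₂ f) (inj₂ f ∷ inj₁ x ∷ inj₂ g ∷ []) (inj₂ g)
        path = YXY-path out-f (Z⇒out Zx) (out-edge x∈g) (Z⇒∈ Zx) x∈g (g≢f ∘ sym)
        absurd : ¬ 3 < 2
        absurd (s≤s (s≤s ()))
        conclude : ∀ b → 3 + b ≡ p × 1 + b ≡ 1 × v p ∉ᴱ e 0 × v 1 ∉ᴱ e p → v (2 + b) ≡ v 2 × p ≡ 3
        conclude zero (3≡p , _) = refl , sym 3≡p
        return : ∀ b → suc b < l → S g (suc b) ≡ true → v (suc b) ≡ v 2 × p ≡ 3
        return zero b<l h = ⊥-elim (absurd (arc-bound path 0 2 S0 h (s≤s z≤n)))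
        return (suc b) b<l h with suc (suc b) ≟ p
        ... | yes eq = ⊥-elim (absurd (arc-bound (reversePath path) (double p) 2
                        (Y~v p (subst (λ i → S g i ≡ true) eq h)) (Y~v (suc p) Sp) (s≤s z≤n)))
        ... | no b≢p = conclude b (ear path (suc (double (suc b))) (3 + b) (1 + b) (Y~v (2 + b) h)
                       (s≤s (n≤1+n _)) (≤∧≢⇒< (s≤s⁻¹ (subst (2 + b <_) (sym suc-p) b<l)) b≢p)
                       (n≤1+n _) (s≤s z≤n) (n≤1+n _) (n≤1+n _))

      special : ∀ {g} → g ≢ f → x ∈ᴱ g → S g 2 ≡ true × p ≡ 3
      special {g} g≢f x∈g with difference g≢f
      ... | u , u∈g , u∉f with classify g≢f x∈g u u∈g (λ Zu → u∉f (Z⇒∈ Zu)) (λ { refl → u∉f S0 })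
      ...   | refl , p≡3 = u∈g , p≡3

      -- A second vertex `y` of `Z` in `g` yields the path `f`, `y`, `g`, `x`, `h` of five nodes,
      -- which beats the three nodes between `v 0` and `v 2`.
      no-detour : ∀ {g h} → g ≢ f → h ≢ f → g ≢ h → x ∈ᴱ g → x ∈ᴱ h → ∀ y → y ∈ᴱ g → Z y ≡ true → y ≡ x
      no-detour g≢f h≢f g≢h x∈g x∈h y y∈g Zy with y Fin.≟ x
      ... | yes eq = eq
      ... | no y≢x with arc-bound
            (YXYXY-path out-f (Z⇒out Zy) (out-edge x∈g) (Z⇒out Zx) (out-edge x∈h)
              (Z⇒∈ Zy) y∈g x∈g x∈h (g≢f ∘ sym) (h≢f ∘ sym) g≢h y≢x)
            0 4 S0 (proj₁ (special h≢f x∈h)) (s≤s z≤n)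
      ...   | s≤s (s≤s (s≤s (s≤s ())))

      -- Both edges have their vertices among `x`, `v 0` and `v 2`, so `r ≥ 3` makes them equal.
      two-impossible : ∀ {g h} → g ≢ f → h ≢ f → g ≢ h → x ∈ᴱ g → x ∈ᴱ h → ⊥
      two-impossible {g} {h} g≢f h≢f g≢h x∈g x∈h = g≢h (⊆⇒≡ λ w w∈g → sub w w∈g (dec-true (Z w)) (w Fin.≟ v 0))
        where
        v₀∈h : v 0 ∈ᴱ h
        v₀∈h with v 0 ∈ᴱ? h
        ... | yes p = p
        ... | no v₀∉h = contradiction
          (≤-trans (≤-reflexive (sym (size h)))
            (subst (count (λ x → inc x h) ≤_) (cong (_+ 2) (count-empty {n} {λ _ → false} λ _ ()))
            (count-cover (λ x → inc x h) (λ _ → false) (x ∷ v 2 ∷ []) cov)))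
          (<⇒≱ 3≤r)
          where
          cov : ∀ w → w ∈ᴱ h → false ≡ true ⊎ w ∈ x ∷ v 2 ∷ []
          cov w w∈h with dec-true (Z w)
          ... | inj₁ Zw = inj₂ (here (no-detour h≢f g≢f (g≢h ∘ sym) x∈h x∈g w w∈h Zw))
          ... | inj₂ ¬Zw = inj₂ (there (here (proj₁ (classify h≢f x∈h w w∈h (λ Zw → true≢false Zw ¬Zw) (λ { refl → v₀∉h w∈h })))))
        sub : ∀ w → w ∈ᴱ g → Z w ≡ true ⊎ Z w ≡ false → Dec (w ≡ v 0) → w ∈ᴱ h
        sub w w∈g (inj₁ Zw) _ = subst (_∈ᴱ h) (sym (no-detour g≢f h≢f g≢h x∈g x∈h w w∈g Zw)) x∈h
        sub w w∈g (inj₂ ¬Zw) (yes refl) = v₀∈h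
        sub w w∈g (inj₂ ¬Zw) (no w≢v₀) = subst (_∈ᴱ h)
          (sym (proj₁ (classify g≢f x∈g w w∈g (λ Zw → true≢false Zw ¬Zw) w≢v₀))) (proj₁ (special h≢f x∈h))

    impossible : ⊥
    impossible with count-witness Z (s≤s⁻¹ (subst (2 ≤_) count-Z (≤-trans (s≤s (s≤s z≤n)) 3≤r)))
    ... | x , Zx = first (another 2≤d x f)
      where
      second : (∃ λ g → ∃ λ h → g ≢ h × (g ≢ f × x ∈ᴱ g) × (h ≢ f × x ∈ᴱ h)) → ⊥
      second (g , h , g≢h , (g≢f , x∈g) , (h≢f , x∈h)) = two-impossible Zx g≢f h≢f g≢h x∈g x∈h
      first : (∃ λ g → g ≢ f × x ∈ᴱ g) → ⊥
      -- `special` gives `l = 4`, and `l < 2 d` then gives `d ≥ 3`, hence two further edges through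
      -- `x`.
      first (g , g≢f , x∈g) = second (another₂ (tan-lin₃ l d
        (≤-reflexive (trans (cong suc (sym (proj₂ (special Zx g≢f x∈g)))) suc-p)) l<2d) x f)

module Attachment {n m r d l : ℕ} (D : Design n m r d) (K : Edges.LongestCycle D l) where
  open Edges D
  open Longest K

  -- A rotation moves the single cycle vertex of an outer edge to position 0, where the previous
  -- argument expects it.
  shifted : ℕ → LongestCycle l
  shifted a = record { C = shift a C ; 2≤l = 2≤l ; max = max ; l<n = l<n ; l<m = l<m ; l<2d = l<2d }

  2≤S : ∀ {f} → OutY f → 2 ≤ cnt (S f)
  2≤S {f} out-f with 2 ≤? cnt (S f) | some? (per-S f)
  ... | yes h | _ = h
  ... | no _  | inj₂ none = ⊥-elim (Detached.impossible D K out-f none)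
  ... | no 2≰ | inj₁ (a , Sa) = ⊥-elim (Tangent.impossible D (shifted a) (λ i → out-f (i + a)) Sa uniqS)
    where
    uniqS : ∀ i → S f (i + a) ≡ true → v (i + a) ≡ v a
    uniqS i Si with offset a (i + a)
    ... | zero  , _   , q , q' , h = transfer v per-v q q' h
    ... | suc k , k<l , q , q' , h = ⊥-elim (2≰ (2≤cnt (per-S f) a (suc k) (s≤s z≤n) k<l Sa
      (trans (sym (transfer (S f) (per-S f) q q' h)) Si)))

-- Two well-separated periodic sets

module Gaps (l : ℕ) (0<l : 0 < l) where
  open Periodic l 0<l

  cnt-∪ : ∀ (A B : ℕ → Bool) → cnt (λ i → A i ∨ B i) ≤ cnt A + cnt B
  cnt-∪ A B = subst (cnt (λ i → A i ∨ B i) ≤_) (sym (cnt-∨∧ A B)) (m≤m+n _ _)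

  cnt-split : ∀ (A B : ℕ → Bool) → cnt A ≤ cnt (λ i → A i ∧ not (B i)) + cnt (λ i → A i ∧ B i)
  cnt-split A B = ≤-trans (cnt-mono split) (cnt-∪ _ _)
    where
    split : ∀ i → A i ≡ true → (A i ∧ not (B i)) ∨ (A i ∧ B i) ≡ true
    split i Ai = cases (A i) (B i) Ai
      where
      cases : ∀ a b → a ≡ true → (a ∧ not b) ∨ (a ∧ b) ≡ true
      cases true true  refl = refl
      cases true false refl = refl

  abstract
    gap-lin₁ : ∀ (a i m m' x h l : ℕ) → a + m' ≤ l → m + h ≤ m' → i + (i + x) ≤ m → (a + i) + (i + x) + h ≤ l
    gap-lin₁ a i m m' x h l h₁ h₂ h₃ = ≮⇒≥ λ neg → infeasible (a ∷ i ∷ m ∷ m' ∷ x ∷ h ∷ l ∷ [])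
      ((var 0 ⊕ var 3) ⊕ ((var 2 ⊕ var 5) ⊕ ((var 1 ⊕ (var 1 ⊕ var 4)) ⊕ (con 1 ⊕ var 6))))
      (var 6 ⊕ (var 3 ⊕ (var 2 ⊕ ((var 0 ⊕ var 1) ⊕ (var 1 ⊕ var 4) ⊕ var 5))))
      (con 0) refl (+-mono-≤ h₁ (+-mono-≤ h₂ (+-mono-≤ h₃ neg)))

  module Spread {A B : ℕ → Bool} (pA : Periodic A) (pB : Periodic B) (h : ℕ) (1≤h : 1 ≤ h)
           (A-B : ∀ i t → 0 < t → t ≤ h → A i ≡ true → B (t + i) ≡ true → ⊥)
           (B-A : ∀ i t → 0 < t → t ≤ h → B i ≡ true → A (t + i) ≡ true → ⊥) where

    I A° B° M : ℕ → Bool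
    I i = A i ∧ B i
    A° i = A i ∧ not (B i)
    B° i = B i ∧ not (A i)
    M i = B i ∨ B (suc i)

    pA° : Periodic A°
    pA° = periodic-∧ pA (periodic-not pB)

    pM : Periodic M
    pM = periodic-∨ pB (periodic-shift 1 pB)

    -- `I`, its translate by one, and `B²` are disjoint parts of `M`: as `h ≥ 1`, no element of `A`
    -- is directly followed by one of `B`, nor the other way round.
    cnt-M : cnt I + (cnt I + cnt (λ i → B° i ∨ B° (suc i))) ≤ cnt M
    cnt-M = begin
      cnt I + (cnt I + cnt B²)              ≡⟨ cong (λ t → cnt I + (t + cnt B²)) (sym (cnt-suc (periodic-∧ pA pB))) ⟩
      cnt I + (cnt (I ∘ suc) + cnt B²)      ≤⟨ +-monoʳ-≤ (cnt I) (cnt-disjoint (I ∘ suc) B² I⁺#B²) ⟩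
      cnt I + cnt (λ i → I (suc i) ∨ B² i)  ≤⟨ cnt-disjoint I _ I#rest ⟩
      cnt (λ i → I i ∨ (I (suc i) ∨ B² i))  ≤⟨ cnt-mono incl ⟩
      cnt M                                 ∎
      where
      open ≤-Reasoning
      B² : ℕ → Bool
      B² i = B° i ∨ B° (suc i)
      I⁺#B² : ∀ i → I (suc i) ≡ true → B² i ≡ true → ⊥
      I⁺#B² i hI hB with ∨-elim {B° i} hB
      ... | inj₁ b = B-A i 1 (s≤s z≤n) 1≤h (proj₁ (∧-elim b)) (proj₁ (∧-elim hI))
      ... | inj₂ b = not-elim (proj₂ (∧-elim {B (suc i)} b)) (proj₁ (∧-elim hI))
      I#rest : ∀ i → I i ≡ true → I (suc i) ∨ B² i ≡ true → ⊥
      I#rest i hI hR with ∨-elim {I (suc i)} hR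
      ... | inj₁ hI⁺ = A-B i 1 (s≤s z≤n) 1≤h (proj₁ (∧-elim hI)) (proj₂ (∧-elim {A (suc i)} hI⁺))
      ... | inj₂ hB with ∨-elim {B° i} hB
      ...   | inj₁ b = not-elim (proj₂ (∧-elim {B i} b)) (proj₁ (∧-elim hI))
      ...   | inj₂ b = A-B i 1 (s≤s z≤n) 1≤h (proj₁ (∧-elim hI)) (proj₁ (∧-elim b))
      incl : ∀ i → I i ∨ (I (suc i) ∨ B² i) ≡ true → M i ≡ true
      incl i hh with ∨-elim {I i} hh
      ... | inj₁ hI = ∨-introˡ (proj₂ (∧-elim {A i} hI))
      ... | inj₂ hR with ∨-elim {I (suc i)} hR
      ...   | inj₁ hI⁺ = ∨-introʳ {B i} (proj₂ (∧-elim {A (suc i)} hI⁺))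
      ...   | inj₂ hB with ∨-elim {B° i} hB
      ...     | inj₁ b = ∨-introˡ {B i} (proj₁ (∧-elim {B i} b))
      ...     | inj₂ b = ∨-introʳ {B i} (proj₁ (∧-elim b))

    -- Three reasons cover the range: for `t < h` the step from `B` to `A` is too short, for `t = h`
    -- the set `A°` avoids `B`, and for `t = suc h` the step from `A` to `B` has length one.
    A°#B : ∀ i t → t ≤ suc h → A° (h + i) ≡ true → B (t + i) ≡ true → ⊥
    A°#B i t t≤ hA hB with <-cmp t h
    ... | tri≈ _ refl _ = not-elim (proj₂ (∧-elim {A (t + i)} hA)) hB
    ... | tri< t<h _ _ = B-A (t + i) (h ∸ t) (m<n⇒0<n∸m t<h) (m∸n≤m h t) hB
      (subst (λ s → A s ≡ true) (sym (trans (sym (+-assoc (h ∸ t) t i)) (cong (_+ i) (m∸n+n≡m (<⇒≤ t<h))))) (proj₁ (∧-elim hA)))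
    ... | tri> _ _ h<t = A-B (h + i) 1 (s≤s z≤n) 1≤h (proj₁ (∧-elim hA))
      (subst (λ s → B (s + i) ≡ true) (≤-antisym t≤ h<t) hB)

    A°#dil : ∀ i → A° (h + i) ≡ true → dil h M i ≡ true → ⊥
    A°#dil i hA hM with dil-elim {M} h i hM
    ... | t , t≤h , hMt with ∨-elim {B (t + i)} hMt
    ...   | inj₁ b = A°#B i t (m≤n⇒m≤1+n t≤h) hA b
    ...   | inj₂ b = A°#B i (suc t) (s≤s t≤h) hA b

    -- A ∖ B lies outside the h-neighbourhood of B, and that neighbourhood is large because it contains M.
    gap : 0 < cnt A° → 0 < cnt B → cnt A + (cnt I + cnt (λ i → B° i ∨ B° (suc i))) + h ≤ l
    gap 0<A° 0<B = ≤-trans (+-monoˡ-≤ h (+-monoˡ-≤ _ (cnt-split A B)))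
      (gap-lin₁ (cnt A°) (cnt I) (cnt M) (cnt (dil h M)) (cnt (λ i → B° i ∨ B° (suc i))) h l
        (subst (λ t → t + cnt (dil h M) ≤ l) (cnt-shift h pA°) (cnt-disjoint-l (λ i → A° (h + i)) (dil h M) A°#dil))
        (dilate (cnt-witness (λ i → A° (h + i)) (subst (0 <_) (sym (cnt-shift h pA°)) 0<A°)) (cnt-witness B 0<B))
        cnt-M)
      where
      dilate : (∃ λ a → A° (h + a) ≡ true) → (∃ λ b → B b ≡ true) → cnt M + h ≤ cnt (dil h M)
      dilate (a , ha) (b , hb) = cnt-dil pM h b a (∨-introˡ hb) (¬true⇒false (A°#dil a ha))

  abstract
    gap-lin₂ : ∀ (a b i b° x h l : ℕ) → a + (i + x) + h ≤ l → b ≤ b° + i → b° < x → a + b + h + 1 ≤ l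
    gap-lin₂ a b i b° x h l h₁ h₂ h₃ = ≮⇒≥ λ neg → infeasible (a ∷ b ∷ i ∷ b° ∷ x ∷ h ∷ l ∷ [])
      ((var 0 ⊕ (var 2 ⊕ var 4) ⊕ var 5) ⊕ (var 1 ⊕ ((con 1 ⊕ var 3) ⊕ (con 1 ⊕ var 6))))
      (var 6 ⊕ ((var 3 ⊕ var 2) ⊕ (var 4 ⊕ (var 0 ⊕ var 1 ⊕ var 5 ⊕ con 1))))
      (con 0) refl (+-mono-≤ h₁ (+-mono-≤ h₂ (+-mono-≤ h₃ neg)))

    gap-lin₃ : ∀ (a b i b° x h l r n : ℕ) → a + (i + x) + h ≤ l → b ≤ b° + i → b° ≤ x → b < a → r ≤ a + h → r ≤ b + h → l + h ≤ n → n ≤ r + r → ⊥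
    gap-lin₃ a b i b° x h l r n h₁ h₂ h₃ h₄ h₅ h₆ h₇ h₈ = infeasible (a ∷ b ∷ i ∷ b° ∷ x ∷ h ∷ l ∷ r ∷ n ∷ [])
      ((var 0 ⊕ (var 2 ⊕ var 4) ⊕ var 5) ⊕ (var 1 ⊕ (var 3 ⊕ ((con 1 ⊕ var 1) ⊕ (var 7 ⊕ (var 7 ⊕ ((var 6 ⊕ var 5) ⊕ var 8)))))))
      (var 6 ⊕ ((var 3 ⊕ var 2) ⊕ (var 4 ⊕ (var 0 ⊕ ((var 1 ⊕ var 5) ⊕ ((var 1 ⊕ var 5) ⊕ (var 8 ⊕ (var 7 ⊕ var 7))))))))
      (con 0) refl (+-mono-≤ h₁ (+-mono-≤ h₂ (+-mono-≤ h₃ (+-mono-≤ h₄ (+-mono-≤ h₆ (+-mono-≤ h₆ (+-mono-≤ h₇ h₈)))))))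

    gap-lin₄ : ∀ (a b h l r n : ℕ) → a + b + h + 1 ≤ l → r ≤ a + h → r ≤ b + h → l + h ≤ n → n ≤ r + r → ⊥
    gap-lin₄ a b h l r n h₁ h₂ h₃ h₄ h₅ = infeasible (a ∷ b ∷ h ∷ l ∷ r ∷ n ∷ [])
      ((var 0 ⊕ var 1 ⊕ var 2 ⊕ con 1) ⊕ (var 4 ⊕ (var 4 ⊕ ((var 3 ⊕ var 2) ⊕ var 5))))
      (var 3 ⊕ ((var 0 ⊕ var 2) ⊕ ((var 1 ⊕ var 2) ⊕ (var 5 ⊕ (var 4 ⊕ var 4)))))
      (con 0) refl (+-mono-≤ h₁ (+-mono-≤ h₂ (+-mono-≤ h₃ (+-mono-≤ h₄ h₅))))

  -- If `A` were not inside `B`, `gap` would give `cnt A + cnt B + h ≤ l`, with something to spare: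
  -- either `B°` is nonempty and gains from its translate, or `B` is a proper subset of `A`. The
  -- size bounds then give `2 r < l + h`, against `l + h ≤ n ≤ 2 r`.
  gap-absurd : ∀ {A B} → Periodic A → Periodic B → ∀ h → 1 ≤ h →
    (∀ i t → 0 < t → t ≤ h → A i ≡ true → B (t + i) ≡ true → ⊥) →
    (∀ i t → 0 < t → t ≤ h → B i ≡ true → A (t + i) ≡ true → ⊥) →
    ∀ {r n} → r ≤ cnt A + h → r ≤ cnt B + h → l + h ≤ n → n ≤ r + r → 0 < cnt B → A ⊑ B
  gap-absurd {A} {B} pA pB h 1≤h A-B B-A {r} {n} rA rB l+h n≤2r 0<B i Ai with dec-true (B i)
  ... | inj₁ Bi = Bi
  ... | inj₂ ¬Bi = ⊥-elim (finish (dec-pos (cnt B°)))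
    where
    A° B° I : ℕ → Bool
    A° i = A i ∧ not (B i)
    B° i = B i ∧ not (A i)
    I i = A i ∧ B i
    A°i : A° i ≡ true
    A°i = ∧-intro Ai (not-intro (λ e → true≢false e ¬Bi))
    B≤ : cnt B ≤ cnt B° + cnt I
    B≤ = ≤-trans (cnt-split B A) (+-monoʳ-≤ (cnt B°) (cnt-mono λ i h → ∧-intro (proj₂ (∧-elim {B i} h)) (proj₁ (∧-elim h))))
    bound : cnt A + (cnt I + cnt (λ i → B° i ∨ B° (suc i))) + h ≤ l
    bound = Spread.gap pA pB h 1≤h A-B B-A (cnt-pos (periodic-∧ pA (periodic-not pB)) i A°i) 0<B
    dec-pos : ∀ x → 0 < x ⊎ x ≡ 0
    dec-pos zero    = inj₂ refl
    dec-pos (suc x) = inj₁ (s≤s z≤n)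
    B°≤ : cnt B° ≤ cnt (λ i → B° i ∨ B° (suc i))
    B°≤ = cnt-mono (λ i → ∨-introˡ)
    finish : 0 < cnt B° ⊎ cnt B° ≡ 0 → ⊥
    finish (inj₁ 0<B°) = gap-lin₄ (cnt A) (cnt B) h l r n (gap-lin₂ (cnt A) (cnt B) (cnt I) (cnt B°) _ h l bound B≤ (grow (cnt-witness B° 0<B°))) rA rB l+h n≤2r
      where
      grow : (∃ λ b → B° b ≡ true) → cnt B° < cnt (λ i → B° i ∨ B° (suc i))
      grow (b , hb) = cnt-grow (periodic-∧ pB (periodic-not pA)) b i hb
        (¬true⇒false λ e → not-elim (proj₂ (∧-elim {B i} e)) Ai)
    finish (inj₂ B°≡0) = gap-lin₃ (cnt A) (cnt B) (cnt I) (cnt B°) _ h l r n bound B≤ B°≤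
      (cnt-strict pB pA B⊑A i Ai (λ e → true≢false e ¬Bi)) rA rB l+h n≤2r
      where
      B⊑A : B ⊑ A
      B⊑A j Bj with dec-true (A j)
      ... | inj₁ Aj = Aj
      ... | inj₂ ¬Aj = contradiction (cnt-pos (periodic-∧ pB (periodic-not pA)) j
        (∧-intro Bj (not-intro (λ e → true≢false e ¬Aj)))) (λ 0< → <⇒≢ 0< (sym B°≡0))

  -- Distances above `h` inside `A` make its translates by `0, …, t` disjoint, so their sizes add
  -- up.
  cnt-translates : ∀ {A} → Periodic A → ∀ h →
    (∀ i t → 0 < t → t ≤ h → A i ≡ true → A (t + i) ≡ true → ⊥) →
    ∀ t → t ≤ h → suc t * cnt A ≤ cnt (dil t A)
  cnt-translates {A} pA h A-A zero    t≤h = ≤-reflexive (+-identityʳ _)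
  cnt-translates {A} pA h A-A (suc t) t≤h = begin
    cnt A + suc t * cnt A                        ≤⟨ +-monoʳ-≤ (cnt A) (cnt-translates pA h A-A t (≤-trans (n≤1+n t) t≤h)) ⟩
    cnt A + cnt (dil t A)                        ≡⟨ cong (cnt A +_) (sym (cnt-suc (periodic-dil t pA))) ⟩
    cnt A + cnt (dil t A ∘ suc)                  ≤⟨ cnt-disjoint A (dil t A ∘ suc) disj ⟩
    cnt (λ i → A i ∨ dil t A (suc i))            ≤⟨ cnt-mono incl ⟩
    cnt (dil (suc t) A)                          ∎
    where
    open ≤-Reasoning
    disj : ∀ i → A i ≡ true → dil t A (suc i) ≡ true → ⊥
    disj i Ai hd with dil-elim {A} t (suc i) hd
    ... | s , s≤t , As = A-A i (suc s) (s≤s z≤n) (≤-trans (s≤s s≤t) t≤h) Ai (subst (λ j → A j ≡ true) (+-suc s i) As)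
    incl : ∀ i → A i ∨ dil t A (suc i) ≡ true → dil (suc t) A i ≡ true
    incl i hh with ∨-elim {A i} hh
    ... | inj₁ Ai = dil-incl (suc t) i Ai
    ... | inj₂ hd = ∨-introʳ {dil t A i} hd

-- Replacing an edge of the cycle

abstract
  caseB-lin : ∀ (s w x y l : ℕ) → s + w ≡ x + y → x ≤ l → y ≤ 2 → s + w ≤ l + 2
  caseB-lin s w x y l h₁ h₂ h₃ = ≮⇒≥ λ neg → infeasible (s ∷ w ∷ x ∷ y ∷ l ∷ [])
    ((var 0 ⊕ var 1) ⊕ (var 2 ⊕ (var 3 ⊕ (con 1 ⊕ (var 4 ⊕ con 2)))))
    ((var 2 ⊕ var 3) ⊕ (var 4 ⊕ (con 2 ⊕ (var 0 ⊕ var 1))))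
    (con 0) refl (+-mono-≤ (≤-reflexive h₁) (+-mono-≤ h₂ (+-mono-≤ h₃ neg)))

  ew-lin₁ : ∀ (s t u a r l : ℕ) → u + t ≤ l → s + s ≡ u + a → r ≤ s + 1 → r ≤ 1 + t → r + r ≡ 1 + l → 3 ≤ r → 0 < a
  ew-lin₁ s t u a r l h₁ h₂ h₃ h₄ h₅ h₆ = ≮⇒≥ λ neg → infeasible (s ∷ t ∷ u ∷ a ∷ r ∷ l ∷ [])
    ((var 2 ⊕ var 1) ⊕ ((var 0 ⊕ var 0) ⊕ (var 4 ⊕ (var 4 ⊕ (var 4 ⊕ ((con 1 ⊕ var 5) ⊕ (con 3 ⊕ (con 1 ⊕ var 3))))))))
    (var 5 ⊕ ((var 2 ⊕ var 3) ⊕ ((var 0 ⊕ con 1) ⊕ ((var 0 ⊕ con 1) ⊕ ((con 1 ⊕ var 1) ⊕ ((var 4 ⊕ var 4) ⊕ (var 4 ⊕ (con 1 ⊕ con 0))))))))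
    (con 0) refl (+-mono-≤ h₁ (+-mono-≤ (≤-reflexive h₂) (+-mono-≤ h₃ (+-mono-≤ h₃ (+-mono-≤ h₄ (+-mono-≤ (≤-reflexive (sym h₅)) (+-mono-≤ h₆ neg)))))))

  ew-lin₂ : ∀ (r s w t q E u l : ℕ) → s + w ≤ l + 2 → r ≤ s → u + q ≤ w → t < u → E < q → 0 < E → r ≤ 1 + t → r + r ≡ 1 + l → ⊥
  ew-lin₂ r s w t q E u l h₁ h₂ h₃ h₄ h₅ h₆ h₇ h₈ = infeasible (r ∷ s ∷ w ∷ t ∷ q ∷ E ∷ u ∷ l ∷ [])
    ((var 1 ⊕ var 2) ⊕ (var 0 ⊕ ((var 6 ⊕ var 4) ⊕ ((con 1 ⊕ var 3) ⊕ ((con 1 ⊕ var 5) ⊕ ((con 1 ⊕ con 0) ⊕ (var 0 ⊕ (con 1 ⊕ var 7))))))))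
    ((var 7 ⊕ con 2) ⊕ (var 1 ⊕ (var 2 ⊕ (var 6 ⊕ (var 4 ⊕ (var 5 ⊕ ((con 1 ⊕ var 3) ⊕ (var 0 ⊕ var 0))))))))
    (con 0) refl (+-mono-≤ h₁ (+-mono-≤ h₂ (+-mono-≤ h₃ (+-mono-≤ h₄ (+-mono-≤ h₅ (+-mono-≤ h₆ (+-mono-≤ h₇ (≤-reflexive (sym h₈)))))))))

  ew-lin₃ : ∀ (l n : ℕ) → l + 2 ≤ n → n ≤ 1 + l → ⊥
  ew-lin₃ l n h₁ h₂ = infeasible (l ∷ n ∷ [])
    ((var 0 ⊕ con 2) ⊕ var 1)
    (var 1 ⊕ (con 1 ⊕ var 0))
    (con 0) refl (+-mono-≤ h₁ h₂)

  ew-lin₄ : ∀ (r t : ℕ) → r ≤ 1 + t → 3 ≤ r → 0 < t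
  ew-lin₄ r t h₁ h₂ = ≮⇒≥ λ neg → infeasible (r ∷ t ∷ [])
    (var 0 ⊕ (con 3 ⊕ (con 1 ⊕ var 1)))
    ((con 1 ⊕ var 1) ⊕ (var 0 ⊕ (con 1 ⊕ con 0)))
    (con 1) refl (+-mono-≤ h₁ (+-mono-≤ h₂ neg))

module Swap {n m r d l : ℕ} (D : Design n m r d) (K : Edges.LongestCycle D l) where
  open Edges D
  open Longest K
  open Reinsertion D K
  open Gaps l 0<l

  e-index : ∀ {i j} → e j ≡ e i → v j ≡ v i × v (suc j) ≡ v (suc i) × e (suc j) ≡ e (suc i)
  e-index {i} {j} eq with offset i j
  ... | suc k , k<l , q , q' , h = contradiction (trans (sym eq) (transfer e per-e q q' h)) (inj-e i (suc k) (s≤s z≤n) k<l)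
  ... | zero  , _ , q , q' , h = transfer v per-v q q' h ,
    transfer (v ∘ suc) (λ i → trans (cong v (sym (+-suc l i))) (per-v (suc i))) q q' h ,
    transfer (e ∘ suc) (λ i → trans (cong e (sym (+-suc l i))) (per-e (suc i))) q q' h

  -- `f` joins `v i` to `v (k + i)` and `x` joins `e i` to `e (k + i)`. Reversing the arc from `e i`
  -- to `v (k + i)` keeps all of C and adds both `f` and `x`.
  crossed : ∀ {f x} → OutY f → OutX x → ∀ i k → 0 < k → k < l →
    S f i ≡ true → S f (k + i) ≡ true → T x i ≡ true → T x (k + i) ≡ true → ⊥
  crossed {f} {x} out-f out-x i (suc k) 0<k k<l Si Ski Ti Tki = <-irrefl refl
    (≤-trans (crossing-via (onePath (outsideY out-f)) (outsideX out-x) (λ { (here ()) ; (there ()) })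
      (double i) (suc (double k)) (suc (double (suc k))) (N ∸ suc (double (suc k)))
      (Y~v i Si) (subst (λ s → inj₂ f ~ c s) (double-+ (suc k) i) (Y~v (suc k + i) Ski))
      (X~e i Ti) (subst (λ s → inj₁ x ~ c (suc s)) (double-+ (suc k) i) (X~e (suc k + i) Tki))
      ≤-refl (m∸n+n≡m (≤-trans (n≤1+n _) (double-mono k<l))))
      (s≤s (m≤m+n _ 1)))

  -- As in `crossed`, but the arc from `v (suc i)` to `e (k + i)` is reversed, with `x` and `f` in
  -- exchanged roles.
  crossed′ : ∀ {f x} → OutY f → OutX x → ∀ i k → 0 < k → k < l →
    S f (suc i) ≡ true → S f (suc (k + i)) ≡ true → T x i ≡ true → T x (k + i) ≡ true → ⊥
  crossed′ {f} {x} out-f out-x i (suc k) 0<k k<l Si Ski Ti Tki = <-irrefl refl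
    (≤-trans (crossing-via (onePath (outsideX out-x)) (outsideY out-f) (λ { (here ()) ; (there ()) })
      (suc (double i)) (suc (double k)) (suc (double (suc k))) (N ∸ suc (double (suc k)))
      (X~e i Ti) (subst (λ s → inj₁ x ~ c s) pos (X~e (suc k + i) Tki))
      (Y~v (suc i) Si) (subst (λ s → inj₂ f ~ c (suc s)) pos (Y~v (suc (suc k + i)) Ski))
      ≤-refl (m∸n+n≡m (≤-trans (n≤1+n _) (double-mono k<l))))
      (s≤s (m≤m+n _ 1)))
    where
    pos : suc (double (suc k + i)) ≡ double (suc k) + suc (double i)
    pos = trans (cong suc (double-+ (suc k) i)) (sym (+-suc (double (suc k)) (double i)))

  T² : Fin n → ℕ → Bool
  T² x i = T x i ∨ T x (suc i)

  module _ {f : Fin m} {x : Fin n} (out-f : OutY f) (out-x : OutX x) where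

    both : cnt (λ i → S f i ∧ T x i) ≤ 1
    both = cnt≤1 _ λ i k 0<k k<l h h′ → crossed out-f out-x i k 0<k k<l
      (proj₁ (∧-elim h)) (proj₁ (∧-elim h′)) (proj₂ (∧-elim {S f i} h)) (proj₂ (∧-elim {S f (k + i)} h′))

    both′ : cnt (λ i → S f (suc i) ∧ T x i) ≤ 1
    both′ = cnt≤1 _ λ i k 0<k k<l h h′ → crossed′ out-f out-x i k 0<k k<l
      (proj₁ (∧-elim h)) (proj₁ (∧-elim h′)) (proj₂ (∧-elim {S f (suc i)} h)) (proj₂ (∧-elim {S f (suc (k + i))} h′))

    -- By `both` and `both′`, the translate of `S f` by one meets `T² x` in at most two positions,
    -- and their union has at most `l`.
    crossing-count : cnt (S f) + cnt (T² x) ≤ l + 2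
    crossing-count = subst (λ s → s + cnt (T² x) ≤ l + 2) (cnt-suc (per-S f))
      (caseB-lin (cnt (S f ∘ suc)) (cnt (T² x)) _ _ l (cnt-∨∧ (S f ∘ suc) (T² x)) (cnt≤ _)
        (≤-trans (≤-trans (cnt-mono split) (cnt-∪ (λ i → S f (suc i) ∧ T x i) (λ i → S f (suc i) ∧ T x (suc i))))
          (+-mono-≤ both′ (≤-trans (≤-reflexive (cnt-suc (periodic-∧ (per-S f) (per-T x)))) both))))
      where
      split : ∀ i → S f (suc i) ∧ T² x i ≡ true → (S f (suc i) ∧ T x i) ∨ (S f (suc i) ∧ T x (suc i)) ≡ true
      split i h with ∨-elim {T x i} (proj₂ (∧-elim {S f (suc i)} h))
      ... | inj₁ t = ∨-introˡ (∧-intro (proj₁ (∧-elim {S f (suc i)} h)) t)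
      ... | inj₂ t = ∨-introʳ {S f (suc i) ∧ T x i} (∧-intro (proj₁ (∧-elim h)) t)

  module _ {f : Fin m} (out-f : OutY f) (i : ℕ) (Si : S f i ≡ true) (Si⁺ : S f (suc i) ≡ true) where

    -- Edges are compared, not indices, so every position congruent to `i` is changed at once and
    -- periodicity is inherited.
    e′ : ℕ → Fin m
    e′ j = if does (e j Fin.≟ e i) then f else e j

    e′-new : ∀ j → e j ≡ e i → e′ j ≡ f
    e′-new j eq with e j Fin.≟ e i
    ... | yes _ = refl
    ... | no ≢ = contradiction eq ≢

    e′-cases : ∀ j → (e j ≡ e i × e′ j ≡ f) ⊎ (e j ≢ e i × e′ j ≡ e j)
    e′-cases j with e j Fin.≟ e i
    ... | yes eq = inj₁ (eq , refl)
    ... | no ≢ = inj₂ (≢ , refl)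

    -- The length is unchanged, so the new cycle is again a longest one; `e i` has become outer.
    swapped : LongestCycle l
    swapped = record
      { C = record { v = v ; e = e′ ; per-v = per-v
                   ; per-e = λ j → cong (λ y → if does (y Fin.≟ e i) then f else y) (per-e j)
                   ; inj-v = inj-v ; inj-e = inj-e′ ; here∈ = here∈′ ; next∈ = next∈′ }
      ; 2≤l = 2≤l ; max = max ; l<n = l<n ; l<m = l<m ; l<2d = l<2d }
      where
      inj-e′ : ∀ j k → 0 < k → k < l → e′ j ≢ e′ (k + j)
      inj-e′ j k 0<k k<l eq with e′-cases j | e′-cases (k + j)
      ... | inj₁ (a , _) | inj₁ (b , _) = inj-e j k 0<k k<l (trans a (sym b))
      ... | inj₁ (_ , a) | inj₂ (_ , b) = out-f (k + j) (trans (sym a) (trans eq b))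
      ... | inj₂ (_ , a) | inj₁ (_ , b) = out-f j (trans (sym b) (trans (sym eq) a))
      ... | inj₂ (_ , a) | inj₂ (_ , b) = inj-e j k 0<k k<l (trans (sym a) (trans eq b))
      here∈′ : ∀ j → v j ∈ᴱ e′ j
      here∈′ j with e′-cases j
      ... | inj₁ (a , b) = subst₂ _∈ᴱ_ (sym (proj₁ (e-index a))) (sym b) Si
      ... | inj₂ (_ , b) = subst (v j ∈ᴱ_) (sym b) (here∈ j)
      next∈′ : ∀ j → v (suc j) ∈ᴱ e′ j
      next∈′ j with e′-cases j
      ... | inj₁ (a , b) = subst₂ _∈ᴱ_ (sym (proj₁ (proj₂ (e-index a)))) (sym b) Si⁺
      ... | inj₂ (_ , b) = subst (v (suc j) ∈ᴱ_) (sym b) (next∈ j)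

    freed : ∀ j → e i ≢ e′ j
    freed j eq with e′-cases j
    ... | inj₁ (_ , b) = out-f i (sym (trans eq b))
    ... | inj₂ (a , b) = a (sym (trans eq b))

  only-outside : n ≤ 1 + l → ∀ {x x'} → OutX x → OutX x' → x ≡ x'
  only-outside n≤ {x} {x'} out-x out-x' with x Fin.≟ x'
  ... | yes eq = eq
  ... | no x≢x' = ⊥-elim (ew-lin₃ l n (≤-trans (≤-reflexive len) (≤-trans
      (count-pack {n} (λ _ → true) (λ _ → false) {x ∷ x' ∷ applyUpTo v l} U (λ _ _ → refl) (λ _ → refl) (λ _ ())) (count≤ {n} (λ _ → true)))) n≤)
    where
    out∉ : ∀ {z} → OutX z → ∀ {w} → w ∈ applyUpTo v l → z ≢ w
    out∉ out w∈ refl with ∈-applyUpTo⁻ v w∈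
    ... | i , _ , eq = out i eq
    U : Unique (x ∷ x' ∷ applyUpTo v l)
    U = (x≢x' ∷ All.tabulate (out∉ out-x)) ∷ All.tabulate (out∉ out-x') ∷
        Unique.applyUpTo⁺₁ v l λ {i} {j} i<j j<l eq → inj-v i (j ∸ i) (m<n⇒0<n∸m i<j) (≤-<-trans (m∸n≤m j i) j<l)
          (trans eq (cong v (sym (m∸n+n≡m (<⇒≤ i<j)))))
    len : l + 2 ≡ count {n} (λ _ → false) + length (x ∷ x' ∷ applyUpTo v l)
    len = trans (+-comm l 2) (cong₂ _+_ (sym (count-empty {n} {λ _ → false} λ _ ())) (cong (2 +_) (sym (length-applyUpTo v l))))

  size-inner : n ≤ 1 + l → ∀ {y x} → OutX x → x ∉ᴱ y → r ≤ cnt (S y)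
  size-inner n≤ {y} {x} out-x x∉y = subst (r ≤_) (trans (cong (λ t → cnt (S y) + (t + 0)) (count-empty {n} {λ _ → false} λ _ ())) (+-identityʳ _))
    (size-cover y (λ _ → false) [] λ x' out x'∈y → ⊥-elim (x∉y (subst (_∈ᴱ y) (only-outside n≤ out out-x) x'∈y)))

module OneOutside {n m r d l : ℕ} (D : Design n m r d) (K : Edges.LongestCycle D l) where
  open Edges D
  open Longest K
  open Reinsertion D K
  open Swap D K

  -- Exactly one outside vertex x, lying in an outside edge f: put f on the cycle in place of some e i;
  -- then the crossing count fails for e i.
  one-outside : n ≤ 1 + l → r + r ≡ 1 + l → ∀ {f x} → OutY f → OutX x → x ∈ᴱ f → r ≤ 1 + cnt (T x) → ⊥
  one-outside n≤ 2r≡ {f} {x} out-f out-x x∈f r≤T = swap (cnt-witness (λ i → S f i ∧ S f (suc i)) consecutive)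
    where
    S≤ : r ≤ cnt (S f) + 1
    S≤ = subst (λ t → r ≤ cnt (S f) + (t + 1)) (count-empty {n} {λ _ → false} λ _ ())
      (size-cover f (λ _ → false) (x ∷ []) λ x' out _ → inj₂ (here (only-outside n≤ out out-x)))
    -- The union of `S f` and its translate avoids `T x`, so it has at most `l - (r - 1) = r`
    -- positions. Each of the two sets has at least `r - 1`, so they overlap as `r ≥ 3`.
    consecutive : 0 < cnt (λ i → S f i ∧ S f (suc i))
    consecutive = ew-lin₁ (cnt (S f)) (cnt (T x)) _ _ r l
      (cnt-disjoint-l (λ i → S f i ∨ S f (suc i)) (T x) disj)
      (trans (cong (cnt (S f) +_) (sym (cnt-suc (per-S f)))) (cnt-∨∧ (S f) (S f ∘ suc)))
      S≤ r≤T 2r≡ 3≤r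
      where
      disj : ∀ i → S f i ∨ S f (suc i) ≡ true → T x i ≡ true → ⊥
      disj i h Ti with ∨-elim {S f i} h
      ... | inj₁ s = no-insert out-f out-x x∈f i s Ti
      ... | inj₂ s = no-insert′ out-f out-x x∈f i s Ti
    swap : (∃ λ i → S f i ∧ S f (suc i) ≡ true) → ⊥
    -- On the new cycle `x` also lies in the edge at position `i`, away from its old edges. So `T′²`
    -- has at least `r + 2` positions; with `r` vertices of `e i` on the cycle, the crossing count
    -- would give `2 r ≤ l`.
    swap (i , h) = ew-lin₂ r (cnt (S (e i))) (cnt T′²) (cnt (T x)) (cnt (λ j → E j ∨ E (suc j))) (cnt E) (cnt (T² x)) l
      count′ (size-inner n≤ out-x (no-insert out-f out-x x∈f i Si))
      (≤-trans (cnt-disjoint (T² x) (λ j → E j ∨ E (suc j)) disj) (cnt-mono incl))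
      (grow-T (cnt-witness (T x) (ew-lin₄ r (cnt (T x)) r≤T 3≤r)))
      (cnt-grow pE i (suc i) (E-intro refl) (¬true⇒false λ h → e-distinct i (sym (E-elim h))))
      (cnt-pos pE i (E-intro refl)) r≤T 2r≡
      where
      Si : S f i ≡ true
      Si = proj₁ (∧-elim h)
      Si⁺ : S f (suc i) ≡ true
      Si⁺ = proj₂ (∧-elim {S f i} h)
      E : ℕ → Bool
      E j = does (e j Fin.≟ e i)
      pE : Periodic E
      pE j = cong (λ y → does (y Fin.≟ e i)) (per-e j)
      E-intro : ∀ {j} → e j ≡ e i → E j ≡ true
      E-intro {j} eq with e j Fin.≟ e i
      ... | yes _ = refl
      ... | no ≢ = contradiction eq ≢
      E-elim : ∀ {j} → E j ≡ true → e j ≡ e i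
      E-elim {j} h with e j Fin.≟ e i
      ... | yes eq = eq
      T′ T′² : ℕ → Bool
      T′ j = inc x (e′ out-f i Si Si⁺ j)
      T′² j = T′ j ∨ T′ (suc j)
      K′ : LongestCycle l
      K′ = swapped out-f i Si Si⁺
      count′ : cnt (S (e i)) + cnt T′² ≤ l + 2
      count′ = Swap.crossing-count D K′ (freed out-f i Si Si⁺) out-x
      T-mono : ∀ j → T x j ≡ true → T′ j ≡ true
      T-mono j Tj with e′-cases out-f i Si Si⁺ j
      ... | inj₁ (_ , b) = subst (x ∈ᴱ_) (sym b) x∈f
      ... | inj₂ (_ , b) = subst (x ∈ᴱ_) (sym b) Tj
      E-mono : ∀ j → E j ≡ true → T′ j ≡ true
      E-mono j Ej = subst (x ∈ᴱ_) (sym (e′-new out-f i Si Si⁺ j (E-elim Ej))) x∈f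
      x∉eᵢ : x ∉ᴱ e i
      x∉eᵢ = no-insert out-f out-x x∈f i Si
      disj : ∀ j → T² x j ≡ true → E j ∨ E (suc j) ≡ true → ⊥
      disj j hT hE with ∨-elim {T x j} hT | ∨-elim {E j} hE
      ... | inj₁ t | inj₁ a = x∉eᵢ (subst (x ∈ᴱ_) (E-elim a) t)
      ... | inj₂ t | inj₂ a = x∉eᵢ (subst (x ∈ᴱ_) (E-elim a) t)
      ... | inj₂ t | inj₁ a = no-insert out-f out-x x∈f (suc i) Si⁺ (subst (x ∈ᴱ_) (proj₂ (proj₂ (e-index (E-elim a)))) t)
      ... | inj₁ t | inj₂ a = no-insert′ out-f out-x x∈f j (subst (_∈ᴱ f) (sym (proj₁ (e-index (E-elim a)))) Si) t
      grow-T : (∃ λ a → T x a ≡ true) → cnt (T x) < cnt (T² x)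
      grow-T (a , ha) = cnt-grow (per-T x) a i ha (¬true⇒false x∉eᵢ)
      incl : ∀ j → T² x j ∨ (E j ∨ E (suc j)) ≡ true → T′² j ≡ true
      incl j h with ∨-elim {T² x j} h
      ... | inj₁ hT with ∨-elim {T x j} hT
      ...   | inj₁ t = ∨-introˡ (T-mono j t)
      ...   | inj₂ t = ∨-introʳ {T′ j} (T-mono (suc j) t)
      incl j h | inj₂ hE with ∨-elim {E j} hE
      ...   | inj₁ a = ∨-introˡ (E-mono j a)
      ...   | inj₂ a = ∨-introʳ {T′ j} (E-mono (suc j) a)

-- An outer vertex that lies in no outer edge

abstract
  iso-lin₁ : ∀ (s w r l : ℕ) → s + w ≤ l + 2 → r ≤ s → l ≤ w → 3 ≤ r → ⊥
  iso-lin₁ s w r l h₁ h₂ h₃ h₄ = infeasible (s ∷ w ∷ r ∷ l ∷ [])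
    ((var 0 ⊕ var 1) ⊕ (var 2 ⊕ (var 3 ⊕ con 3)))
    ((var 3 ⊕ con 2) ⊕ (var 0 ⊕ (var 1 ⊕ var 2)))
    (con 0) refl (+-mono-≤ h₁ (+-mono-≤ h₂ (+-mono-≤ h₃ h₄)))

  iso-lin₂ : ∀ (s t x y r l : ℕ) → s + t ≡ x + y → y ≤ 1 → r ≤ s → r ≤ t → r + r ≡ 1 + l → l ≤ x
  iso-lin₂ s t x y r l h₁ h₂ h₃ h₄ h₅ = ≮⇒≥ λ neg → infeasible (s ∷ t ∷ x ∷ y ∷ r ∷ l ∷ [])
    ((var 0 ⊕ var 1) ⊕ (var 3 ⊕ (var 4 ⊕ (var 4 ⊕ ((con 1 ⊕ var 5) ⊕ (con 1 ⊕ var 2))))))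
    ((var 2 ⊕ var 3) ⊕ (con 1 ⊕ (var 0 ⊕ (var 1 ⊕ ((var 4 ⊕ var 4) ⊕ var 5)))))
    (con 0) refl (+-mono-≤ (≤-reflexive h₁) (+-mono-≤ h₂ (+-mono-≤ h₃ (+-mono-≤ h₄ (+-mono-≤ (≤-reflexive (sym h₅)) neg)))))

  iso-lin₃ : ∀ (s w t r l a x : ℕ) → s + w ≤ l + 2 → r ≤ s → r ≤ t → t < w → r + r ≡ 1 + l → t + t ≡ w + a → l ≤ s + x → a ≤ x
  iso-lin₃ s w t r l a x h₁ h₂ h₃ h₄ h₅ h₆ h₇ = ≮⇒≥ λ neg → infeasible (s ∷ w ∷ t ∷ r ∷ l ∷ a ∷ x ∷ [])
    ((var 0 ⊕ var 1) ⊕ ((con 1 ⊕ var 2) ⊕ ((con 1 ⊕ var 2) ⊕ ((var 1 ⊕ var 5) ⊕ (var 4 ⊕ (con 1 ⊕ var 6))))))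
    ((var 4 ⊕ con 2) ⊕ (var 1 ⊕ (var 1 ⊕ ((var 2 ⊕ var 2) ⊕ ((var 0 ⊕ var 6) ⊕ var 5)))))
    (con 0) refl (+-mono-≤ h₁ (+-mono-≤ h₄ (+-mono-≤ h₄ (+-mono-≤ (≤-reflexive (sym h₆)) (+-mono-≤ h₇ neg)))))

  iso-lin₄ : ∀ (s x y r l : ℕ) → s + s ≡ x + y → x ≤ l → r ≤ s → r + r ≡ 1 + l → 0 < y
  iso-lin₄ s x y r l h₁ h₂ h₃ h₄ = ≮⇒≥ λ neg → infeasible (s ∷ x ∷ y ∷ r ∷ l ∷ [])
    ((var 0 ⊕ var 0) ⊕ (var 1 ⊕ (var 3 ⊕ (var 3 ⊕ ((con 1 ⊕ var 4) ⊕ (con 1 ⊕ var 2))))))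
    ((var 1 ⊕ var 2) ⊕ (var 4 ⊕ (var 0 ⊕ (var 0 ⊕ ((var 3 ⊕ var 3) ⊕ (con 1 ⊕ con 0))))))
    (con 0) refl (+-mono-≤ (≤-reflexive h₁) (+-mono-≤ h₂ (+-mono-≤ h₃ (+-mono-≤ h₃ (+-mono-≤ (≤-reflexive (sym h₄)) neg)))))

  iso-lin₅ : ∀ (d t r : ℕ) → d ≤ t + 1 → r ≤ d → r ≤ 1 + t
  iso-lin₅ d t r h₁ h₂ = ≮⇒≥ λ neg → infeasible (d ∷ t ∷ r ∷ [])
    (var 0 ⊕ (var 2 ⊕ (con 1 ⊕ (con 1 ⊕ var 1))))
    ((var 1 ⊕ con 1) ⊕ (var 0 ⊕ var 2))
    (con 0) refl (+-mono-≤ h₁ (+-mono-≤ h₂ neg))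

module Forced {n m r d l : ℕ} (D : Design n m r d) (K : Edges.LongestCycle D l) where
  open Edges D
  open Longest K
  open Swap D K
  open Gaps l 0<l

  module _ {f : Fin m} {x : Fin n} (out-f : OutY f) (out-x : OutX x) (r≤S : r ≤ cnt (S f)) where

    -- If `T x` were everything, the crossing count would leave only `r ≤ 2`.
    somewhere-off : ∃ λ i → T x i ≡ false
    somewhere-off with some? (periodic-not (per-T x))
    ... | inj₁ (i , h) = i , ¬true⇒false (not-elim h)
    ... | inj₂ all = ⊥-elim (iso-lin₁ (cnt (S f)) (cnt (T² x)) r l (crossing-count out-f out-x) r≤S
      (subst (_≤ cnt (T² x)) full (cnt-mono {λ _ → true} λ i _ → ∨-introˡ (everywhere i))) 3≤r)
      where
      everywhere : ∀ i → T x i ≡ true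
      everywhere i with dec-true (T x i)
      ... | inj₁ h = h
      ... | inj₂ h = ⊥-elim (all i (cong not h))
      full : cnt (λ _ → true) ≡ l
      full = trans (cnt≡ (λ _ → true)) (count-full {l} λ _ → refl)

    T<T² : 0 < cnt (T x) → cnt (T x) < cnt (T² x)
    T<T² 0<T = grow somewhere-off (cnt-witness (T x) 0<T)
      where
      grow : (∃ λ i → T x i ≡ false) → (∃ λ i → T x i ≡ true) → cnt (T x) < cnt (T² x)
      grow (b , hb) (a , ha) = cnt-grow (per-T x) a b ha hb

  module _ {f : Fin m} {x : Fin n} (out-f : OutY f) (out-x : OutX x)
           (2r≡ : r + r ≡ 1 + l) (r≤S : r ≤ cnt (S f)) (r≤T : r ≤ cnt (T x)) where

    -- The two sizes add up to at least `2 r = l + 1` and the overlap is at most one, so the union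
    -- is everything.
    cover : ∀ i → S f i ∨ T x i ≡ true
    cover = cnt-full⁻ (periodic-∨ (per-S f) (per-T x))
      (iso-lin₂ (cnt (S f)) (cnt (T x)) _ _ r l (cnt-∨∧ (S f) (T x)) (both out-f out-x) r≤S r≤T 2r≡)

    cover′ : ∀ i → S f (suc i) ∨ T x i ≡ true
    cover′ = cnt-full⁻ (periodic-∨ (periodic-shift 1 (per-S f)) (per-T x))
      (iso-lin₂ (cnt (S f)) (cnt (T x)) _ _ r l
        (trans (cong (_+ cnt (T x)) (sym (cnt-suc (per-S f)))) (cnt-∨∧ (S f ∘ suc) (T x))) (both′ out-f out-x) r≤S r≤T 2r≡)

    -- By the two covers, a cycle vertex outside `f` has `x` in both adjacent edges. The crossing
    -- count bounds the number of such pairs of edges, which gives the converse: `S f` is determined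
    -- by `T x`.
    forced : ∀ i → S f (suc i) ≡ not (T x i ∧ T x (suc i))
    forced i with dec-true (S f (suc i))
    ... | inj₁ s = trans s (sym (not-intro λ t → not-elim (missed i t) s))
      where
      missed : (λ i → T x i ∧ T x (suc i)) ⊑ (λ i → not (S f (suc i)))
      missed = cnt-⊑⁻ (periodic-not (periodic-shift 1 (per-S f))) (periodic-∧ (per-T x) (periodic-shift 1 (per-T x)))
        (λ j h → inT j (not-elim h))
        (iso-lin₃ (cnt (S f)) (cnt (T² x)) (cnt (T x)) r l _ (cnt (λ i → not (S f (suc i))))
          (crossing-count out-f out-x) r≤S r≤T (T<T² out-f out-x r≤S (≤-trans (≤-trans (s≤s z≤n) 3≤r) r≤T)) 2r≡
          (trans (cong (cnt (T x) +_) (sym (cnt-suc (per-T x)))) (cnt-∨∧ (T x) (T x ∘ suc)))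
          (≤-trans (≤-reflexive (sym full)) (≤-trans (cnt-mono {λ _ → true} (λ j _ → either j))
            (≤-trans (cnt-∪ (S f ∘ suc) (λ i → not (S f (suc i)))) (≤-reflexive (cong (_+ cnt (λ i → not (S f (suc i)))) (cnt-suc (per-S f))))))))
        where
        full : cnt (λ _ → true) ≡ l
        full = trans (cnt≡ (λ _ → true)) (count-full {l} λ _ → refl)
        either : ∀ j → S f (suc j) ∨ not (S f (suc j)) ≡ true
        either j with S f (suc j)
        ... | true  = refl
        ... | false = refl
        inT : ∀ j → ¬ S f (suc j) ≡ true → T x j ∧ T x (suc j) ≡ true
        inT j ¬s with ∨-elim {S f (suc j)} (cover′ j) | ∨-elim {S f (suc j)} (cover (suc j))
        ... | inj₁ s | _ = ⊥-elim (¬s s)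
        ... | inj₂ _ | inj₁ s = ⊥-elim (¬s s)
        ... | inj₂ t | inj₂ t′ = ∧-intro t t′
    ... | inj₂ ¬s with ∨-elim {S f (suc i)} (cover′ i) | ∨-elim {S f (suc i)} (cover (suc i))
    ...   | inj₁ s | _ = ⊥-elim (true≢false s ¬s)
    ...   | inj₂ _ | inj₁ s = ⊥-elim (true≢false s ¬s)
    ...   | inj₂ t | inj₂ t′ = trans ¬s (sym (cong not (∧-intro t t′)))

    -- `f` holds more than half of the cycle vertices.
    consecutive : ∃ λ i → S f i ∧ S f (suc i) ≡ true
    consecutive = cnt-witness (λ i → S f i ∧ S f (suc i)) (iso-lin₄ (cnt (S f)) _ _ r l
      (trans (cong (cnt (S f) +_) (sym (cnt-suc (per-S f)))) (cnt-∨∧ (S f) (S f ∘ suc))) (cnt≤ _) r≤S 2r≡)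

module Isolated {n m r d l : ℕ} (D : Design n m r d) (K : Edges.LongestCycle D l) where
  open Edges D
  open Longest K
  open Swap D K

  -- Put `f` on the cycle in place of `e i`. If `x` lies in the freed edge, `one-outside` applies to
  -- the new cycle. Otherwise `T x` has not changed, and `forced` on both cycles gives `f` and `e i`
  -- the same vertices.
  isolated : n ≤ 1 + l → r + r ≡ 1 + l → r ≤ d → ∀ {f x} → OutY f → OutX x → (∀ y → OutY y → x ∉ᴱ y) → ⊥
  isolated n≤ 2r≡ r≤d {f} {x} out-f out-x alone = swap (Forced.consecutive D K out-f out-x 2r≡ r≤S r≤T)
    where
    r≤S : r ≤ cnt (S f)
    r≤S = size-inner n≤ out-x (alone f out-f)
    r≤T : r ≤ cnt (T x)
    r≤T = ≤-trans r≤d (subst (d ≤_) (+-identityʳ _) (deg-cover x [] λ y out x∈y → ⊥-elim (alone y out x∈y)))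
    swap : (∃ λ i → S f i ∧ S f (suc i) ≡ true) → ⊥
    swap (i , h) = decide (x ∈ᴱ? e i)
      where
      Si : S f i ≡ true
      Si = proj₁ (∧-elim h)
      Si⁺ : S f (suc i) ≡ true
      Si⁺ = proj₂ (∧-elim {S f i} h)
      K′ : LongestCycle l
      K′ = swapped out-f i Si Si⁺
      module L′ = Longest K′
      out-eᵢ : L′.OutY (e i)
      out-eᵢ = freed out-f i Si Si⁺
      decide : Dec (x ∈ᴱ e i) → ⊥
      decide (yes x∈eᵢ) = OneOutside.one-outside D K′ n≤ 2r≡ out-eᵢ out-x x∈eᵢ
        (iso-lin₅ d (cnt (L′.T x)) r (L′.deg-cover x (e i ∷ []) only) r≤d)
        where
        only : ∀ y → L′.OutY y → x ∈ᴱ y → y ∈ e i ∷ []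
        only y out x∈y with onY? y
        ... | inj₂ out-y = ⊥-elim (alone y out-y x∈y)
        ... | inj₁ (j , _ , refl) with e′-cases out-f i Si Si⁺ j
        ...   | inj₁ (eq , _) = here eq
        ...   | inj₂ (_ , eq) = ⊥-elim (out j (sym eq))
      decide (no x∉eᵢ) = out-f i (sym (⊆⇒≡ sub))
        where
        T≡ : ∀ j → L′.T x j ≡ T x j
        T≡ j with e′-cases out-f i Si Si⁺ j
        ... | inj₁ (a , b) = trans (cong (inc x) b) (trans (¬true⇒false (alone f out-f)) (sym (¬true⇒false (λ t → x∉eᵢ (subst (x ∈ᴱ_) a t)))))
        ... | inj₂ (_ , b) = cong (inc x) b
        r≤T′ : r ≤ cnt (L′.T x)
        r≤T′ = ≤-trans r≤T (cnt-mono (λ j t → trans (T≡ j) t))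
        same : ∀ j → S (e i) (suc j) ≡ S f (suc j)
        same j = trans (Forced.forced D K′ out-eᵢ out-x 2r≡ (size-inner n≤ out-x x∉eᵢ) r≤T′ j)
          (trans (cong₂ (λ a b → not (a ∧ b)) (T≡ j) (T≡ (suc j)))
            (sym (Forced.forced D K out-f out-x 2r≡ r≤S r≤T j)))
        sub : ∀ w → w ∈ᴱ e i → w ∈ᴱ f
        sub w w∈ with onX? w
        ... | inj₂ out-w = ⊥-elim (x∉eᵢ (subst (_∈ᴱ e i) (only-outside n≤ out-w out-x) w∈))
        ... | inj₁ (b , _ , refl) with pred-index b
        ...   | j , _ , eq , _ = subst (_∈ᴱ f) eq (trans (sym (same j)) (subst (_∈ᴱ e i) (sym eq) w∈))

-- Longest outer paths

module Parts {n m : ℕ} (inc : Fin n → Fin m → Bool) where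
  open Incidence inc

  xsOf : List Node → List (Fin n)
  xsOf []           = []
  xsOf (inj₁ x ∷ L) = x ∷ xsOf L
  xsOf (inj₂ y ∷ L) = xsOf L

  ysOf : List Node → List (Fin m)
  ysOf []           = []
  ysOf (inj₁ x ∷ L) = ysOf L
  ysOf (inj₂ y ∷ L) = y ∷ ysOf L

  length-parts : ∀ L → length L ≡ length (xsOf L) + length (ysOf L)
  length-parts []           = refl
  length-parts (inj₁ x ∷ L) = cong suc (length-parts L)
  length-parts (inj₂ y ∷ L) = trans (cong suc (length-parts L)) (sym (+-suc _ _))

  ∈-xsOf⁺ : ∀ {x} L → inj₁ x ∈ L → x ∈ xsOf L
  ∈-xsOf⁺ (inj₁ x ∷ L) (here refl) = here refl
  ∈-xsOf⁺ (inj₁ x ∷ L) (there p)   = there (∈-xsOf⁺ L p)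
  ∈-xsOf⁺ (inj₂ y ∷ L) (there p)   = ∈-xsOf⁺ L p

  ∈-xsOf⁻ : ∀ {x} L → x ∈ xsOf L → inj₁ x ∈ L
  ∈-xsOf⁻ (inj₁ x ∷ L) (here refl) = here refl
  ∈-xsOf⁻ (inj₁ x ∷ L) (there p)   = there (∈-xsOf⁻ L p)
  ∈-xsOf⁻ (inj₂ y ∷ L) p           = there (∈-xsOf⁻ L p)

  ∈-ysOf⁺ : ∀ {y} L → inj₂ y ∈ L → y ∈ ysOf L
  ∈-ysOf⁺ (inj₂ y ∷ L) (here refl) = here refl
  ∈-ysOf⁺ (inj₂ y ∷ L) (there p)   = there (∈-ysOf⁺ L p)
  ∈-ysOf⁺ (inj₁ x ∷ L) (there p)   = ∈-ysOf⁺ L p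

  ∈-ysOf⁻ : ∀ {y} L → y ∈ ysOf L → inj₂ y ∈ L
  ∈-ysOf⁻ (inj₂ y ∷ L) (here refl) = here refl
  ∈-ysOf⁻ (inj₂ y ∷ L) (there p)   = there (∈-ysOf⁻ L p)
  ∈-ysOf⁻ (inj₁ x ∷ L) p           = there (∈-ysOf⁻ L p)

  Unique-xsOf : ∀ {L} → Unique L → Unique (xsOf L)
  Unique-xsOf {[]} [] = []
  Unique-xsOf {inj₁ x ∷ L} (x∉ ∷ u) = All.tabulate (λ p eq → All.lookup x∉ (∈-xsOf⁻ L p) (cong inj₁ eq)) ∷ Unique-xsOf u
  Unique-xsOf {inj₂ y ∷ L} (_ ∷ u) = Unique-xsOf u

  Unique-ysOf : ∀ {L} → Unique L → Unique (ysOf L)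
  Unique-ysOf {[]} [] = []
  Unique-ysOf {inj₂ y ∷ L} (y∉ ∷ u) = All.tabulate (λ p eq → All.lookup y∉ (∈-ysOf⁻ L p) (cong inj₂ eq)) ∷ Unique-ysOf u
  Unique-ysOf {inj₁ x ∷ L} (_ ∷ u) = Unique-ysOf u

  mutual
    balance-YY : ∀ {y L y'} → Walk (inj₂ y) L (inj₂ y') → length (ysOf L) ≡ suc (length (xsOf L))
    balance-YY (single _) = refl
    balance-YY (_∷_ {w = inj₁ x} _ W) = cong suc (balance-XY W)
    balance-YY (_∷_ {w = inj₂ y} () W)

    balance-XY : ∀ {x L y'} → Walk (inj₁ x) L (inj₂ y') → length (ysOf L) ≡ length (xsOf L)
    balance-XY (_∷_ {w = inj₂ y} _ W) = balance-YY W
    balance-XY (_∷_ {w = inj₁ x} () W)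

abstract
  out-lin₁ : ∀ (P h t : ℕ) → P ≡ 1 + (h + h) → 1 + P < 1 + (t + t) → t ≤ h → ⊥
  out-lin₁ P h t h₁ h₂ h₃ = infeasible (P ∷ h ∷ t ∷ [])
    ((con 1 ⊕ (var 1 ⊕ var 1)) ⊕ ((con 1 ⊕ (con 1 ⊕ var 0)) ⊕ (var 2 ⊕ var 2)))
    (var 0 ⊕ ((con 1 ⊕ (var 2 ⊕ var 2)) ⊕ (var 1 ⊕ var 1)))
    (con 1) refl (+-mono-≤ (≤-reflexive (sym h₁)) (+-mono-≤ h₂ (+-mono-≤ h₃ h₃)))

  out-lin₂ : ∀ (P h t : ℕ) → P ≡ 1 + (h + h) → P < t + t → h < t
  out-lin₂ P h t h₁ h₂ = ≮⇒≥ λ neg → infeasible (P ∷ h ∷ t ∷ [])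
    ((con 1 ⊕ (var 1 ⊕ var 1)) ⊕ ((con 1 ⊕ var 0) ⊕ ((con 1 ⊕ var 2) ⊕ (con 1 ⊕ var 2))))
    (var 0 ⊕ ((var 2 ⊕ var 2) ⊕ ((con 1 ⊕ var 1) ⊕ (con 1 ⊕ var 1))))
    (con 1) refl (+-mono-≤ (≤-reflexive (sym h₁)) (+-mono-≤ h₂ (+-mono-≤ neg neg)))

  out-lin₃ : ∀ (k j h l : ℕ) → j + k ≡ l → h < k → h < j → (1 + h) + (1 + h) ≤ l
  out-lin₃ k j h l h₁ h₂ h₃ = ≮⇒≥ λ neg → infeasible (k ∷ j ∷ h ∷ l ∷ [])
    ((var 1 ⊕ var 0) ⊕ ((con 1 ⊕ var 2) ⊕ ((con 1 ⊕ var 2) ⊕ (con 1 ⊕ var 3))))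
    (var 3 ⊕ (var 0 ⊕ (var 1 ⊕ ((con 1 ⊕ var 2) ⊕ (con 1 ⊕ var 2)))))
    (con 0) refl (+-mono-≤ (≤-reflexive h₁) (+-mono-≤ h₂ (+-mono-≤ h₃ neg)))

  out-lin₄ : ∀ (T h d l : ℕ) → d ≤ T + (1 + h) → T ≡ 0 → (1 + h) + (1 + h) ≤ l → l < d + d → ⊥
  out-lin₄ T h d l h₁ h₂ h₃ h₄ = infeasible (T ∷ h ∷ d ∷ l ∷ [])
    (var 2 ⊕ (var 2 ⊕ (var 0 ⊕ (var 0 ⊕ (((con 1 ⊕ var 1) ⊕ (con 1 ⊕ var 1)) ⊕ (con 1 ⊕ var 3))))))
    ((var 0 ⊕ (con 1 ⊕ var 1)) ⊕ ((var 0 ⊕ (con 1 ⊕ var 1)) ⊕ (con 0 ⊕ (con 0 ⊕ (var 3 ⊕ (var 2 ⊕ var 2))))))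
    (con 0) refl (+-mono-≤ h₁ (+-mono-≤ h₁ (+-mono-≤ (≤-reflexive h₂) (+-mono-≤ (≤-reflexive h₂) (+-mono-≤ h₃ h₄)))))

  out-lin₅ : ∀ (t h i : ℕ) → t ≤ 1 + (h + h) → h < t → i + (1 + h) ≡ t → i ≤ h
  out-lin₅ t h i h₁ h₂ h₃ = ≮⇒≥ λ neg → infeasible (t ∷ h ∷ i ∷ [])
    (var 0 ⊕ ((var 2 ⊕ (con 1 ⊕ var 1)) ⊕ (con 1 ⊕ var 1)))
    ((con 1 ⊕ (var 1 ⊕ var 1)) ⊕ (var 0 ⊕ var 2))
    (con 0) refl (+-mono-≤ h₁ (+-mono-≤ (≤-reflexive h₃) neg))

  out-lin₆ : ∀ (T S W h l : ℕ) → T + W ≤ l → S + (1 + (h + h)) ≤ W → T + (S + (1 + (h + h))) ≤ l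
  out-lin₆ T S W h l h₁ h₂ = ≮⇒≥ λ neg → infeasible (T ∷ S ∷ W ∷ h ∷ l ∷ [])
    ((var 0 ⊕ var 2) ⊕ ((var 1 ⊕ (con 1 ⊕ (var 3 ⊕ var 3))) ⊕ (con 1 ⊕ var 4)))
    (var 4 ⊕ (var 2 ⊕ (var 0 ⊕ (var 1 ⊕ (con 1 ⊕ (var 3 ⊕ var 3))))))
    (con 0) refl (+-mono-≤ h₁ (+-mono-≤ h₂ neg))

  out-lin₇ : ∀ (T S h l d r z : ℕ) → T + (S + (1 + (h + h))) ≤ l → d ≤ T + (1 + h) → r ≤ S + (z + h) → r + d ≤ l + z
  out-lin₇ T S h l d r z h₁ h₂ h₃ = ≮⇒≥ λ neg → infeasible (T ∷ S ∷ h ∷ l ∷ d ∷ r ∷ z ∷ [])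
    ((var 0 ⊕ (var 1 ⊕ (con 1 ⊕ (var 2 ⊕ var 2)))) ⊕ (var 4 ⊕ (var 5 ⊕ (con 1 ⊕ (var 3 ⊕ var 6)))))
    (var 3 ⊕ ((var 0 ⊕ (con 1 ⊕ var 2)) ⊕ ((var 1 ⊕ (var 6 ⊕ var 2)) ⊕ (var 5 ⊕ var 4))))
    (con 0) refl (+-mono-≤ h₁ (+-mono-≤ h₂ (+-mono-≤ h₃ neg)))

  out-lin₈ : ∀ (r d l z n : ℕ) → r + d ≤ l + z → n ≤ r + r → l < d + d → 1 + n ≤ l + (z + z)
  out-lin₈ r d l z n h₁ h₂ h₃ = ≮⇒≥ λ neg → infeasible (r ∷ d ∷ l ∷ z ∷ n ∷ [])
    ((var 0 ⊕ var 1) ⊕ ((var 0 ⊕ var 1) ⊕ (var 4 ⊕ ((con 1 ⊕ var 2) ⊕ (con 1 ⊕ (var 2 ⊕ (var 3 ⊕ var 3)))))))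
    ((var 2 ⊕ var 3) ⊕ ((var 2 ⊕ var 3) ⊕ ((var 0 ⊕ var 0) ⊕ ((var 1 ⊕ var 1) ⊕ (con 1 ⊕ var 4)))))
    (con 0) refl (+-mono-≤ h₁ (+-mono-≤ h₁ (+-mono-≤ h₂ (+-mono-≤ h₃ neg))))

  out-lin₉ : ∀ (z l n : ℕ) → 1 + n ≤ l + (z + z) → l < n → 0 < z
  out-lin₉ z l n h₁ h₂ = ≮⇒≥ λ neg → infeasible (z ∷ l ∷ n ∷ [])
    ((con 1 ⊕ var 2) ⊕ ((con 1 ⊕ var 1) ⊕ ((con 1 ⊕ var 0) ⊕ (con 1 ⊕ var 0))))
    ((var 1 ⊕ (var 0 ⊕ var 0)) ⊕ (var 2 ⊕ ((con 1 ⊕ con 0) ⊕ (con 1 ⊕ con 0))))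
    (con 1) refl (+-mono-≤ h₁ (+-mono-≤ h₂ (+-mono-≤ neg neg)))

  out-lin₁₀ : ∀ (a b u i l n h : ℕ) → 1 + n ≤ l + (a + a) → 1 + n ≤ l + (b + b) → a + b ≡ u + i → u + (l + h) ≤ n → h < i
  out-lin₁₀ a b u i l n h h₁ h₂ h₃ h₄ = ≮⇒≥ λ neg → infeasible (a ∷ b ∷ u ∷ i ∷ l ∷ n ∷ h ∷ [])
    ((con 1 ⊕ var 5) ⊕ ((con 1 ⊕ var 5) ⊕ ((var 0 ⊕ var 1) ⊕ ((var 0 ⊕ var 1) ⊕ ((var 2 ⊕ (var 4 ⊕ var 6)) ⊕ ((var 2 ⊕ (var 4 ⊕ var 6)) ⊕ ((con 1 ⊕ var 3) ⊕ (con 1 ⊕ var 3))))))))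
    ((var 4 ⊕ (var 0 ⊕ var 0)) ⊕ ((var 4 ⊕ (var 1 ⊕ var 1)) ⊕ ((var 2 ⊕ var 3) ⊕ ((var 2 ⊕ var 3) ⊕ (var 5 ⊕ (var 5 ⊕ ((con 1 ⊕ var 6) ⊕ (con 1 ⊕ var 6))))))))
    (con 1) refl (+-mono-≤ h₁ (+-mono-≤ h₂ (+-mono-≤ (≤-reflexive h₃) (+-mono-≤ (≤-reflexive h₃) (+-mono-≤ h₄ (+-mono-≤ h₄ (+-mono-≤ neg neg)))))))

  out-lin₁₁ : ∀ (A B S W U h l d : ℕ) → A + B ≤ U → U + W ≤ l → S + (h + h) ≤ W → 2 ≤ S → d ≤ A + (1 + h) → d ≤ B + (1 + h) → l < d + d → ⊥
  out-lin₁₁ A B S W U h l d h₁ h₂ h₃ h₄ h₅ h₆ h₇ = infeasible (A ∷ B ∷ S ∷ W ∷ U ∷ h ∷ l ∷ d ∷ [])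
    ((var 0 ⊕ var 1) ⊕ ((var 4 ⊕ var 3) ⊕ ((var 2 ⊕ (var 5 ⊕ var 5)) ⊕ (con 2 ⊕ (var 7 ⊕ (var 7 ⊕ (con 1 ⊕ var 6)))))))
    (var 4 ⊕ (var 6 ⊕ (var 3 ⊕ (var 2 ⊕ ((var 0 ⊕ (con 1 ⊕ var 5)) ⊕ ((var 1 ⊕ (con 1 ⊕ var 5)) ⊕ (var 7 ⊕ var 7)))))))
    (con 0) refl (+-mono-≤ h₁ (+-mono-≤ h₂ (+-mono-≤ h₃ (+-mono-≤ h₄ (+-mono-≤ h₅ (+-mono-≤ h₆ h₇))))))

  out-lin₁₂ : ∀ (r d l n z : ℕ) → r + d ≤ l + z → z ≤ 1 → n ≤ r + r → l < d + d → l < n → n ≤ 1 + l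
  out-lin₁₂ r d l n z h₁ h₂ h₃ h₄ h₅ = ≮⇒≥ λ neg → infeasible (r ∷ d ∷ l ∷ n ∷ z ∷ [])
    ((var 0 ⊕ var 1) ⊕ ((var 0 ⊕ var 1) ⊕ (var 4 ⊕ (var 4 ⊕ (var 3 ⊕ ((con 1 ⊕ var 2) ⊕ (con 1 ⊕ (con 1 ⊕ var 2))))))))
    ((var 2 ⊕ var 4) ⊕ ((var 2 ⊕ var 4) ⊕ (con 1 ⊕ (con 1 ⊕ ((var 0 ⊕ var 0) ⊕ ((var 1 ⊕ var 1) ⊕ var 3))))))
    (con 0) refl (+-mono-≤ h₁ (+-mono-≤ h₁ (+-mono-≤ h₂ (+-mono-≤ h₂ (+-mono-≤ h₃ (+-mono-≤ h₄ neg))))))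

  out-lin₁₃ : ∀ (r d l n z : ℕ) → r + d ≤ l + z → z ≤ 1 → n ≤ r + r → l < d + d → l < n → r + r ≤ 1 + l
  out-lin₁₃ r d l n z h₁ h₂ h₃ h₄ h₅ = ≮⇒≥ λ neg → infeasible (r ∷ d ∷ l ∷ n ∷ z ∷ [])
    ((var 0 ⊕ var 1) ⊕ ((var 0 ⊕ var 1) ⊕ (var 4 ⊕ (var 4 ⊕ ((con 1 ⊕ var 2) ⊕ (con 1 ⊕ (con 1 ⊕ var 2)))))))
    ((var 2 ⊕ var 4) ⊕ ((var 2 ⊕ var 4) ⊕ (con 1 ⊕ (con 1 ⊕ ((var 1 ⊕ var 1) ⊕ (var 0 ⊕ var 0))))))
    (con 0) refl (+-mono-≤ h₁ (+-mono-≤ h₁ (+-mono-≤ h₂ (+-mono-≤ h₂ (+-mono-≤ h₄ neg)))))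

  out-lin₁₄ : ∀ (r l n : ℕ) → l < n → n ≤ r + r → 1 + l ≤ r + r
  out-lin₁₄ r l n h₁ h₂ = ≮⇒≥ λ neg → infeasible (r ∷ l ∷ n ∷ [])
    ((con 1 ⊕ var 1) ⊕ (var 2 ⊕ (con 1 ⊕ (var 0 ⊕ var 0))))
    (var 2 ⊕ ((var 0 ⊕ var 0) ⊕ (con 1 ⊕ var 1)))
    (con 0) refl (+-mono-≤ h₁ (+-mono-≤ h₂ neg))

  out-lin₁₅ : ∀ (r d l n z : ℕ) → r + d ≤ l + z → z ≤ 1 → n ≤ r + r → l < d + d → l < n → r ≤ d
  out-lin₁₅ r d l n z h₁ h₂ h₃ h₄ h₅ = ≮⇒≥ λ neg → infeasible (r ∷ d ∷ l ∷ n ∷ z ∷ [])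
    ((var 0 ⊕ var 1) ⊕ (var 4 ⊕ ((con 1 ⊕ var 2) ⊕ (con 1 ⊕ var 1))))
    ((var 2 ⊕ var 4) ⊕ (con 1 ⊕ ((var 1 ⊕ var 1) ⊕ var 0)))
    (con 0) refl (+-mono-≤ h₁ (+-mono-≤ h₂ (+-mono-≤ h₄ neg)))

  out-lin₁₆ : ∀ (s t w r d l : ℕ) → s + w ≤ l + 2 → t < w → r ≤ s → d ≤ t → r + d ≤ l + 1
  out-lin₁₆ s t w r d l h₁ h₂ h₃ h₄ = ≮⇒≥ λ neg → infeasible (s ∷ t ∷ w ∷ r ∷ d ∷ l ∷ [])
    ((var 0 ⊕ var 2) ⊕ ((con 1 ⊕ var 1) ⊕ (var 3 ⊕ (var 4 ⊕ (con 1 ⊕ (var 5 ⊕ con 1))))))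
    ((var 5 ⊕ con 2) ⊕ (var 2 ⊕ (var 0 ⊕ (var 1 ⊕ (var 3 ⊕ var 4)))))
    (con 0) refl (+-mono-≤ h₁ (+-mono-≤ h₂ (+-mono-≤ h₃ (+-mono-≤ h₄ neg))))

  out-lin₁₈ : ∀ (i h : ℕ) → h < i → i < 2 → h ≤ 0
  out-lin₁₈ i h h₁ h₂ = ≮⇒≥ λ neg → infeasible (i ∷ h ∷ [])
    ((con 1 ⊕ var 1) ⊕ ((con 1 ⊕ var 0) ⊕ (con 1 ⊕ con 0)))
    (var 0 ⊕ (con 2 ⊕ var 1))
    (con 0) refl (+-mono-≤ h₁ (+-mono-≤ h₂ neg))

  out-lin₁₉ : ∀ (c h r l n y : ℕ) → c + (c + y) ≤ l → h ≤ y → l + (1 + h) ≤ n → n ≤ r + r → r < c + (1 + h) → ⊥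
  out-lin₁₉ c h r l n y h₁ h₂ h₃ h₄ h₅ = infeasible (c ∷ h ∷ r ∷ l ∷ n ∷ y ∷ [])
    ((var 0 ⊕ (var 0 ⊕ var 5)) ⊕ (var 1 ⊕ ((var 3 ⊕ (con 1 ⊕ var 1)) ⊕ (var 4 ⊕ ((con 1 ⊕ var 2) ⊕ (con 1 ⊕ var 2))))))
    (var 3 ⊕ (var 5 ⊕ (var 4 ⊕ ((var 2 ⊕ var 2) ⊕ ((var 0 ⊕ (con 1 ⊕ var 1)) ⊕ (var 0 ⊕ (con 1 ⊕ var 1)))))))
    (con 0) refl (+-mono-≤ h₁ (+-mono-≤ h₂ (+-mono-≤ h₃ (+-mono-≤ h₄ (+-mono-≤ h₅ h₅)))))

  out-lin₂₀ : ∀ (s k h c r : ℕ) → r ≤ s + (k + 0) → k < h → s ≤ c → c + h ≤ r → ⊥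
  out-lin₂₀ s k h c r h₁ h₂ h₃ h₄ = infeasible (s ∷ k ∷ h ∷ c ∷ r ∷ [])
    (var 4 ⊕ ((con 1 ⊕ var 1) ⊕ (var 0 ⊕ (var 3 ⊕ var 2))))
    ((var 0 ⊕ (var 1 ⊕ con 0)) ⊕ (var 2 ⊕ (var 3 ⊕ var 4)))
    (con 0) refl (+-mono-≤ h₁ (+-mono-≤ h₂ (+-mono-≤ h₃ h₄)))

  out-lin₂₂ : ∀ (P Q h k : ℕ) → P ≡ 1 + (h + h) → Q ≡ 1 + (k + k) → P < Q → h < k
  out-lin₂₂ P Q h k h₁ h₂ h₃ = ≮⇒≥ λ neg → infeasible (P ∷ Q ∷ h ∷ k ∷ [])
    ((con 1 ⊕ (var 2 ⊕ var 2)) ⊕ (var 1 ⊕ ((con 1 ⊕ var 0) ⊕ ((con 1 ⊕ var 3) ⊕ (con 1 ⊕ var 3)))))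
    (var 0 ⊕ ((con 1 ⊕ (var 3 ⊕ var 3)) ⊕ (var 1 ⊕ ((con 1 ⊕ var 2) ⊕ (con 1 ⊕ var 2)))))
    (con 0) refl (+-mono-≤ (≤-reflexive (sym h₁)) (+-mono-≤ (≤-reflexive h₂) (+-mono-≤ h₃ (+-mono-≤ neg neg))))

  out-lin₂₃ : ∀ (n k h j : ℕ) → n < (1 + k) + h → h < j → n < k + j
  out-lin₂₃ n k h j h₁ h₂ = ≮⇒≥ λ neg → infeasible (n ∷ k ∷ h ∷ j ∷ [])
    ((con 1 ⊕ var 0) ⊕ ((con 1 ⊕ var 2) ⊕ (con 1 ⊕ (var 1 ⊕ var 3))))
    (((con 1 ⊕ var 1) ⊕ var 2) ⊕ (var 3 ⊕ (con 1 ⊕ var 0)))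
    (con 0) refl (+-mono-≤ h₁ (+-mono-≤ h₂ neg))

  out-lin₁₇ : ∀ (t h i : ℕ) → t ≤ h + h → i + h ≡ t → i ≤ h
  out-lin₁₇ t h i h₁ h₂ = ≮⇒≥ λ neg → infeasible (t ∷ h ∷ i ∷ [])
    (var 0 ⊕ ((var 2 ⊕ var 1) ⊕ (con 1 ⊕ var 1)))
    ((var 1 ⊕ var 1) ⊕ (var 0 ⊕ var 2))
    (con 0) refl (+-mono-≤ h₁ (+-mono-≤ (≤-reflexive h₂) neg))

module OuterPaths {n m r d l : ℕ} (D : Design n m r d) (K : Edges.LongestCycle D l) where
  open Edges D
  open Longest K
  open Reinsertion D K
  open Attachment D K
  open Parts inc

  module MaxPath {f P g} (path : OuterPath (inj₂ f) P (inj₂ g))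
                 (maxP : ∀ {a Q b} → OuterPath (inj₂ a) Q (inj₂ b) → length Q ≤ length P) where

    h : ℕ
    h = length (xsOf P)

    length-P : length P ≡ 1 + (h + h)
    length-P = trans (length-parts P) (trans (cong (h +_) (balance-YY (OuterPath.walk path))) (+-suc h h))

    -- `P` read in either direction. Keeping the same nodes, both readings agree on which vertices
    -- are off the path, so every estimate can be applied at either end.
    record End (a b : Fin m) (Q : List Node) : Set where
      constructor end
      field
        epath : OuterPath (inj₂ a) Q (inj₂ b)
        len   : length Q ≡ length P
        to    : ∀ {u} → u ∈ Q → u ∈ P
        from  : ∀ {u} → u ∈ P → u ∈ Q

    open End

    forward : End f g P
    forward = end path refl id id

    reverseEnd : ∀ {a b Q} → End a b Q → End b a (reverse Q)
    reverseEnd {Q = Q} E = end (reversePath (epath E)) (trans (length-reverse Q) (len E))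
      (to E ∘ ∈-reverse⁻ Q) (∈-resp-↭ (↭-sym (↭-reverse Q)) ∘ from E)

    L : List (Fin n)
    L = applyUpTo v l ++ xsOf P

    off : Fin n → Bool
    off x = not (does (_∈?_ Fin._≟_ x L))

    off-elim : ∀ {x} → off x ≡ true → OutX x × ¬ inj₁ x ∈ P
    off-elim {x} o with _∈?_ Fin._≟_ x L
    ... | no x∉ = out , λ x∈P → x∉ (∈-++⁺ʳ (applyUpTo v l) (∈-xsOf⁺ P x∈P))
      where
      out : OutX x
      out i eq = let j , j<l , vi≡vj = reduce v per-v i in
        x∉ (∈-++⁺ˡ (subst (_∈ applyUpTo v l) (sym (trans eq vi≡vj)) (∈-applyUpTo⁺ v j<l)))

    off-intro : ∀ {x} → OutX x → ¬ inj₁ x ∈ P → off x ≡ true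
    off-intro {x} out x∉P with _∈?_ Fin._≟_ x L
    ... | no _ = refl
    ... | yes x∈ with ∈-++⁻ (applyUpTo v l) x∈
    ...   | inj₂ x∈xs = contradiction (∈-xsOf⁻ P x∈xs) x∉P
    ...   | inj₁ x∈vs = let i , _ , eq = ∈-applyUpTo⁻ v x∈vs in contradiction eq (out i)

    length-L : length L ≡ l + h
    length-L = trans (length-++ (applyUpTo v l)) (cong (_+ h) (length-applyUpTo v l))

    Unique-L : Unique L
    Unique-L = Unique.++⁺
      (Unique.applyUpTo⁺₁ v l λ {i} {j} i<j j<l eq → inj-v i (j ∸ i) (m<n⇒0<n∸m i<j) (≤-<-trans (m∸n≤m j i) j<l)
        (trans eq (cong v (sym (m∸n+n≡m (<⇒≤ i<j))))))
      (Unique-xsOf (OuterPath.uniq path))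
      λ { (p , q) → let i , _ , eq = ∈-applyUpTo⁻ v p in outX⁻ (OuterPath.out path (∈-xsOf⁻ P q)) i eq }

    -- For an end `a` of `P`, these are the vertices by which the path could be prolonged.
    Z : Fin m → Fin n → Bool
    Z a x = inc x a ∧ off x

    Z∈ : ∀ {a x} → Z a x ≡ true → x ∈ᴱ a
    Z∈ z = proj₁ (∧-elim z)

    Z-out : ∀ {a x} → Z a x ≡ true → OutX x
    Z-out {a} {x} z = proj₁ (off-elim (proj₂ (∧-elim {inc x a} z)))

    Z∉P : ∀ {a x} → Z a x ≡ true → ¬ inj₁ x ∈ P
    Z∉P {a} {x} z = proj₂ (off-elim (proj₂ (∧-elim {inc x a} z)))

    count-off : ∀ (A : Fin n → Bool) → A ⊑ off → count A + (l + h) ≤ n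
    count-off A A⊑off = ≤-trans (≤-reflexive (cong (count A +_) (sym length-L)))
      (≤-trans (count-pack (λ _ → true) A Unique-L (λ _ _ → refl) (λ _ → refl) (λ {x} x∈L Ax → L#off x∈L (A⊑off x Ax)))
               (count≤ {n} (λ _ → true)))
      where
      L#off : ∀ {x} → x ∈ L → ¬ off x ≡ true
      L#off {x} x∈L o with _∈?_ Fin._≟_ x L
      ... | no x∉L = x∉L x∈L

    size-bound : ∀ a → r ≤ cnt (S a) + (count (Z a) + h)
    size-bound a = size-cover a (Z a) (xsOf P) λ x out x∈a → place x out x∈a (_∈?_ Fin._≟_ x (xsOf P))
      where
      place : ∀ x → OutX x → x ∈ᴱ a → Dec (x ∈ xsOf P) → Z a x ≡ true ⊎ x ∈ xsOf P
      place x out x∈a (yes p) = inj₂ p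
      place x out x∈a (no ¬p) = inj₁ (∧-intro x∈a (off-intro out (¬p ∘ ∈-xsOf⁺ P)))

    end-out : ∀ {a b Q} → End a b Q → OutY a
    end-out E = outY⁻ (OuterPath.out (epath E) (head∈ (OuterPath.walk (epath E))))

    cons-end : ∀ {a b Q z} → End a b Q → Z a z ≡ true → OuterPath (inj₁ z) (inj₁ z ∷ Q) (inj₂ b)
    cons-end E z = consPath (outsideX (Z-out z)) (Z∈ z) (Z∉P z ∘ to E) (epath E)

    -- Otherwise `y` and `z` could be put in front of the path, making it longer by two nodes.
    closed : ∀ {a b Q z} → End a b Q → Z a z ≡ true → ∀ y → OutY y → z ∈ᴱ y → y ∈ ysOf P
    closed {Q = Q} E z y out-y z∈y with any? (inj₂ y ≟ᴺ_) P
    ... | yes y∈P = ∈-ysOf⁺ P y∈P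
    ... | no y∉P = contradiction
      (maxP (consPath (outsideY out-y) z∈y (λ { (here ()) ; (there y∈Q) → y∉P (to E y∈Q) }) (cons-end E z)))
      (<⇒≱ (s≤s (subst (_≤ suc (length Q)) (len E) (n≤1+n _))))

    deg-bound : ∀ {a b Q z} → End a b Q → Z a z ≡ true → d ≤ cnt (T z) + (1 + h)
    deg-bound {z = z} E hz = subst (λ t → d ≤ cnt (T z) + t) (balance-YY (OuterPath.walk path))
      (deg-cover z (ysOf P) (closed E hz))

    -- The path from `z` to `b` has `2 h + 2` nodes, but only `2 t` nodes lie between `e j` and
    -- `v (suc t + j)`.
    T→S : ∀ {a b Q z} → End a b Q → Z a z ≡ true → ∀ j t → t ≤ h → T z j ≡ true → S b (suc t + j) ≡ true → ⊥
    T→S {b = b} {Q} E hz j t t≤h Tj Sj = out-lin₁ (length Q) h t (trans (len E) length-P)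
      (subst (λ s → suc (length Q) < suc s) (double≡ t) (arc-bound (cons-end E hz) (suc (double j)) (suc (double t)) (X~e j Tj)
        (subst (λ s → inj₂ b ~ c s) pos (Y~v (suc t + j) Sj)) (s≤s z≤n))) t≤h
      where
      pos : double (suc t + j) ≡ suc (double t) + suc (double j)
      pos = cong suc (trans (cong suc (double-+ t j)) (sym (+-suc (double t) (double j))))

    S→T : ∀ {a b Q z} → End a b Q → Z a z ≡ true → ∀ i t → t ≤ h → S b i ≡ true → T z (t + i) ≡ true → ⊥
    S→T {Q = Q} {z} E hz i t t≤h Si Ti = out-lin₁ (length Q) h t (trans (len E) length-P)
      (subst₂ (λ s s' → s' < suc s) (double≡ t) (length-reverse (inj₁ z ∷ Q))
        (arc-bound (reversePath (cons-end E hz)) (double i) (suc (double t)) (Y~v i Si)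
          (subst (λ s → inj₁ z ~ c (suc s)) (double-+ t i) (X~e (t + i) Ti)) (s≤s z≤n))) t≤h

    S→S : ∀ {a b Q} → End a b Q → ∀ i t → 0 < t → S a i ≡ true → S b (t + i) ≡ true → h < t
    S→S {b = b} {Q} E i (suc t) 0<t Sa Sb = out-lin₂ (length Q) h (suc t) (trans (len E) length-P)
      (subst (length Q <_) (double≡ (suc t)) (arc-bound (epath E) (double i) (double (suc t)) (Y~v i Sa)
        (subst (λ s → inj₂ b ~ c s) (double-+ (suc t) i) (Y~v (suc t + i) Sb)) (s≤s z≤n)))

    -- As `S a` has two elements, `a` and `b` attach at distinct positions. These split C into two
    -- arcs, each of more than `h` steps by `S→S`.
    far : ∀ {a b Q} → End a b Q → (1 + h) + (1 + h) ≤ l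
    far {a} {b} E = start (cnt-witness₂ (S a) (2≤S (end-out E))) (cnt-witness (S b) (≤-trans (s≤s z≤n) (2≤S (end-out (reverseEnd E)))))
      where
      around : ∀ {A : ℕ → Bool} → Periodic A → ∀ i k → k < l → A i ≡ true → A ((l ∸ k) + (k + i)) ≡ true
      around {A} pA i k k<l Ai = trans (cong A (trans (sym (+-assoc (l ∸ k) k i)) (cong (_+ i) (m∸n+n≡m (<⇒≤ k<l))))) (trans (pA i) Ai)
      start : (∃ λ i → ∃ λ k → 0 < k × k < l × S a i ≡ true × S a (k + i) ≡ true) → (∃ λ j → S b j ≡ true) → (1 + h) + (1 + h) ≤ l
      start (i , k , 0<k , k<l , Si , Ski) (j , Sj) with offset i j
      ... | zero , _ , q , q' , eq = out-lin₃ k (l ∸ k) h l (m∸n+n≡m (<⇒≤ k<l))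
        (S→S (reverseEnd E) i k 0<k Sb Ski)
        (S→S E (k + i) (l ∸ k) (m<n⇒0<n∸m k<l) Ski (around (per-S b) i k k<l Sb))
        where
        Sb : S b i ≡ true
        Sb = trans (sym (transfer (S b) (per-S b) q q' eq)) Sj
      ... | suc k' , k'<l , q , q' , eq = out-lin₃ (suc k') (l ∸ suc k') h l (m∸n+n≡m (<⇒≤ k'<l))
        (S→S E i (suc k') (s≤s z≤n) Si Sb)
        (S→S (reverseEnd E) (suc k' + i) (l ∸ suc k') (m<n⇒0<n∸m k'<l) Sb (around (per-S a) i (suc k') k'<l Si))
        where
        Sb : S b (suc k' + i) ≡ true
        Sb = trans (sym (transfer (S b) (per-S b) q q' eq)) Sj

    -- Otherwise all edges through `z` are among the `h + 1` edges of `P`; then `d ≤ 1 + h`, and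
    -- `far` gives `2 d ≤ l`.
    T-nonempty : ∀ {a b Q z} → End a b Q → Z a z ≡ true → 0 < cnt (T z)
    T-nonempty {z = z} E hz = n≢0⇒n>0 λ eq → out-lin₄ (cnt (T z)) h d l (deg-bound E hz) eq (far E) l<2d

    -- Together, `S→T` and `T→S` keep `b` off the `h + 1` cycle vertices on either side of
    -- `e (suc h + j)`, a window of `2 h + 2` positions.
    clash : ∀ {a b Q z} → End a b Q → Z a z ≡ true → ∀ j t → t ≤ 1 + (h + h) →
      T z (suc h + j) ≡ true → S b (suc (t + j)) ≡ true → ⊥
    clash {b = b} {z = z} E hz j t t≤ Tj Sj with t ≤? h
    ... | yes t≤h = S→T E hz (suc (t + j)) (h ∸ t) (m∸n≤m h t) Sj
      (subst (λ s → T z s ≡ true) (sym (trans (+-suc (h ∸ t) (t + j))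
        (cong suc (trans (sym (+-assoc (h ∸ t) t j)) (cong (_+ j) (m∸n+n≡m t≤h)))))) Tj)
    ... | no t≰h = T→S E hz (suc h + j) (t ∸ suc h) (out-lin₅ t h (t ∸ suc h) t≤ (≰⇒> t≰h) (m∸n+n≡m (≰⇒> t≰h))) Tj
      (subst (λ s → S b (suc s) ≡ true) (sym (trans (sym (+-assoc (t ∸ suc h) (suc h) j)) (cong (_+ j) (m∸n+n≡m (≰⇒> t≰h))))) Sj)

    -- The window around `e (h + j)`, shortened to the `2 h + 1` positions that also lie in the
    -- window of `e (suc h + j)`, so that both can be used at once.
    clash′ : ∀ {a b Q z} → End a b Q → Z a z ≡ true → ∀ j t → t ≤ h + h →
      T z (h + j) ≡ true → S b (suc (t + j)) ≡ true → ⊥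
    clash′ {b = b} {z = z} E hz j t t≤ Tj Sj with suc t ≤? h
    ... | yes t<h = S→T E hz (suc (t + j)) (h ∸ suc t) (m∸n≤m h (suc t)) Sj
      (subst (λ s → T z s ≡ true) (sym (trans (sym (+-assoc (h ∸ suc t) (suc t) j)) (cong (_+ j) (m∸n+n≡m t<h)))) Tj)
    ... | no t≮h = T→S E hz (h + j) (t ∸ h) (out-lin₁₇ t h (t ∸ h) t≤ (m∸n+n≡m (≮⇒≥ t≮h))) Tj
      (subst (λ s → S b (suc s) ≡ true) (sym (trans (sym (+-assoc (t ∸ h) h j)) (cong (_+ j) (m∸n+n≡m (≮⇒≥ t≮h))))) Sj)

    dilate : ∀ b j a → S b a ≡ true → ∀ i → ¬ dil j (S b ∘ suc) i ≡ true → cnt (S b) + j ≤ cnt (dil j (S b ∘ suc))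
    dilate b j a Sa i ¬d = subst (λ t → t + j ≤ cnt (dil j (S b ∘ suc))) (cnt-suc (per-S b))
      (cnt-dil (periodic-shift 1 (per-S b)) j (l ∸ 1 + a) i
        (trans (cong (S b) (cong (_+ a) (m+[n∸m]≡n 0<l))) (trans (per-S b a) Sa)) (¬true⇒false ¬d))

    some-S : ∀ {a b Q} → End a b Q → ∃ λ i → S a i ≡ true
    some-S {a} E = cnt-witness (S a) (≤-trans (s≤s z≤n) (2≤S (end-out E)))

    -- Shifted to the start of its windows, `T z` is disjoint from the dilation of `S b` by the
    -- window, and this dilation adds `2 h + 1` positions.
    YX-count : ∀ {a b Q z} → End a b Q → Z a z ≡ true → cnt (T z) + (cnt (S b) + (1 + (h + h))) ≤ l
    YX-count {b = b} {z = z} E hz = out-lin₆ (cnt (T z)) (cnt (S b)) (cnt W) h l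
      (subst (λ t → t + cnt W ≤ l) (cnt-shift (suc h) (per-T z)) (cnt-disjoint-l A W disj))
      (grow (cnt-witness A (subst (0 <_) (sym (cnt-shift (suc h) (per-T z))) (T-nonempty E hz))) (some-S (reverseEnd E)))
      where
      A W : ℕ → Bool
      A j = T z (suc h + j)
      W = dil (1 + (h + h)) (S b ∘ suc)
      disj : ∀ j → A j ≡ true → W j ≡ true → ⊥
      disj j Aj Wj with dil-elim {S b ∘ suc} (1 + (h + h)) j Wj
      ... | t , t≤ , St = clash E hz j t t≤ Aj St
      grow : (∃ λ i → A i ≡ true) → (∃ λ i → S b i ≡ true) → cnt (S b) + (1 + (h + h)) ≤ cnt W
      grow (i , Ai) (a , Sa) = dilate b (1 + (h + h)) a Sa i (disj i Ai)

    -- The nodes of `P` cost `h` in the size bound and `h + 1` in the degree bound, exactly what the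
    -- windows gain.
    YX-bound : ∀ {a b Q z} → End a b Q → Z a z ≡ true → r + d ≤ l + count (Z b)
    YX-bound {b = b} {z = z} E hz = out-lin₇ (cnt (T z)) (cnt (S b)) h l d r (count (Z b)) (YX-count E hz) (deg-bound E hz) (size-bound b)

    -- `T z` and `T z'` may overlap, but `same-vertex` makes them disjoint after a relative shift by
    -- one. Both then avoid the dilation of `S a` by `2 h`, and `cnt (S a) ≥ 2` supplies what is
    -- missing for `2 d ≤ l`.
    two-outside : ∀ {a b Q z z'} → End a b Q → z ≢ z' → Z a z ≡ true → Z a z' ≡ true → Z b z ≡ true → Z b z' ≡ true → ⊥
    two-outside {a} {b} {z = z} {z'} E z≢z' az az' bz bz' = out-lin₁₁ (cnt (T z)) (cnt (T z')) (cnt (S a)) (cnt W) (cnt U) h l d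
      (subst₂ (λ s t → s + t ≤ cnt U) (cnt-shift (suc h) (per-T z)) (cnt-shift h (per-T z')) (cnt-disjoint A B A#B))
      (cnt-disjoint-l U W U#W)
      (grow (cnt-witness A (subst (0 <_) (sym (cnt-shift (suc h) (per-T z))) (T-nonempty E az))) (some-S E))
      (2≤S (end-out E)) (deg-bound E az) (deg-bound E az') l<2d
      where
      A B U W : ℕ → Bool
      A j = T z (suc h + j)
      B j = T z' (h + j)
      U j = A j ∨ B j
      W = dil (h + h) (S a ∘ suc)
      A#B : ∀ j → A j ≡ true → B j ≡ true → ⊥
      A#B j Aj Bj = z≢z' (sym (same-vertex (end-out E) (h + j) (Z-out az') (Z-out az) (Z∈ az') (Z∈ az) Bj Aj))
      U#W : ∀ j → U j ≡ true → W j ≡ true → ⊥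
      U#W j Uj Wj with dil-elim {S a ∘ suc} (h + h) j Wj | ∨-elim {A j} Uj
      ... | t , t≤ , St | inj₁ Aj = clash (reverseEnd E) bz j t (m≤n⇒m≤1+n t≤) Aj St
      ... | t , t≤ , St | inj₂ Bj = clash′ (reverseEnd E) bz' j t t≤ Bj St
      grow : (∃ λ i → A i ≡ true) → (∃ λ i → S a i ≡ true) → cnt (S a) + (h + h) ≤ cnt W
      grow (i , Ai) (s , Ss) = dilate a (h + h) s Ss i (U#W i (∨-introˡ Ai))

    n-bound : l + h ≤ n
    n-bound = subst (λ t → t + (l + h) ≤ n) (count-empty {n} {λ _ → false} λ _ ()) (count-off (λ _ → false) (λ _ ()))

    trivial : ∀ {a Q b} → Walk a Q b → length Q ≡ 1 → a ≡ b
    trivial (single _) _ = refl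
    trivial (_ ∷ single _) ()
    trivial (_ ∷ (_ ∷ _)) ()

    -- `YX-bound` at one end produces an outer neighbour at the other, so the bound holds at both.
    -- Adding the two yields more than `h` common neighbours off `P`: either two of them, or `h = 0`
    -- and a single edge with one outer vertex.
    no-outer-neighbour : ∀ {a b Q z} → End a b Q → Z a z ≡ true → ⊥
    no-outer-neighbour {a} {b} {Q} {z} E az = second (count-witness (Z b) (out-lin₉ (count (Z b)) l n bound-b l<n))
      where
      bound-b : 1 + n ≤ l + (count (Z b) + count (Z b))
      bound-b = out-lin₈ r d l (count (Z b)) n (YX-bound E az) n≤2r l<2d
      common : ℕ
      common = count (λ x → Z a x ∧ Z b x)
      lonely : h ≤ 0 → common < 2 → ⊥
      -- Now `r + d ≤ l + 1`; with `l < n ≤ 2 r` and `l < 2 d` this forces `n = 2 r = l + 1` and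
      -- `r ≤ d`.
      lonely h≤0 c<2 = OneOutside.one-outside D K
        (out-lin₁₂ r d l n (count (Z b)) (YX-bound E az) z≤1 n≤2r l<2d l<n)
        (≤-antisym (out-lin₁₃ r d l n (count (Z b)) (YX-bound E az) z≤1 n≤2r l<2d l<n) (out-lin₁₄ r l n l<n n≤2r))
        (end-out E) (Z-out az) (Z∈ az)
        (≤-trans (out-lin₁₅ r d l n (count (Z b)) (YX-bound E az) z≤1 n≤2r l<2d l<n)
          (subst (d ≤_) (trans (cong (λ t → cnt (T z) + (1 + t)) h≡0) (+-comm (cnt (T z)) 1)) (deg-bound E az)))
        where
        h≡0 : h ≡ 0
        h≡0 = n≤0⇒n≡0 h≤0
        a≡b : a ≡ b
        a≡b = Sum.inj₂-injective (trivial (OuterPath.walk (epath E)) (trans (len E) (trans length-P (cong (λ t → 1 + (t + t)) h≡0))))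
        z≤1 : count (Z b) ≤ 1
        z≤1 = ≤-trans (count-mono (λ x bx → ∧-intro (subst (λ y → Z y x ≡ true) (sym a≡b) bx) bx)) (s≤s⁻¹ c<2)
      finish : h < common → Dec (2 ≤ common) → ⊥
      finish h<c (yes 2≤c) = pair (count-witness₂ (λ x → Z a x ∧ Z b x) 2≤c)
        where
        pair : (∃ λ x → ∃ λ y → x ≢ y × Z a x ∧ Z b x ≡ true × Z a y ∧ Z b y ≡ true) → ⊥
        pair (x , y , x≢y , hx , hy) = two-outside E x≢y (proj₁ (∧-elim hx)) (proj₁ (∧-elim hy))
          (proj₂ (∧-elim {Z a x} hx)) (proj₂ (∧-elim {Z a y} hy))
      finish h<c (no c≱2) = lonely (out-lin₁₈ common h h<c (≰⇒> c≱2)) (≰⇒> c≱2)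
      off-∨ : (λ x → Z a x ∨ Z b x) ⊑ off
      off-∨ x hx with ∨-elim {Z a x} hx
      ... | inj₁ t = proj₂ (∧-elim {inc x a} t)
      ... | inj₂ t = proj₂ (∧-elim {inc x b} t)
      second : (∃ λ z' → Z b z' ≡ true) → ⊥
      second (z' , bz') = finish
        (out-lin₁₀ (count (Z a)) (count (Z b)) (count (λ x → Z a x ∨ Z b x)) common l n h
          (out-lin₈ r d l (count (Z a)) n (YX-bound (reverseEnd E) bz') n≤2r l<2d) bound-b
          (count-∨∧ (Z a) (Z b)) (count-off _ off-∨))
        (2 ≤? common)

    module _ (noZf : ∀ x → ¬ Z f x ≡ true) (noZg : ∀ x → ¬ Z g x ≡ true) where

      open Gaps l 0<l using (gap-absurd; cnt-translates)

      size-end : ∀ {a} → (∀ x → ¬ Z a x ≡ true) → r ≤ cnt (S a) + h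
      size-end {a} noZ = subst (λ t → r ≤ cnt (S a) + (t + h)) (count-empty noZ) (size-bound a)

      apart : ∀ {a b Q} → End a b Q → ∀ i t → 0 < t → t ≤ h → S a i ≡ true → S b (t + i) ≡ true → ⊥
      apart E i t 0<t t≤h Sa Sb = <⇒≱ (S→S E i t 0<t Sa Sb) t≤h

      Sf⊑Sg : 1 ≤ h → S f ⊑ S g
      Sf⊑Sg 1≤h = gap-absurd (per-S f) (per-S g) h 1≤h (apart forward) (apart (reverseEnd forward))
        (size-end noZf) (size-end noZg) n-bound n≤2r (≤-trans (s≤s z≤n) (2≤S (end-out (reverseEnd forward))))

      Sg⊑Sf : 1 ≤ h → S g ⊑ S f
      Sg⊑Sf 1≤h = gap-absurd (per-S g) (per-S f) h 1≤h (apart (reverseEnd forward)) (apart forward)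
        (size-end noZg) (size-end noZf) n-bound n≤2r (≤-trans (s≤s z≤n) (2≤S (end-out forward)))

      -- As `S f` lies in `S g`, its own elements are more than `h` apart, so `suc h` disjoint
      -- translates fit into `l`. With `l + h ≤ n ≤ 2 r` this leaves no room for
      -- `r < cnt (S f) + h`.
      few : 1 ≤ h → cnt (S f) + h ≤ r
      few 1≤h = ≮⇒≥ (many h refl)
        where
        translates : suc h * cnt (S f) ≤ l
        translates = ≤-trans (cnt-translates (per-S f) h (λ i t 0<t t≤h Si Sti → apart forward i t 0<t t≤h Si (Sf⊑Sg 1≤h (t + i) Sti)) h ≤-refl) (cnt≤ _)
        many : ∀ k → k ≡ h → ¬ r < cnt (S f) + k
        many zero eq _ = contradiction 1≤h (subst (λ t → ¬ 1 ≤ t) eq (λ ()))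
        many (suc k) eq r< = out-lin₁₉ (cnt (S f)) k r l n (k * cnt (S f))
          (subst (λ t → suc t * cnt (S f) ≤ l) (sym eq) translates)
          (subst (_≤ k * cnt (S f)) (*-identityʳ k) (*-monoʳ-≤ k (≤-trans (s≤s z≤n) (2≤S (end-out forward)))))
          (subst (λ t → l + t ≤ n) (sym eq) n-bound) n≤2r r<

      -- `g` has at most `r - h` vertices on C and none outside C and `P`; to reach `r` it needs all
      -- `h` vertices of `P`.
      path∈g : 1 ≤ h → ∀ x → inj₁ x ∈ P → x ∈ᴱ g
      path∈g 1≤h x x∈P with x ∈ᴱ? g
      ... | yes x∈g = x∈g
      ... | no x∉g = ⊥-elim (out-lin₂₀ (cnt (S g)) (count g∩P) h (cnt (S f)) r
        (size-cover g g∩P [] λ w out w∈g → inj₁ (∧-intro w∈g (on-P w out w∈g)))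
        (<-≤-trans (count-strict {f = g∩P} {inP} (λ w e → proj₂ (∧-elim {inc w g} e)) x (inP-intro x (∈-xsOf⁺ P x∈P)) (λ e → x∉g (proj₁ (∧-elim e))))
          (≤-trans (count-cover inP (λ _ → false) (xsOf P) (λ w e → inj₂ (inP-elim w e)))
            (≤-reflexive (cong (_+ h) (count-empty {n} {λ _ → false} λ _ ())))))
        (cnt-mono (Sg⊑Sf 1≤h)) (few 1≤h))
        where
        inP g∩P : Fin n → Bool
        inP w = does (_∈?_ Fin._≟_ w (xsOf P))
        g∩P w = inc w g ∧ inP w
        inP-intro : ∀ w → w ∈ xsOf P → inP w ≡ true
        inP-intro w w∈ with _∈?_ Fin._≟_ w (xsOf P)
        ... | yes _ = refl
        ... | no w∉ = contradiction w∈ w∉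
        inP-elim : ∀ w → inP w ≡ true → w ∈ xsOf P
        inP-elim w e with _∈?_ Fin._≟_ w (xsOf P)
        ... | yes w∈ = w∈
        on-P : ∀ w → OutX w → w ∈ᴱ g → inP w ≡ true
        on-P w out w∈g with dec-true (inP w)
        ... | inj₁ e = e
        ... | inj₂ e = ⊥-elim (noZg w (∧-intro w∈g (off-intro out λ w∈P → true≢false (inP-intro w (∈-xsOf⁺ P w∈P)) e)))

      f⊆g : 1 ≤ h → ∀ w → w ∈ᴱ f → w ∈ᴱ g
      f⊆g 1≤h w w∈f with onX? w
      ... | inj₁ (i , _ , refl) = Sf⊑Sg 1≤h i w∈f
      ... | inj₂ out with any? (inj₁ w ≟ᴺ_) P
      ...   | yes w∈P = path∈g 1≤h w w∈P
      ...   | no w∉P = ⊥-elim (noZf w (∧-intro w∈f (off-intro out w∉P)))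

      simple : ∀ {a Q b} → Walk a Q b → Unique Q → a ≡ b → length Q ≡ 1
      simple (single _) _ _ = refl
      simple (_ ∷ W) (a∉ ∷ _) refl = contradiction refl (All.lookup a∉ (last∈ W))

      -- The two ends are the same edge, and a path with distinct nodes and equal ends has only one
      -- node.
      no-long-path : 1 ≤ h → ⊥
      no-long-path 1≤h = <⇒≢ 1≤h (sym (0-half (suc-injective (trans (sym length-P)
          (simple (OuterPath.walk path) (OuterPath.uniq path) (cong inj₂ (⊆⇒≡ (f⊆g 1≤h))))))))
        where
        0-half : ∀ {k} → k + k ≡ 0 → k ≡ 0
        0-half {zero} _ = refl

  open Swap D K

  outside-edge? : ∀ x → (∃ λ y → OutY y × x ∈ᴱ y) ⊎ (∀ y → OutY y → x ∉ᴱ y)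
  outside-edge? x with find (λ y → inc x y ∧ not (does (_∈?_ Fin._≟_ y (applyUpTo e l))))
  ... | inj₁ (y , h) = inj₁ (y , out , proj₁ (∧-elim h))
    where
    out : OutY y
    out i eq with onY? y | _∈?_ Fin._≟_ y (applyUpTo e l) | proj₂ (∧-elim {inc x y} h)
    ... | inj₂ o | _ | _ = o i eq
    ... | inj₁ (j , j<l , eq′) | no y∉ | _ = y∉ (subst (_∈ applyUpTo e l) (sym eq′) (∈-applyUpTo⁺ e j<l))
  ... | inj₂ none = inj₂ λ y out x∈y → none y (∧-intro x∈y (absent y out))
    where
    absent : ∀ y → OutY y → not (does (_∈?_ Fin._≟_ y (applyUpTo e l))) ≡ true
    absent y out with _∈?_ Fin._≟_ y (applyUpTo e l)
    ... | no _ = refl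
    ... | yes y∈ with ∈-applyUpTo⁻ e y∈
    ...   | i , _ , eq = contradiction eq (out i)

  outside-vertex : ∃ OutX
  outside-vertex with Fin.any? (λ x → out? x)
    where
    out? : ∀ x → Dec (OutX x)
    out? x with onX? x
    ... | inj₁ (i , _ , eq) = no λ out → out i eq
    ... | inj₂ out = yes out
  ... | yes p = p
  ... | no ¬p = contradiction l<n (≤⇒≯ (≤-trans (≤-reflexive (sym (count-full {n} {λ _ → true} λ _ → refl)))
    (≤-trans (count-cover (λ _ → true) (λ _ → false) (applyUpTo v l) (λ x _ → cov x))
      (≤-reflexive (cong₂ _+_ (count-empty {n} {λ _ → false} λ _ ()) (length-applyUpTo v l))))))
    where
    cov : ∀ x → false ≡ true ⊎ x ∈ applyUpTo v l
    cov x with onX? x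
    ... | inj₁ (i , i<l , refl) = inj₂ (∈-applyUpTo⁺ v i<l)
    ... | inj₂ out = contradiction (x , out) ¬p

  outside-edge : ∃ OutY
  outside-edge with Fin.any? (λ y → out? y)
    where
    out? : ∀ y → Dec (OutY y)
    out? y with onY? y
    ... | inj₁ (i , _ , eq) = no λ out → out i eq
    ... | inj₂ out = yes out
  ... | yes p = p
  ... | no ¬p = contradiction l<m (≤⇒≯ (≤-trans (≤-reflexive (sym (count-full {m} {λ _ → true} λ _ → refl)))
    (≤-trans (count-cover (λ _ → true) (λ _ → false) (applyUpTo e l) (λ y _ → cov y))
      (≤-reflexive (cong₂ _+_ (count-empty {m} {λ _ → false} λ _ ()) (length-applyUpTo e l))))))
    where
    cov : ∀ y → false ≡ true ⊎ y ∈ applyUpTo e l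
    cov y with onY? y
    ... | inj₁ (i , i<l , refl) = inj₂ (∈-applyUpTo⁺ e i<l)
    ... | inj₂ out = contradiction (y , out) ¬p

  -- All `d` edges through `x` are on C and `f` has `r` vertices there, so the crossing count gives
  -- `r + d ≤ l + 1` and thereby the extremal equalities.
  no-outer-vertex : ∀ {f x} → OutY f → OutX x → r ≤ cnt (S f) → (∀ y → OutY y → x ∉ᴱ y) → ⊥
  no-outer-vertex {f} {x} out-f out-x r≤S alone = Isolated.isolated D K
      (out-lin₁₂ r d l n 1 bound ≤-refl n≤2r l<2d l<n)
      (≤-antisym (out-lin₁₃ r d l n 1 bound ≤-refl n≤2r l<2d l<n) (out-lin₁₄ r l n l<n n≤2r))
      (out-lin₁₅ r d l n 1 bound ≤-refl n≤2r l<2d l<n)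
      out-f out-x alone
    where
    d≤T : d ≤ cnt (T x)
    d≤T = subst (d ≤_) (+-identityʳ _) (deg-cover x [] λ y out x∈y → ⊥-elim (alone y out x∈y))
    bound : r + d ≤ l + 1
    bound = out-lin₁₆ (cnt (S f)) (cnt (T x)) (cnt (T² x)) r d l (crossing-count out-f out-x)
      (Forced.T<T² D K out-f out-x r≤S (≤-trans (≤-trans (s≤s z≤n) 2≤d) d≤T)) r≤S d≤T

  maximal-impossible : ∀ {f P g} (path : OuterPath (inj₂ f) P (inj₂ g)) →
    (∀ {a Q b} → OuterPath (inj₂ a) Q (inj₂ b) → length Q ≤ length P) → ⊥
  maximal-impossible {f} {P} {g} path maxP = neighbours (find (M.Z f)) (find (M.Z g))
    where
    module M = MaxPath path maxP
    -- With `h = 0` every outer edge alone is a longest path, so `f` may be traded for an outer edge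
    -- through an outer vertex, if there is one.
    short : (∀ x → ¬ M.Z f x ≡ true) → M.h ≡ 0 → ∃ OutX → ⊥
    short noZ h≡0 (x , out-x) = decide (outside-edge? x)
      where
      max₁ : ∀ {y} {a Q b} → OuterPath (inj₂ a) Q (inj₂ b) → length Q ≤ length (inj₂ {A = Fin n} {B = Fin m} y ∷ [])
      max₁ Q = ≤-trans (maxP Q) (≤-reflexive (trans M.length-P (cong (λ t → 1 + (t + t)) h≡0)))
      decide : (∃ λ y → OutY y × x ∈ᴱ y) ⊎ (∀ y → OutY y → x ∉ᴱ y) → ⊥
      decide (inj₁ (y , out-y , x∈y)) = M₁.no-outer-neighbour M₁.forward
          (∧-intro x∈y (M₁.off-intro out-x λ { (here ()) ; (there ()) }))
        where module M₁ = MaxPath (onePath (outsideY out-y)) (λ {a} {Q} {b} → max₁ {y} {a} {Q} {b})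
      decide (inj₂ alone) = no-outer-vertex (M.end-out M.forward) out-x
        (subst (r ≤_) (trans (cong₂ (λ s t → cnt (S f) + (s + t)) (count-empty noZ) h≡0) (+-identityʳ _)) (M.size-bound f)) alone
    neighbours : (∃ λ z → M.Z f z ≡ true) ⊎ (∀ x → ¬ M.Z f x ≡ true) →
                 (∃ λ z → M.Z g z ≡ true) ⊎ (∀ x → ¬ M.Z g x ≡ true) → ⊥
    neighbours (inj₁ (z , hz)) _ = M.no-outer-neighbour M.forward hz
    neighbours (inj₂ _) (inj₁ (z , hz)) = M.no-outer-neighbour (M.reverseEnd M.forward) hz
    neighbours (inj₂ noZf) (inj₂ noZg) with 1 ≤? M.h
    ... | yes 1≤h = M.no-long-path noZf noZg 1≤h
    ... | no h≱1 = short noZf (n≤0⇒n≡0 (s≤s⁻¹ (≰⇒> h≱1))) outside-vertex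

  -- A search for a longest path: a longer one has more vertices, these number at most `n`, and `k`
  -- bounds the improvements still possible.
  longer : ∀ k {f P g} → OuterPath (inj₂ f) P (inj₂ g) → n < k + length (xsOf P) → ⊥
  longer k {P = P} path n< = maximal-impossible path λ {a} {Q} {b} q → bounded k n< q (length Q ≤? length P)
    where
    len : ∀ {a Q b} → OuterPath (inj₂ a) Q (inj₂ b) → length Q ≡ 1 + (length (xsOf Q) + length (xsOf Q))
    len {Q = Q} q = trans (length-parts Q) (trans (cong (length (xsOf Q) +_) (balance-YY (OuterPath.walk q))) (+-suc _ _))
    xs≤n : ∀ {a Q b} → OuterPath (inj₂ a) Q (inj₂ b) → length (xsOf Q) ≤ n
    xs≤n q = ≤-trans (m≤n+m _ _) (≤-trans (count-pack {n} (λ _ → true) (λ _ → false) (Unique-xsOf (OuterPath.uniq q))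
      (λ _ _ → refl) (λ _ → refl) (λ _ ())) (count≤ {n} (λ _ → true)))
    bounded : ∀ k → n < k + length (xsOf P) → ∀ {a Q b} → OuterPath (inj₂ a) Q (inj₂ b) → Dec (length Q ≤ length P) → length Q ≤ length P
    bounded _ _ q (yes h) = h
    bounded zero n< q (no h) = contradiction (xs≤n path) (<⇒≱ n<)
    bounded (suc k) n< {Q = Q} q (no h) = ⊥-elim (longer k q
      (out-lin₂₃ n k (length (xsOf P)) (length (xsOf Q)) n<
        (out-lin₂₂ (length P) (length Q) _ _ (len path) (len q) (≰⇒> h))))

  impossible : ⊥
  impossible with outside-edge
  ... | f , out-f = longer (suc n) (onePath (outsideY out-f)) (m≤m+n (suc n) _)

-- Lists and cycles

module _ {A : Set} (z : A) where

  -- `z` is only a default beyond the end of the list; cycles read the list at indices reduced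
  -- modulo its length.
  nth : List A → ℕ → A
  nth []       k       = z
  nth (x ∷ xs) zero    = x
  nth (x ∷ xs) (suc k) = nth xs k

  nth∈ : ∀ xs {k} → k < length xs → nth xs k ∈ xs
  nth∈ (x ∷ xs) {zero}  _       = here refl
  nth∈ (x ∷ xs) {suc k} (s≤s h) = there (nth∈ xs h)

  nth-< : ∀ {xs} → Unique xs → ∀ {j k} → j < k → k < length xs → nth xs j ≢ nth xs k
  nth-< {x ∷ xs} (x∉ ∷ u) {zero}  {suc k} _       (s≤s h) = All.lookup x∉ (nth∈ xs h)
  nth-< {x ∷ xs} (x∉ ∷ u) {suc j} {suc k} (s≤s q) (s≤s h) = nth-< u q h

  nth-≢ : ∀ {xs} → Unique xs → ∀ {j k} → j < length xs → k < length xs → j ≢ k → nth xs j ≢ nth xs k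
  nth-≢ u {j} {k} hj hk j≢k with <-cmp j k
  ... | tri< j<k _ _ = nth-< u j<k hk
  ... | tri≈ _ eq _ = contradiction eq j≢k
  ... | tri> _ _ k<j = nth-< u k<j hj ∘ sym

module Residues (l : ℕ) .{{_ : NonZero l}} where

  %-step : ∀ k i → (k + i) % l ≡ (k + i % l) % l
  %-step k i = trans (cong (_% l) (trans (cong (k +_) (m≡m%n+[m/n]*n i l)) (sym (+-assoc k (i % l) (i / l * l)))))
    ([m+kn]%n≡m%n (k + i % l) (i / l) l)

  %-period : ∀ i → (l + i) % l ≡ i % l
  %-period i = trans (cong (_% l) (trans (+-comm l i) (cong (i +_) (sym (*-identityˡ l))))) ([m+kn]%n≡m%n i 1 l)

  %-≢ : ∀ i k → 0 < k → k < l → i % l ≢ (k + i) % l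
  %-≢ i k 0<k k<l eq with k + i % l <? l
  ... | yes h = <⇒≢ (+-monoˡ-< (i % l) 0<k) (trans eq (trans (%-step k i) (m<n⇒m%n≡m h)))
  ... | no h = <⇒≢ rest<a (sym (trans eq (trans (%-step k i) (trans (cong (_% l) (sym split)) (trans (%-period rest) (m<n⇒m%n≡m (<-trans rest<a (m%n<n i l))))))))
    where
    rest : ℕ
    rest = k + i % l ∸ l
    split : l + rest ≡ k + i % l
    split = m+[n∸m]≡n (≮⇒≥ h)
    rest<a : rest < i % l
    rest<a = +-cancelˡ-< l rest (i % l) (subst (_< l + i % l) (sym split) (+-monoˡ-< (i % l) k<l))

  %-suc : ∀ i → (suc (i % l) < l × suc i % l ≡ suc (i % l)) ⊎ (suc (i % l) ≡ l × suc i % l ≡ 0)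
  %-suc i with m≤n⇒m<n∨m≡n (m%n<n i l)
  ... | inj₁ h = inj₁ (h , trans (%-step 1 i) (m<n⇒m%n≡m h))
  ... | inj₂ h = inj₂ (h , trans (%-step 1 i) (trans (cong (_% l) h) (n%n≡0 l)))

module FromList {n m : ℕ} (inc : Fin n → Fin m → Bool) where
  open Incidence inc
  open Parts inc

  module _ (z : Fin n) (z' : Fin m) where

    first-vertex : ∀ {x L b} → Walk (inj₁ x) L b → nth z (xsOf L) 0 ≡ x
    first-vertex (single _) = refl
    first-vertex (_ ∷ _)    = refl

    here-nth : ∀ {x L y} → Walk (inj₁ x) L (inj₂ y) → ∀ k → k < length (ysOf L) →
      inc (nth z (xsOf L) k) (nth z' (ysOf L) k) ≡ true
    here-nth (_∷_ {w = inj₂ y} h (single _)) zero _ = h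
    here-nth (_∷_ {w = inj₂ y} h (_∷_ {w = inj₁ x} h' W)) zero _ = h
    here-nth (_∷_ {w = inj₂ y} h (_∷_ {w = inj₁ x} h' W)) (suc k) k< = here-nth W k (s≤s⁻¹ k<)
    here-nth (_∷_ {w = inj₂ y} h (single _)) (suc k) (s≤s ())
    here-nth (_∷_ {w = inj₁ x} () W)
    here-nth (_∷_ {w = inj₂ y} h (_∷_ {w = inj₂ y'} () W))

    next-nth : ∀ {x L y} → Walk (inj₁ x) L (inj₂ y) → ∀ k → suc k < length (ysOf L) →
      inc (nth z (xsOf L) (suc k)) (nth z' (ysOf L) k) ≡ true
    next-nth (_∷_ {w = inj₂ y} h (single _)) k (s≤s ())
    next-nth (_∷_ {w = inj₂ y} h (_∷_ {w = inj₁ x} h' W)) zero _ = subst (λ t → inc t y ≡ true) (sym (first-vertex W)) h'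
    next-nth (_∷_ {w = inj₂ y} h (_∷_ {w = inj₁ x} h' W)) (suc k) k< = next-nth W k (s≤s⁻¹ k<)
    next-nth (_∷_ {w = inj₁ x} () W)
    next-nth (_∷_ {w = inj₂ y} h (_∷_ {w = inj₂ y'} () W))

    last-edge : ∀ {x L y} → Walk (inj₁ x) L (inj₂ y) → ∀ k → suc k ≡ length (ysOf L) → nth z' (ysOf L) k ≡ y
    last-edge (_∷_ {w = inj₂ y} h (single _)) zero _ = refl
    last-edge (_∷_ {w = inj₂ y} h (_∷_ {w = inj₁ x} h' W)) (suc k) eq = last-edge W k (suc-injective eq)
    last-edge (_∷_ {w = inj₂ y} h (_∷_ {w = inj₁ x} h' W)) zero eq = contradiction (suc-injective eq) (nonempty W)
      where
      nonempty : ∀ {x L y} → Walk (inj₁ x) L (inj₂ y) → 0 ≢ length (ysOf L)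
      nonempty (_∷_ {w = inj₂ y} h (single _)) ()
      nonempty (_∷_ {w = inj₂ y} h (_ ∷ _)) ()
      nonempty (_∷_ {w = inj₁ x} () W)
    last-edge (_∷_ {w = inj₁ x} () W)
    last-edge (_∷_ {w = inj₂ y} h (_∷_ {w = inj₂ y'} () W))

  fromXY : ∀ {x L y} → Walk (inj₁ x) L (inj₂ y) → inc x y ≡ true → Unique L → ∃ λ l → double l ≡ length L × Cycle l
  fromXY {x} {L} {y} W close U = l , trans (double≡ l) (trans (cong (_+ l) balanced) (sym (length-parts L))) , record
    { v = λ i → nth x (xsOf L) (i % l) ; e = λ i → nth y (ysOf L) (i % l)
    ; per-v = λ i → cong (nth x (xsOf L)) (%-period i) ; per-e = λ i → cong (nth y (ysOf L)) (%-period i)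
    ; inj-v = λ i k 0<k k<l → nth-≢ x (Unique-xsOf U) (in-xs i) (in-xs (k + i)) (%-≢ i k 0<k k<l)
    ; inj-e = λ i k 0<k k<l → nth-≢ y (Unique-ysOf U) (m%n<n i l) (m%n<n (k + i) l) (%-≢ i k 0<k k<l)
    ; here∈ = λ i → here-nth x y W (i % l) (m%n<n i l)
    ; next∈ = closing }
    where
    l : ℕ
    l = length (ysOf L)
    balanced : l ≡ length (xsOf L)
    balanced = balance-XY W
    positive : 0 < l
    positive = ≤-trans (s≤s z≤n) (nonempty (∈-ysOf⁺ L (last∈ W)))
      where
      nonempty : ∀ {w} {K : List (Fin m)} → w ∈ K → 0 < length K
      nonempty (here _)  = s≤s z≤n
      nonempty (there _) = s≤s z≤n
    instance
      l-nonZero : NonZero l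
      l-nonZero = >-nonZero positive
    open Residues l
    in-xs : ∀ i → i % l < length (xsOf L)
    in-xs i = subst (i % l <_) balanced (m%n<n i l)
    closing : ∀ i → inc (nth x (xsOf L) (suc i % l)) (nth y (ysOf L) (i % l)) ≡ true
    closing i with %-suc i
    ... | inj₁ (h , eq) = subst (λ t → inc (nth x (xsOf L) t) (nth y (ysOf L) (i % l)) ≡ true) (sym eq) (next-nth x y W (i % l) h)
    ... | inj₂ (h , eq) = subst₂ (λ s t → inc s t ≡ true)
      (sym (trans (cong (nth x (xsOf L)) eq) (first-vertex x y W))) (sym (last-edge x y W (i % l) h)) close

  fromList : ∀ {a L b} → Walk a L b → b ~ a → Unique L → ∃ λ l → double l ≡ length L × Cycle l
  fromList {inj₁ x} {L} {inj₂ y} W close U = fromXY W close U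
  -- Reversal makes the closed walk start at a vertex and end at an edge.
  fromList {inj₂ y} {L} {inj₁ x} W close U with fromXY (walk-reverse W) close (Unique-reverse U)
  ... | l , eq , C = l , trans eq (length-reverse L) , C
  fromList {inj₁ x} {L} {inj₁ x'} W () U
  fromList {inj₂ y} {L} {inj₂ y'} W () U

  toList : ∀ {l} → 0 < l → Cycle l → ∃ λ a → ∃ λ L → ∃ λ b → Walk a L b × b ~ a × Unique L × length L ≡ double l
  toList {suc l} _ C = c 0 , arc 0 N , c (suc (double l) + 0) , walk-arc 0 (suc (double l)) ,
      subst (c (suc (double l) + 0) ~_) (c-per 0) (c-adj (suc (double l) + 0)) , arc-unique 0 N ≤-refl , length-arc 0 N
    where open OnCycle C

-- Deciding the existence of closed walks

module Search {n m : ℕ} (inc : Fin n → Fin m → Bool) where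
  open Incidence inc

  _~?_ : ∀ u w → Dec (u ~ w)
  inj₁ x ~? inj₂ y = inc x y Bool.≟ true
  inj₂ y ~? inj₁ x = inc x y Bool.≟ true
  inj₁ _ ~? inj₁ _ = no λ ()
  inj₂ _ ~? inj₂ _ = no λ ()

  ClosedWalk : List Node → Set
  ClosedWalk L = ∃ λ a → ∃ λ b → Walk a L b × b ~ a × Unique L

  walk? : ∀ a L z → Dec (∃ λ b → Walk a (a ∷ L) b × b ~ z)
  walk? a [] z = map′ (λ h → a , single a , h) (λ { (_ , single _ , h) → h }) (a ~? z)
  walk? a (u ∷ L) z = map′ (λ { (h , b , W , q) → b , h ∷ W , q }) from (a ~? u ×-dec walk? u L z)
    where
    from : (∃ λ b → Walk a (a ∷ u ∷ L) b × b ~ z) → a ~ u × (∃ λ b → Walk u (u ∷ L) b × b ~ z)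
    from (b , (h ∷ single _) , q) = h , b , single _ , q
    from (b , (h ∷ (h' ∷ W)) , q) = h , b , (h' ∷ W) , q

  closedWalk? : ∀ L → Dec (ClosedWalk L)
  closedWalk? [] = no λ { (_ , _ , () , _) }
  closedWalk? (a ∷ L) = map′ (λ { ((b , W , q) , U) → a , b , W , q , U }) from (walk? a L a ×-dec unique? _≟ᴺ_ (a ∷ L))
    where
    from : ClosedWalk (a ∷ L) → (∃ λ b → Walk a (a ∷ L) b × b ~ a) × Unique (a ∷ L)
    from (_ , b , single _ , q , U) = (b , single _ , q) , U
    from (_ , b , (h ∷ W) , q , U) = (b , (h ∷ W) , q) , U

  -- There are finitely many nodes, so lists of length `j` are searched by their first entry.
  list? : ∀ j {Q : List Node → Set} → (∀ L → Dec (Q L)) → Dec (∃ λ L → length L ≡ j × Q L)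
  list? zero Q? = map′ (λ q → [] , refl , q) (λ { ([] , _ , q) → q }) (Q? [])
  list? (suc j) {Q} Q? = map′ to from
      (Fin.any? (λ x → list? j (λ L → Q? (inj₁ x ∷ L))) ⊎-dec Fin.any? (λ y → list? j (λ L → Q? (inj₂ y ∷ L))))
    where
    to : (∃ λ x → ∃ λ L → length L ≡ j × Q (inj₁ x ∷ L)) ⊎ (∃ λ y → ∃ λ L → length L ≡ j × Q (inj₂ y ∷ L)) →
         ∃ λ L → length L ≡ suc j × Q L
    to (inj₁ (x , L , eq , q)) = inj₁ x ∷ L , cong suc eq , q
    to (inj₂ (y , L , eq , q)) = inj₂ y ∷ L , cong suc eq , q
    from : (∃ λ L → length L ≡ suc j × Q L) →
           (∃ λ x → ∃ λ L → length L ≡ j × Q (inj₁ x ∷ L)) ⊎ (∃ λ y → ∃ λ L → length L ≡ j × Q (inj₂ y ∷ L))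
    from (inj₁ x ∷ L , eq , q) = inj₁ (x , L , suc-injective eq , q)
    from (inj₂ y ∷ L , eq , q) = inj₂ (y , L , suc-injective eq , q)

-- A first cycle

module Existence {n m r d : ℕ} (D : Design n m r d) where
  open Edges D
  open Search inc
  open FromList inc

  two-cycle : ∀ {x x' y y'} → x ≢ x' → y ≢ y' → x ∈ᴱ y → x' ∈ᴱ y → x ∈ᴱ y' → x' ∈ᴱ y' → ∃ λ l → 2 ≤ l × Cycle l
  two-cycle {x} {x'} {y} {y'} x≢x' y≢y' h₁ h₂ h₃ h₄ = size₂ (fromList
      {L = inj₁ x ∷ inj₂ y ∷ inj₁ x' ∷ inj₂ y' ∷ []} (h₁ ∷ h₂ ∷ h₄ ∷ single (inj₂ y')) h₃
      (((λ ()) ∷ (x≢x' ∘ Sum.inj₁-injective) ∷ (λ ()) ∷ []) ∷ ((λ ()) ∷ (y≢y' ∘ Sum.inj₂-injective) ∷ []) ∷ ((λ ()) ∷ []) ∷ [] ∷ []))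
    where
    size₂ : (∃ λ l → double l ≡ 4 × Cycle l) → ∃ λ l → 2 ≤ l × Cycle l
    size₂ (suc (suc l) , _ , C) = suc (suc l) , s≤s (s≤s z≤n) , C

  three-cycle : ∀ {x y z e g f} → x ≢ y → x ≢ z → y ≢ z → e ≢ g → e ≢ f → g ≢ f →
    x ∈ᴱ e → y ∈ᴱ e → y ∈ᴱ g → z ∈ᴱ g → z ∈ᴱ f → x ∈ᴱ f → ∃ λ l → 2 ≤ l × Cycle l
  three-cycle {x} {y} {z} {e} {g} {f} x≢y x≢z y≢z e≢g e≢f g≢f h₁ h₂ h₃ h₄ h₅ h₆ = size₃ (fromList
      {L = inj₁ x ∷ inj₂ e ∷ inj₁ y ∷ inj₂ g ∷ inj₁ z ∷ inj₂ f ∷ []} (h₁ ∷ h₂ ∷ h₃ ∷ h₄ ∷ h₅ ∷ single (inj₂ f)) h₆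
      (((λ ()) ∷ (x≢y ∘ Sum.inj₁-injective) ∷ (λ ()) ∷ (x≢z ∘ Sum.inj₁-injective) ∷ (λ ()) ∷ []) ∷
       ((λ ()) ∷ (e≢g ∘ Sum.inj₂-injective) ∷ (λ ()) ∷ (e≢f ∘ Sum.inj₂-injective) ∷ []) ∷
       ((λ ()) ∷ (y≢z ∘ Sum.inj₁-injective) ∷ (λ ()) ∷ []) ∷
       ((λ ()) ∷ (g≢f ∘ Sum.inj₂-injective) ∷ []) ∷ ((λ ()) ∷ []) ∷ [] ∷ []))
    where
    size₃ : (∃ λ l → double l ≡ 6 × Cycle l) → ∃ λ l → 2 ≤ l × Cycle l
    size₃ (suc (suc l) , _ , C) = suc (suc l) , s≤s (s≤s z≤n) , C

  -- Take edges `e` and `f` through `x`, vertices `y`, `y'` of `e`, and another edge `g` through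
  -- `y`. If no two of the edges share two of these vertices and `g` meets `f`, there is a triangle.
  -- If `g` misses `f`, they are complementary, so `y'`, not in `f`, is a second common vertex of
  -- `g` and `e`.
  initial : 2 ≤ d → Fin m → Fin n → ∃ λ l → 2 ≤ l × Cycle l
  initial 2≤d f₀ x with another 2≤d x f₀
  ... | e , _ , x∈e with another 2≤d x e
  ...   | f , f≢e , x∈f with count-witness₂ (remove x (λ w → inc w e)) two
    where
    two : 2 ≤ count (remove x (λ w → inc w e))
    two = s≤s⁻¹ (≤-trans 3≤r (≤-trans (≤-reflexive (trans (sym (size e)) (count-remove x (λ w → inc w e)))) (+-monoˡ-≤ _ (bit≤1 (inc x e)))))
  ...     | y , y' , y≢y' , ry , ry' = cases (y ∈ᴱ? f) (y' ∈ᴱ? f) (another 2≤d y e)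
    where
    y≢x : y ≢ x
    y≢x = proj₁ (remove-elim x (λ w → inc w e) y ry)
    y∈e : y ∈ᴱ e
    y∈e = proj₂ (remove-elim x (λ w → inc w e) y ry)
    y'≢x : y' ≢ x
    y'≢x = proj₁ (remove-elim x (λ w → inc w e) y' ry')
    y'∈e : y' ∈ᴱ e
    y'∈e = proj₂ (remove-elim x (λ w → inc w e) y' ry')
    cases : Dec (y ∈ᴱ f) → Dec (y' ∈ᴱ f) → (∃ λ g → g ≢ e × y ∈ᴱ g) → ∃ λ l → 2 ≤ l × Cycle l
    cases (yes h) _ _ = two-cycle (y≢x ∘ sym) (f≢e ∘ sym) x∈e y∈e x∈f h
    cases (no _) (yes h) _ = two-cycle (y'≢x ∘ sym) (f≢e ∘ sym) x∈e y'∈e x∈f h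
    cases (no y∉f) (no y'∉f) (g , g≢e , y∈g) with x ∈ᴱ? g
    ... | yes x∈g = two-cycle (y≢x ∘ sym) (g≢e ∘ sym) x∈e y∈e x∈g y∈g
    ... | no x∉g with find (λ w → inc w g ∧ inc w f)
    ...   | inj₁ (w , h) = three-cycle (y≢x ∘ sym) (λ { refl → x∉g (proj₁ (∧-elim h)) }) (λ { refl → y∉f (proj₂ (∧-elim {inc y g} h)) })
              (g≢e ∘ sym) (f≢e ∘ sym) (λ { refl → y∉f y∈g })
              x∈e y∈e y∈g (proj₁ (∧-elim h)) (proj₂ (∧-elim {inc w g} h)) x∈f
    ...   | inj₂ none with y' ∈ᴱ? g
    ...     | yes y'∈g = two-cycle y≢y' (g≢e ∘ sym) y∈e y'∈e y∈g y'∈g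
    ...     | no y'∉g = ⊥-elim (covered {g} {f} (λ w w∈g w∈f → none w (∧-intro w∈g w∈f)) y' y'∉g y'∉f)

-- From the contradiction to a long cycle

abstract
  top-lin₁ : ∀ (n f j l : ℕ) → n < (1 + f) + l → l < j → n < f + j
  top-lin₁ n f j l h₁ h₂ = ≮⇒≥ λ neg → infeasible (n ∷ f ∷ j ∷ l ∷ [])
    ((con 1 ⊕ var 0) ⊕ ((con 1 ⊕ var 3) ⊕ (con 1 ⊕ (var 1 ⊕ var 2))))
    (((con 1 ⊕ var 1) ⊕ var 3) ⊕ (var 2 ⊕ (con 1 ⊕ var 0)))
    (con 0) refl (+-mono-≤ h₁ (+-mono-≤ h₂ neg))

  top-lin₂ : ∀ (l k d : ℕ) → l < k → k ≤ d + d → l < d + d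
  top-lin₂ l k d h₁ h₂ = ≮⇒≥ λ neg → infeasible (l ∷ k ∷ d ∷ [])
    ((con 1 ⊕ var 0) ⊕ (var 1 ⊕ (con 1 ⊕ (var 2 ⊕ var 2))))
    (var 1 ⊕ ((var 2 ⊕ var 2) ⊕ (con 1 ⊕ var 0)))
    (con 0) refl (+-mono-≤ h₁ (+-mono-≤ h₂ neg))

module Extremal {n m r d : ℕ} (D : Design n m r d) where
  open Edges D
  open Search inc
  open FromList inc

  cycle≤n : ∀ {l} → Cycle l → l ≤ n
  cycle≤n {l} C = subst (_≤ n) (length-applyUpTo v l) (≤-trans (m≤n+m _ _) (≤-trans
    (count-pack {n} (λ _ → true) (λ _ → false) {applyUpTo v l}
      (Unique.applyUpTo⁺₁ v l λ {i} {j} i<j j<l eq → inj-v i (j ∸ i) (m<n⇒0<n∸m i<j) (≤-<-trans (m∸n≤m j i) j<l)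
        (trans eq (cong v (sym (m∸n+n≡m (<⇒≤ i<j))))))
      (λ _ _ → refl) (λ _ → refl) (λ _ ())) (count≤ {n} (λ _ → true))))
    where open Cycle C

  module _ {k : ℕ} (k≤n : k ≤ n) (k≤m : k ≤ m) (k≤2d : k ≤ d + d) (short : ∀ {l} → Cycle l → l < k) where

    -- A cycle that is not longest is replaced by a longer one; lengths stay at most `n`, so `fuel`
    -- suffices.
    no-cycle : ∀ fuel {l} → 2 ≤ l → Cycle l → n < fuel + l → ⊥
    no-cycle zero 2≤l C n< = <⇒≱ n< (cycle≤n C)
    no-cycle (suc fuel) {l} 2≤l C n< = OuterPaths.impossible D (record
      { C = C ; 2≤l = 2≤l ; max = λ {a} {L} {b} W close U → bounded W close U (length L ≤? double l)
      ; l<n = <-≤-trans (short C) k≤n ; l<m = <-≤-trans (short C) k≤m ; l<2d = top-lin₂ l k d (short C) k≤2d })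
      where
      bounded : ∀ {a L b} → Walk a L b → b ~ a → Unique L → Dec (length L ≤ double l) → length L ≤ double l
      bounded W close U (yes h) = h
      bounded {L = L} W close U (no h) = ⊥-elim (recurse (fromList W close U))
        where
        recurse : (∃ λ l' → double l' ≡ length L × Cycle l') → ⊥
        recurse (l' , eq , C') = no-cycle fuel (≤-trans 2≤l (<⇒≤ l<l')) C' (top-lin₁ n fuel l' l n< l<l')
          where
          l<l' : l < l'
          l<l' = double-cancel-< (subst (double l <_) (sym eq) (≰⇒> h))

  -- Deciding this makes the indirect argument constructive. Cycles have at most `n` vertices, so
  -- finitely many lengths are searched.
  long? : ∀ k → Dec (∃ λ l → l < suc n × k ≤ l × ∃ λ L → length L ≡ double l × ClosedWalk L)
  long? k = anyUpTo? (λ l → (k ≤? l) ×-dec list? (double l) closedWalk?) (suc n)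

  long-cycle : ∀ {k} → 0 < k → k ≤ n → k ≤ m → k ≤ d + d → (∃ λ l → 2 ≤ l × Cycle l) → ∃ λ l → k ≤ l × Cycle l
  long-cycle {k} 0<k k≤n k≤m k≤2d (l₀ , 2≤l₀ , C₀) with long? k
  ... | yes (l , _ , k≤l , L , len , a , b , W , close , U) = resize (fromList W close U)
    where
    resize : (∃ λ l' → double l' ≡ length L × Cycle l') → ∃ λ l → k ≤ l × Cycle l
    resize (l' , eq , C) = l' , ≤-trans k≤l (≮⇒≥ λ l'<l → <⇒≢ (double-strict l'<l) (trans eq len)) , C
      where
      double-strict : ∀ {i j} → i < j → double i < double j
      double-strict {zero}  (s≤s _) = s≤s z≤n
      double-strict {suc i} (s≤s h) = s≤s (s≤s (double-strict h))
  ... | no ¬long = ⊥-elim (no-cycle k≤n k≤m k≤2d short (suc n) 2≤l₀ C₀ (m≤m+n (suc n) l₀))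
    where
    short : ∀ {l} → Cycle l → l < k
    short {l} C with k ≤? l
    ... | no h = ≰⇒> h
    ... | yes k≤l with toList (<-≤-trans 0<k k≤l) C
    ...   | a , L , b , W , close , U , len = ⊥-elim (¬long (l , s≤s (cycle≤n C) , k≤l , L , len , a , b , W , close , U))

-- From the hypergraph to its incidence relation

does⇒ : ∀ {P : Set} (p? : Dec P) → does p? ≡ true → P
does⇒ (yes p) _ = p

⇒does : ∀ {P : Set} (p? : Dec P) → P → does p? ≡ true
⇒does (yes _) _ = refl
⇒does (no ¬p) p = contradiction p ¬p

count-subset : ∀ {k} (q : Subset k) → count (λ x → does (x Subset.∈? q)) ≡ ∣ q ∣
count-subset Vec.[]            = refl
count-subset (true  Vec.∷ q) = cong suc (count-subset q)
count-subset (false Vec.∷ q) = count-subset q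

count-tabulate : ∀ {k} (f : Fin k → Bool) → ∣ Vec.tabulate f ∣ ≡ count f
count-tabulate {zero}  f = refl
count-tabulate {suc k} f with f Fin.zero
... | true  = cong suc (count-tabulate (f ∘ Fin.suc))
... | false = count-tabulate (f ∘ Fin.suc)

total : ∀ {k} → (Fin k → ℕ) → ℕ
total {zero}  f = 0
total {suc k} f = f Fin.zero + total (f ∘ Fin.suc)

total-+ : ∀ {k} (f g : Fin k → ℕ) → total (λ x → f x + g x) ≡ total f + total g
total-+ {zero}  f g = refl
total-+ {suc k} f g = trans (cong (f Fin.zero + g Fin.zero +_) (total-+ (f ∘ Fin.suc) (g ∘ Fin.suc)))
  (interchange (f Fin.zero) (g Fin.zero) _ _)

total-bit : ∀ {k} (f : Fin k → Bool) → total (bit ∘ f) ≡ count f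
total-bit {zero}  f = refl
total-bit {suc k} f = cong (bit (f Fin.zero) +_) (total-bit (f ∘ Fin.suc))

total-zero : ∀ {k} → total {k} (λ _ → 0) ≡ 0
total-zero {zero}  = refl
total-zero {suc k} = total-zero {k}

double-count : ∀ {n m} (inc : Fin n → Fin m → Bool) →
  total (λ x → count (inc x)) ≡ total (λ y → count (λ x → inc x y))
double-count {zero}  {m} inc = sym (total-zero {m})
double-count {suc n} inc = trans
  (cong₂ _+_ (sym (total-bit (inc Fin.zero))) (double-count (inc ∘ Fin.suc)))
  (sym (total-+ (bit ∘ inc Fin.zero) (λ y → count (λ x → inc (Fin.suc x) y))))

total-≥ : ∀ {k c} (f : Fin k → ℕ) → (∀ x → c ≤ f x) → k * c ≤ total f
total-≥ {zero}  f h = z≤n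
total-≥ {suc k} f h = +-mono-≤ (h Fin.zero) (total-≥ (f ∘ Fin.suc) (h ∘ Fin.suc))

total-≤ : ∀ {k c} (f : Fin k → ℕ) → (∀ x → f x ≤ c) → total f ≤ k * c
total-≤ {zero}  f h = z≤n
total-≤ {suc k} f h = +-mono-≤ (h Fin.zero) (total-≤ (f ∘ Fin.suc) (h ∘ Fin.suc))

/-bound : ∀ a b .{{_ : NonZero b}} → a < b * (a / b + 1)
/-bound a b = subst₂ _<_ (sym (m≡m%n+[m/n]*n a b)) (rearrange b (a / b)) (+-monoˡ-< (a / b * b) (m%n<n a b))
  where
  rearrange : ∀ b q → b + q * b ≡ b * (q + 1)
  rearrange = solve-∀

module _ {n r : ℕ} (H : UniformHypergraph n r) where

  incidence : Fin n → Fin (m H) → Bool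
  incidence x y = does (x Subset.∈? edge H y)

  edge-size : ∀ y → count (λ x → incidence x y) ≡ r
  edge-size y = trans (count-subset (edge H y)) (uniform H y)

  edge-ext : ∀ y y' → (∀ x → incidence x y ≡ incidence x y') → y ≡ y'
  edge-ext y y' h = distinct H (Subset.⊆-antisym
    (λ {x} p → does⇒ (x Subset.∈? edge H y') (trans (sym (h x)) (⇒does (x Subset.∈? edge H y) p)))
    (λ {x} p → does⇒ (x Subset.∈? edge H y) (trans (h x) (⇒does (x Subset.∈? edge H y') p))))

  toBerge : ∀ {l} → Incidence.Cycle incidence l → BergeCycle H l
  toBerge {l} C = record
    { vtx = v ∘ toℕ ; edg = e ∘ toℕ
    ; vtx-inj = inject v inj-v ; edg-inj = inject e inj-e
    ; here∈ = λ i → does⇒ (_ Subset.∈? _) (here∈ (toℕ i))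
    ; next∈ = λ i → does⇒ (_ Subset.∈? _) (subst (λ x → incidence x (e (toℕ i)) ≡ true) (sym (v-next i)) (next∈ (toℕ i))) }
    where
    open Incidence.Cycle C
    inject : ∀ {A : Set} (g : ℕ → A) → (∀ i k → 0 < k → k < l → g i ≢ g (k + i)) →
      ∀ {i j : Fin l} → g (toℕ i) ≡ g (toℕ j) → i ≡ j
    inject g inj {i} {j} eq with <-cmp (toℕ i) (toℕ j)
    ... | tri≈ _ h _ = Fin.toℕ-injective h
    ... | tri< i<j _ _ = contradiction (trans eq (cong g (sym (m∸n+n≡m (<⇒≤ i<j)))))
      (inj (toℕ i) (toℕ j ∸ toℕ i) (m<n⇒0<n∸m i<j) (≤-<-trans (m∸n≤m (toℕ j) (toℕ i)) (Fin.toℕ<n j)))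
    ... | tri> _ _ j<i = contradiction (trans (sym eq) (cong g (sym (m∸n+n≡m (<⇒≤ j<i)))))
      (inj (toℕ j) (toℕ i ∸ toℕ j) (m<n⇒0<n∸m j<i) (≤-<-trans (m∸n≤m (toℕ i) (toℕ j)) (Fin.toℕ<n i)))
    v-* : ∀ k t → v (k * l + t) ≡ v t
    v-* zero    t = refl
    v-* (suc k) t = trans (cong v (+-assoc l (k * l) t)) (trans (per-v (k * l + t)) (v-* k t))
    v-mod : ∀ .{{_ : NonZero l}} i → v (i % l) ≡ v i
    v-mod i = sym (trans (cong v (trans (m≡m%n+[m/n]*n i l) (+-comm (i % l) _))) (v-* (i / l) (i % l)))
    v-next : ∀ (i : Fin l) → v (toℕ (next i)) ≡ v (suc (toℕ i))
    v-next i = lemma l i v-mod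
      where
      -- The length is generalised so that matching on `suc l` lets `next` reduce.
      lemma : ∀ l (i : Fin l) → (∀ .{{_ : NonZero l}} i → v (i % l) ≡ v i) → v (toℕ (next i)) ≡ v (suc (toℕ i))
      lemma (suc l) i h = trans (cong v (Fin.toℕ-fromℕ< (m%n<n (suc (toℕ i)) (suc l)))) (h (suc (toℕ i)))

abstract
  main-lin₁ : ∀ (k d : ℕ) → 3 ≤ k → k ≤ d + d → 2 ≤ d
  main-lin₁ k d h₁ h₂ = ≮⇒≥ λ neg → infeasible (k ∷ d ∷ [])
    (con 3 ⊕ (var 0 ⊕ ((con 1 ⊕ var 1) ⊕ (con 1 ⊕ var 1))))
    (var 0 ⊕ ((var 1 ⊕ var 1) ⊕ (con 2 ⊕ con 2)))
    (con 0) refl (+-mono-≤ h₁ (+-mono-≤ h₂ (+-mono-≤ neg neg)))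

theorem1p8 : (n k r : ℕ) → .{{_ : NonZero n}} → 3 ≤ r → r ≤ k → k ≤ n →
    (n ∸ 1) / 2 < r →
    (H : UniformHypergraph n r) →
    MinDegreeAtLeast H ((r * (k ∸ 1)) / n + 1) →
    HasLongBergeCycle H k
theorem1p8 n k r 3≤r r≤k k≤n t<r H δ = finish
    (Extremal.long-cycle D (≤-trans (s≤s z≤n) 3≤k) k≤n k≤m k≤2d
      (Existence.initial D (main-lin₁ k d 3≤k k≤2d) (fromℕ< (≤-trans (≤-trans (s≤s z≤n) 3≤k) k≤m)) (fromℕ< (≤-trans (≤-trans (s≤s z≤n) 3≤k) k≤n))))
  where
  d : ℕ
  d = (r * (k ∸ 1)) / n + 1
  3≤k : 3 ≤ k
  3≤k = ≤-trans 3≤r r≤k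
  suc-k : suc (k ∸ 1) ≡ k
  suc-k = m+[n∸m]≡n (≤-trans (s≤s z≤n) 3≤k)
  n≤2r : n ≤ r + r
  -- `n - 1` is less than twice `(n - 1) / 2 + 1`, which the hypothesis on `r` bounds by `r`.
  n≤2r = subst (_≤ r + r) (m+[n∸m]≡n (≤-trans (≤-trans (s≤s z≤n) 3≤k) k≤n))
    (≤-trans (/-bound (n ∸ 1) 2) (subst (_≤ r + r) (sym (cong₂ _+_ (+-comm ((n ∸ 1) / 2) 1) (trans (+-identityʳ _) (+-comm ((n ∸ 1) / 2) 1)))) (+-mono-≤ t<r t<r)))
  D : Design n (m H) r d
  D = record { inc = incidence H ; size = edge-size H
             ; deg = λ x → subst (d ≤_) (count-tabulate (incidence H x)) (δ x)
             ; ext = edge-ext H ; n≤2r = n≤2r ; 3≤r = 3≤r }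
  instance
    r-nonZero : NonZero r
    r-nonZero = >-nonZero (≤-trans (s≤s z≤n) 3≤r)
  -- The one use of the exact degree bound: `n ≤ 2 r` turns it into `k - 1 < 2 d`, and counting
  -- incidences turns it into `k - 1 < m H`.
  average : r * (k ∸ 1) < n * d
  average = /-bound (r * (k ∸ 1)) n
  k≤2d : k ≤ d + d
  k≤2d = subst (_≤ d + d) suc-k (*-cancelˡ-< r (k ∸ 1) (d + d)
    (<-≤-trans average (≤-trans (*-monoˡ-≤ d n≤2r) (≤-reflexive (rearrange r d)))))
    where
    rearrange : ∀ r d → (r + r) * d ≡ r * (d + d)
    rearrange = solve-∀
  k≤m : k ≤ m H
  k≤m = subst (_≤ m H) suc-k (*-cancelˡ-< r (k ∸ 1) (m H)
    (<-≤-trans average (≤-trans (total-≥ (λ x → count (incidence H x)) (Design.deg D))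
      (≤-trans (≤-reflexive (double-count (incidence H)))
        (≤-trans (total-≤ (λ y → count (λ x → incidence H x y)) (λ y → ≤-reflexive (edge-size H y))) (≤-reflexive (*-comm (m H) r)))))))
  finish : (∃ λ l → k ≤ l × Incidence.Cycle (incidence H) l) → HasLongBergeCycle H k
  finish (l , k≤l , C) = l , k≤l , toBerge H C
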